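{- Let $n\ge 1$ and let $D=(D_1,\ldots,D_n)$ be a diagram, i.e. each $D_j\subseteq[n]$. The following conditions are equivalent: (1) The Schubitope $\mathcal{S}_D$ is lattice-free; (2) for all $1\le i<j\le n$, $|M(D_i)\cap M(D_j)|\le 1$; (3) for all integers $t\ge 0$, $$ i(\mathcal{S}_D,t)=\prod_{j=1}^n i\big(P(SM_n(D_j)),t\big).$$
   Context: A diagram $D$ is a set of boxes in the $n\times n$ grid, box $(i,j)$ being in row $i$ (from the top) and column $j$; it is recorded as $D=(D_1,\ldots,D_n)$ with $D_j=\{i:(i,j)\in D\}\subseteq[n]$, and $\#D=\sum_j|D_j|$. For $a\le b$ write $[a,b]=\{a,a+1,\ldots,b\}$. The movable interval $M(D_j)$ of column $D_j$ is defined as follows: if $D_j\ne[n]$, let $a=\min([n]\setminus D_j)$ (topmost row without a box) and $b=\max D_j$ (bottommost row with a box, if $D_j\neq\emptyset$); then $M(D_j)=[a,b]$ if $D_j\neq\emptyset$ and $a<b$, and $M(D_j)=\emptyset$ otherwise. Schubitope: for $I\subseteq[n]$ and column $j$, form the word $\mathrm{word}_I(D_j)$ by reading rows $i=1,\ldots,n$ top to bottom and recording "(" if $i\notin D_j, i\in I$; ")" if $i\in D_j, i\notin I$; "$\star$" if $i\in D_j, i\in I$ (nothing otherwise). Let $\theta_{D_j}(I)$ be the number of matched pairs of parentheses in this word plus the number of $\star$'s, and $\theta_D(I)=\sum_{j=1}^n\theta_{D_j}(I)$. Then $\mathcal{S}_D=\{\alpha\in\mathbb{R}_{\ge0}^n:\sum_i\alpha_i=\#D,\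 \sum_{i\in I}\alpha_i\le\theta_D(I)\ \forall I\subseteq[n]\}$. (It is known, by Fink–Mészáros–St. Dizier, that $\mathcal{S}_D=P(SM_n(D_1))+\cdots+P(SM_n(D_n))$, Minkowski sum.) Schubert matroid: for $S\subseteq[n]$, $SM_n(S)$ is the matroid on $[n]$ whose bases are the $T\subseteq[n]$ with $T\preceq S$ in Gale order: $|T|=|S|$ and, writing $T=\{a_1<\cdots<a_k\}$, $S=\{b_1<\cdots<b_k\}$, $a_i\le b_i$ for all $i$. Its matroid (base) polytope is $P(SM_n(S))=\mathrm{conv}\{\mathbf e_B: B \text{ a basis}\}$, where $\mathbf e_B=\sum_{b\in B}\mathbf e_b$ is the indicator vector. A polytope $P\subset\mathbb{R}^n$ is lattice-free if $P\cap\mathbb{Z}^n$ equals its vertex set. For a polytope $P$, $i(P,t)=|tP\cap\mathbb{Z}^n|$ (its Ehrhart polynomial when $P$ is integral); by convention the Ehrhart polynomial of the empty set is $1$.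
   Formalization: The Schubitope, the matroid polytopes and their vertices are taken among points with rational instead of real coordinates (a vertex is an extreme point among the rational points), which gives the same vertices and lattice points because these polytopes have rational data. -}

module Defs where

open import Data.Bool using (Bool; true; false; if_then_else_; _∧_; not)
open import Data.Nat as ℕ using (ℕ; zero; suc)
open import Data.Integer as ℤ using (ℤ)
open import Data.Rational as ℚ using (ℚ; 0ℚ; 1ℚ)
open import Data.Fin using (Fin; toℕ)
open import Data.Fin.Subset using (Subset; _∈_; _∉_; _∩_; ∣_∣)
open import Data.Vec using (Vec; []; _∷_; lookup; tabulate; map; zip; toList)
open import Data.List as L using (List; []; _∷_; length; _++_)
open import Data.List.Relation.Unary.Unique.Propositional using (Unique)
open import Data.List.Membership.Propositional as LM using ()
open import Data.List.Relation.Binary.Pointwise using (Pointwise)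
open import Data.Maybe using (Maybe; just; nothing)
open import Data.Product using (Σ; _×_; _,_; ∃)
open import Function.Bundles using (_⇔_)
open import Relation.Binary.PropositionalEquality using (_≡_)
open import Relation.Nullary using (¬_)

-- Conventions: rows and columns of the n×n grid are indexed by Fin n
-- (row 0 = top row, i.e. paper's row i is Fin index i-1).
-- A subset of [n] is a Data.Fin.Subset (Vec Bool n, true = member).
-- A diagram is D : Fin n → Subset n, D j = column D_{j+1}.

Diagram : ℕ → Set
Diagram n = Fin n → Subset n

data Sym : Set where
  opn cls star : Sym

-- symbol contributed by one row, given (row ∈ D_j, row ∈ I)
rowSym : Bool → Bool → List Sym
rowSym false true  = opn ∷ []
rowSym true  false = cls ∷ []
rowSym true  true  = star ∷ []
rowSym false false = []

word : ∀ {n} → Subset n → Subset n → List Sym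
word []       []       = []
word (d ∷ ds) (i ∷ is) = rowSym d i ++ word ds is

-- left-to-right scan; first argument = number of currently unmatched "("
-- result = number of matched pairs + number of stars
scan : ℕ → List Sym → ℕ
scan k []           = 0
scan k (opn ∷ w)    = scan (suc k) w
scan zero (cls ∷ w) = scan zero w
scan (suc k) (cls ∷ w) = suc (scan k w)
scan k (star ∷ w)   = suc (scan k w)

θcol : ∀ {n} → Subset n → Subset n → ℕ
θcol Dj I = scan 0 (word Dj I)

sumℕ : ∀ {n} → (Fin n → ℕ) → ℕ
sumℕ {zero}  f = 0
sumℕ {suc n} f = f Fin.zero ℕ.+ sumℕ (λ j → f (Fin.suc j))
  where import Data.Fin as Fin

sumℚ : ∀ {n} → (Fin n → ℚ) → ℚ
sumℚ {zero}  f = 0ℚ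
sumℚ {suc n} f = f Fin.zero ℚ.+ sumℚ (λ j → f (Fin.suc j))
  where import Data.Fin as Fin

prodℕ : ∀ {n} → (Fin n → ℕ) → ℕ
prodℕ {zero}  f = 1
prodℕ {suc n} f = f Fin.zero ℕ.* prodℕ (λ j → f (Fin.suc j))
  where import Data.Fin as Fin

size : ∀ {n} → Diagram n → ℕ
size D = sumℕ (λ j → ∣ D j ∣)

θ : ∀ {n} → Diagram n → Subset n → ℕ
θ D I = sumℕ (λ j → θcol (D j) I)

ℕ→ℚ : ℕ → ℚ
ℕ→ℚ k = ℤ.+ k ℚ./ 1

ℤ→ℚ : ℤ → ℚ
ℤ→ℚ z = z ℚ./ 1

sumOver : ∀ {n} → Subset n → Vec ℚ n → ℚ
sumOver I x = sumℚ (λ i → if lookup I i then lookup x i else 0ℚ)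

InDilatedSchubitope : ∀ {n} → Diagram n → ℕ → Vec ℚ n → Set
InDilatedSchubitope {n} D t x =
  (∀ i → 0ℚ ℚ.≤ lookup x i)
  × (sumℚ (lookup x) ≡ ℕ→ℚ (t ℕ.* size D))
  × (∀ (I : Subset n) → sumOver I x ℚ.≤ ℕ→ℚ (t ℕ.* θ D I))

InSchubitope : ∀ {n} → Diagram n → Vec ℚ n → Set
InSchubitope D = InDilatedSchubitope D 1

IsVertex : ∀ {n} → Diagram n → Vec ℚ n → Set
IsVertex {n} D x = InSchubitope D x ×
  (∀ y z → InSchubitope D y → InSchubitope D z →
     (∀ i → lookup x i ℚ.+ lookup x i ≡ lookup y i ℚ.+ lookup z i) → y ≡ z)

IsLatticePoint : ∀ {n} → Vec ℚ n → Set
IsLatticePoint {n} x = Σ (Vec ℤ n) λ v → x ≡ map ℤ→ℚ v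

LatticeFree : ∀ {n} → Diagram n → Set
LatticeFree {n} D = ∀ (x : Vec ℚ n) → (InSchubitope D x × IsLatticePoint x) ⇔ IsVertex D x

firstMissing : ∀ {n} → Subset n → Maybe ℕ
firstMissing [] = nothing
firstMissing (false ∷ s) = just 0
firstMissing (true ∷ s) with firstMissing s
... | just k  = just (suc k)
... | nothing = nothing

lastPresent : ∀ {n} → Subset n → Maybe ℕ
lastPresent [] = nothing
lastPresent (b ∷ s) with lastPresent s
... | just k  = just (suc k)
... | nothing = if b then just 0 else nothing

movable : ∀ {n} → Subset n → Subset n
movable {n} S = tabulate λ (r : Fin n) → mem (firstMissing S) (lastPresent S) (toℕ r)
  where
  mem : Maybe ℕ → Maybe ℕ → ℕ → Bool
  mem (just a) (just b) r =
    Relation.Nullary.Decidable.⌊ a ℕ.<? b ⌋ ∧ Relation.Nullary.Decidable.⌊ a ℕ.≤? r ⌋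
      ∧ Relation.Nullary.Decidable.⌊ r ℕ.≤? b ⌋
    where import Relation.Nullary.Decidable
  mem _ _ r = false

elems : ∀ {n} → Subset n → List ℕ
elems [] = []
elems (b ∷ s) = (if b then 0 ∷ [] else []) ++ L.map suc (elems s)

-- Gale order T ⪯ S : |T| = |S| and a_i ≤ b_i (Pointwise forces equal length)
GaleLeq : ∀ {n} → Subset n → Subset n → Set
GaleLeq T S = Pointwise ℕ._≤_ (elems T) (elems S)

IsBasis : ∀ {n} → Subset n → Subset n → Set
IsBasis S T = GaleLeq T S

allSubsets : (n : ℕ) → List (Subset n)
allSubsets zero = [] ∷ []
allSubsets (suc n) = L.map (false ∷_) (allSubsets n) ++ L.map (true ∷_) (allSubsets n)

sumList : List ℚ → ℚ
sumList = L.foldr ℚ._+_ 0ℚ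

indicator : Bool → ℚ
indicator b = if b then 1ℚ else 0ℚ

-- x ∈ t · P(SM_n(S)) = t · conv{ e_T : T basis }
-- i.e. x = Σ_T λ_T e_T with λ_T ≥ 0, λ_T = 0 for non-bases, Σ λ_T = t
InDilatedMatroidPolytope : ∀ {n} → Subset n → ℕ → Vec ℚ n → Set
InDilatedMatroidPolytope {n} S t x =
  Σ (Subset n → ℚ) λ λ' →
    (∀ T → 0ℚ ℚ.≤ λ' T)
    × (∀ T → ¬ IsBasis S T → λ' T ≡ 0ℚ)
    × (sumList (L.map λ' (allSubsets n)) ≡ ℕ→ℚ t)
    × (∀ i → lookup x i ≡ sumList (L.map (λ T → λ' T ℚ.* indicator (lookup T i)) (allSubsets n)))

HasLatticeCount : ∀ {n} → (Vec ℚ n → Set) → ℕ → Set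
HasLatticeCount {n} P N =
  Σ (List (Vec ℤ n)) λ vs →
    Unique vs × (length vs ≡ N) × (∀ v → (v LM.∈ vs) ⇔ P (map ℤ→ℚ v))

{-# OPTIONS --safe #-}

-- A point of t·P(SM(S)) is determined by its prefix sums F k (sums over the rows
-- above line k); the polytope is cut out by 0 ≤ F (k+1) - F k ≤ t and
-- F k ≥ t |S ∩ [0,k)|, with equality at k = n. F k is not forced to be
-- t |S ∩ [0,k)| only for the lines k strictly inside the movable interval of S, the
-- "active" ones, and condition (2) says that no line is active for two columns.
-- In that case the prefix sums of a point of t·S_D determine those of its column
-- components, so t·S_D is the product of the column polytopes, also on lattice
-- points, which gives (3). For (1), the components of a lattice point of S_D are
-- 0/1 vectors, hence extreme, and conversely a non-integral point is the midpoint
-- of the two points obtained by moving all non-integral prefix sums by ±ε.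
-- Rational points are treated by clearing denominators.
--
-- If a line is active for two columns, moving a box across it in one column or in
-- the other gives a lattice point that is a midpoint of two others. Moreover the
-- counts of the columns then grow like t^e, e being the number of pairs of a column
-- and an active line, while the count of t·S_D is O(t^d), d < e being the number of
-- active lines.

module Submission where

-- θ of a column at I is the least number, over all cuts k, of elements of I above the cut plus
-- boxes below it. Hence sums of column points satisfy every inequality of the Schubitope. For the
-- reverse direction under (2), four kinds of I are used: the rows above a line, the rows below it,
-- one row, all rows but one. A column that is inactive at the lines concerned has θ bounded there
-- by its forced value, so it cancels, and what remains is the inequality wanted for the single
-- active column. The obstacle is a row at the end of an active interval, whose other line may be
-- active for a different column. There the bounds F k ≤ tk and F k ≤ t|D_j| suffice, since the
-- column is full above its interval and empty below. The matroid polytope is given as a convex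
-- hull; its integer points are matched with the prefix-sum inequalities by splitting off one basis
-- at a time. Condition (3) speaks of counts witnessed by enumerations, so to draw a conclusion from
-- it such enumerations must first be produced.

-- Counting boxes above a line, θ as a minimum over cuts, and active lines.

module Counting where
  open import Defs
  open import Data.Bool using (true; false; if_then_else_)
  open import Data.Empty using (⊥-elim)
  open import Data.Nat using (ℕ; zero; suc; _+_; _≤_; _<_; z≤n; s≤s)
  open import Data.Nat.Properties as ℕ
  open import Data.Fin using (Fin; zero; suc; toℕ)
  open import Data.Fin.Subset using (Subset; ∣_∣; ∁; ⁅_⁆; ⊥)
  open import Data.Fin.Subset.Properties using (∣⁅x⁆∣≡1)
  open import Data.List using ([]; _∷_)
  open import Data.Vec using ([]; _∷_)
  open import Data.Product using (∃; _×_; _,_)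
  open import Data.Sum using (_⊎_; inj₁; inj₂)
  open import Relation.Nullary using (¬_; Dec; yes; no)
  open import Relation.Nullary.Decidable using (_×-dec_)
  open import Relation.Binary.PropositionalEquality using (_≡_; refl; sym; trans; cong; subst; subst₂)

  private variable n : ℕ

  bit : Subset n → ℕ → ℕ
  bit []          _       = 0
  bit (b     ∷ S) zero    = if b then 1 else 0
  bit (_     ∷ S) (suc k) = bit S k

  -- Lines are indexed by ℕ and the count saturates past the last row, so one index serves all
  -- columns, including the bottom line n.
  count : Subset n → ℕ → ℕ
  count []          _       = 0
  count (_     ∷ S) zero    = 0
  count (true  ∷ S) (suc k) = suc (count S k)
  count (false ∷ S) (suc k) = count S k

  count-zero : (S : Subset n) → count S 0 ≡ 0
  count-zero []      = refl
  count-zero (_ ∷ _) = refl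

  count-suc : (S : Subset n) (k : ℕ) → count S (suc k) ≡ bit S k + count S k
  count-suc []          k       = refl
  count-suc (true  ∷ S) zero    = cong suc (count-zero S)
  count-suc (false ∷ S) zero    = count-zero S
  count-suc (true  ∷ S) (suc k) = trans (cong suc (count-suc S k)) (sym (+-suc (bit S k) _))
  count-suc (false ∷ S) (suc k) = count-suc S k

  bit≤1 : (S : Subset n) (k : ℕ) → bit S k ≤ 1
  bit≤1 []          k       = z≤n
  bit≤1 (true  ∷ S) zero    = ≤-refl
  bit≤1 (false ∷ S) zero    = z≤n
  bit≤1 (_     ∷ S) (suc k) = bit≤1 S k

  count-mono-suc : (S : Subset n) (k : ℕ) → count S k ≤ count S (suc k)
  count-mono-suc S k rewrite count-suc S k = m≤n+m _ _

  count-suc-≤ : (S : Subset n) (k : ℕ) → count S (suc k) ≤ suc (count S k)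
  count-suc-≤ S k rewrite count-suc S k = +-monoˡ-≤ _ (bit≤1 S k)

  count≤k : (S : Subset n) (k : ℕ) → count S k ≤ k
  count≤k []          k       = z≤n
  count≤k (_     ∷ S) zero    = z≤n
  count≤k (true  ∷ S) (suc k) = s≤s (count≤k S k)
  count≤k (false ∷ S) (suc k) = m≤n⇒m≤1+n (count≤k S k)

  count≤∣∣ : (S : Subset n) (k : ℕ) → count S k ≤ ∣ S ∣
  count≤∣∣ []          k       = z≤n
  count≤∣∣ (_     ∷ S) zero    = z≤n
  count≤∣∣ (true  ∷ S) (suc k) = s≤s (count≤∣∣ S k)
  count≤∣∣ (false ∷ S) (suc k) = count≤∣∣ S k

  count-all : (S : Subset n) → count S n ≡ ∣ S ∣
  count-all []          = refl
  count-all (true  ∷ S) = cong suc (count-all S)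
  count-all (false ∷ S) = count-all S

  below : (n k : ℕ) → Subset n
  below zero    k       = []
  below (suc n) zero    = false ∷ below n zero
  below (suc n) (suc k) = true ∷ below n k

  ∣below∣≤ : (n k : ℕ) → ∣ below n k ∣ ≤ k
  ∣below∣≤ zero    k       = z≤n
  ∣below∣≤ (suc n) zero    = ∣below∣≤ n zero
  ∣below∣≤ (suc n) (suc k) = s≤s (∣below∣≤ n k)

  count-above : (n k : ℕ) → count (∁ (below n k)) k ≡ 0
  count-above zero    k       = refl
  count-above (suc n) zero    = refl
  count-above (suc n) (suc k) = count-above n k

  count-⁅⁆ : (i : Fin n) → count ⁅ i ⁆ (toℕ i) ≡ 0
  count-⁅⁆ zero    = refl
  count-⁅⁆ (suc i) = count-⁅⁆ i

  count-∁⁅⁆ : (i : Fin n) → count (∁ ⁅ i ⁆) (suc (toℕ i)) ≤ toℕ i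
  count-∁⁅⁆ {suc n} zero = ≤-reflexive (count-zero (∁ {n} ⊥))
  count-∁⁅⁆ (suc i) = s≤s (count-∁⁅⁆ i)

  scan≤∣∣ : (u : ℕ) (S I : Subset n) → scan u (word S I) ≤ ∣ S ∣
  scan≤∣∣ u       []          []          = z≤n
  scan≤∣∣ zero    (true  ∷ S) (true  ∷ I) = s≤s (scan≤∣∣ zero S I)
  scan≤∣∣ (suc u) (true  ∷ S) (true  ∷ I) = s≤s (scan≤∣∣ (suc u) S I)
  scan≤∣∣ zero    (true  ∷ S) (false ∷ I) = m≤n⇒m≤1+n (scan≤∣∣ 0 S I)
  scan≤∣∣ (suc u) (true  ∷ S) (false ∷ I) = s≤s (scan≤∣∣ u S I)
  scan≤∣∣ u       (false ∷ S) (true  ∷ I) = scan≤∣∣ (suc u) S I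
  scan≤∣∣ u       (false ∷ S) (false ∷ I) = scan≤∣∣ u S I

  -- The next two lemmas say θ S I = min_k (|I ∩ [0,k)| + |S ∖ [0,k)|): a matched
  -- pair opens before k or closes after k, and the minimum is attained where the
  -- unmatched ")" end and the unmatched "(" begin. They are stated for a scan that
  -- starts with u pending "(".
  scan-cut-≤ : (u : ℕ) (S I : Subset n) (k : ℕ) →
    scan u (word S I) + count S k ≤ u + count I k + ∣ S ∣
  scan-cut-≤ u S I zero rewrite count-zero S | +-identityʳ (scan u (word S I)) =
    ≤-trans (scan≤∣∣ u S I) (m≤n+m _ _)
  scan-cut-≤ u [] [] (suc k) = z≤n
  scan-cut-≤ u (true ∷ S) (true ∷ I) (suc k) = begin
    scan u (star ∷ word S I) + suc (count S k) ≡⟨ cong (_+ suc (count S k)) (scan-star u (word S I)) ⟩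
    suc (scan u (word S I) + suc (count S k)) ≡⟨ cong suc (+-suc _ _) ⟩
    suc (suc (scan u (word S I) + count S k)) ≤⟨ s≤s (s≤s (scan-cut-≤ u S I k)) ⟩
    suc (suc (u + count I k + ∣ S ∣))         ≡⟨ cong suc (sym (+-suc _ _)) ⟩
    suc (u + count I k + suc ∣ S ∣)           ≡⟨ cong (_+ suc ∣ S ∣) (sym (+-suc u _)) ⟩
    u + suc (count I k) + suc ∣ S ∣           ∎
    where
    open ≤-Reasoning
    scan-star : ∀ u w → scan u (star ∷ w) ≡ suc (scan u w)
    scan-star zero    w = refl
    scan-star (suc _) w = refl
  scan-cut-≤ zero (true ∷ S) (false ∷ I) (suc k) = begin
    scan 0 (word S I) + suc (count S k) ≡⟨ +-suc _ _ ⟩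
    suc (scan 0 (word S I) + count S k) ≤⟨ s≤s (scan-cut-≤ 0 S I k) ⟩
    suc (count I k + ∣ S ∣)             ≡⟨ sym (+-suc _ _) ⟩
    count I k + suc ∣ S ∣               ∎
    where open ≤-Reasoning
  scan-cut-≤ (suc u) (true ∷ S) (false ∷ I) (suc k) = begin
    suc (scan u (word S I) + suc (count S k)) ≡⟨ cong suc (+-suc _ _) ⟩
    suc (suc (scan u (word S I) + count S k)) ≤⟨ s≤s (s≤s (scan-cut-≤ u S I k)) ⟩
    suc (suc (u + count I k + ∣ S ∣))         ≡⟨ cong suc (sym (+-suc _ _)) ⟩
    suc (u + count I k + suc ∣ S ∣)           ∎
    where open ≤-Reasoning
  scan-cut-≤ u (false ∷ S) (true ∷ I) (suc k) =
    ≤-trans (scan-cut-≤ (suc u) S I k) (≤-reflexive (cong (_+ ∣ S ∣) (sym (+-suc u _))))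
  scan-cut-≤ u (false ∷ S) (false ∷ I) (suc k) = scan-cut-≤ u S I k

  TightCut : (u : ℕ) → Subset n → Subset n → Set
  TightCut {n} u S I = ∃ λ k → k ≤ n × scan u (word S I) + count S k ≡ u + count I k + ∣ S ∣

  private
    tightCut-star : ∀ {a b i c} u → a + b ≡ u + i + c → suc a + suc b ≡ u + suc i + suc c
    tightCut-star {a} {b} {i} {c} u eq rewrite +-suc a b | +-suc u i | +-suc (u + i) c = cong (λ x → suc (suc x)) eq

  scan-tightCut : (u : ℕ) (S I : Subset n) → TightCut u S I ⊎ scan u (word S I) ≡ ∣ S ∣
  scan-tightCut u [] [] = inj₂ refl
  scan-tightCut zero (true ∷ S) (true ∷ I) with scan-tightCut zero S I
  ... | inj₁ (k , k≤n , eq) = inj₁ (suc k , s≤s k≤n , tightCut-star 0 eq)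
  ... | inj₂ eq       = inj₂ (cong suc eq)
  scan-tightCut (suc u) (true ∷ S) (true ∷ I) with scan-tightCut (suc u) S I
  ... | inj₁ (k , k≤n , eq) = inj₁ (suc k , s≤s k≤n , tightCut-star (suc u) eq)
  ... | inj₂ eq       = inj₂ (cong suc eq)
  scan-tightCut zero (true ∷ S) (false ∷ I) with scan-tightCut zero S I
  ... | inj₁ (k , k≤n , eq) = inj₁ (suc k , s≤s k≤n , trans (+-suc _ _) (trans (cong suc eq) (sym (+-suc _ _))))
  -- This `)` is the last unmatched one, so the cut goes directly below it. With no unmatched `)`
  -- the value is `∣ S ∣`, which for u > 0 need not be attained by any cut; hence the second
  -- alternative.
  ... | inj₂ eq       = inj₁ (1 , s≤s z≤n , cut)
    where
    cut : scan 0 (word S I) + suc (count S 0) ≡ count I 0 + suc ∣ S ∣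
    cut rewrite count-zero S | count-zero I | eq = +-comm ∣ S ∣ 1
  scan-tightCut (suc u) (true ∷ S) (false ∷ I) with scan-tightCut u S I
  ... | inj₁ (k , k≤n , eq) = inj₁ (suc k , s≤s k≤n , cong suc (trans (+-suc _ _) (trans (cong suc eq) (sym (+-suc _ _)))))
  ... | inj₂ eq       = inj₂ (cong suc eq)
  scan-tightCut u (false ∷ S) (true ∷ I) with scan-tightCut (suc u) S I
  ... | inj₁ (k , k≤n , eq) = inj₁ (suc k , s≤s k≤n , trans eq (cong (_+ ∣ S ∣) (sym (+-suc u _))))
  ... | inj₂ eq       = inj₂ eq
  scan-tightCut u (false ∷ S) (false ∷ I) with scan-tightCut u S I
  ... | inj₁ (k , k≤n , eq) = inj₁ (suc k , s≤s k≤n , eq)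
  ... | inj₂ eq       = inj₂ eq

  θ-cut-≤ : (S I : Subset n) (k : ℕ) → θcol S I + count S k ≤ count I k + ∣ S ∣
  θ-cut-≤ = scan-cut-≤ 0

  θ-tightCut : (S I : Subset n) → TightCut 0 S I
  θ-tightCut S I with scan-tightCut 0 S I
  ... | inj₁ cut = cut
  ... | inj₂ eq  = 0 , z≤n , trans (cong (θcol S I +_) (count-zero S))
    (trans (+-identityʳ _) (trans eq (cong (_+ ∣ S ∣) (sym (count-zero I)))))

  θ≤∣S∣ : (S I : Subset n) → θcol S I ≤ ∣ S ∣
  θ≤∣S∣ = scan≤∣∣ 0

  θ≤∣I∣ : (S I : Subset n) → θcol S I ≤ ∣ I ∣
  θ≤∣I∣ {n} S I = +-cancelʳ-≤ ∣ S ∣ _ _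
    (subst₂ (λ s i → θcol S I + s ≤ i + ∣ S ∣) (count-all S) (count-all I) (θ-cut-≤ S I n))

  θ-below≤k : (S : Subset n) (k : ℕ) → θcol S (below n k) ≤ k
  θ-below≤k {n} S k = ≤-trans (θ≤∣I∣ S (below n k)) (∣below∣≤ n k)

  θ-above : (S : Subset n) (k : ℕ) → θcol S (∁ (below n k)) + count S k ≤ ∣ S ∣
  θ-above {n} S k = ≤-trans (θ-cut-≤ S (∁ (below n k)) k) (≤-reflexive (cong (_+ ∣ S ∣) (count-above n k)))

  θ-⁅⁆≤1 : (S : Subset n) (i : Fin n) → θcol S ⁅ i ⁆ ≤ 1
  θ-⁅⁆≤1 S i = ≤-trans (θ≤∣I∣ S ⁅ i ⁆) (≤-reflexive (∣⁅x⁆∣≡1 i))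

  θ-⁅⁆ : (S : Subset n) (i : Fin n) → θcol S ⁅ i ⁆ + count S (toℕ i) ≤ ∣ S ∣
  θ-⁅⁆ S i = ≤-trans (θ-cut-≤ S ⁅ i ⁆ (toℕ i)) (≤-reflexive (cong (_+ ∣ S ∣) (count-⁅⁆ i)))

  θ-∁⁅⁆ : (S : Subset n) (i : Fin n) → θcol S (∁ ⁅ i ⁆) + count S (suc (toℕ i)) ≤ toℕ i + ∣ S ∣
  θ-∁⁅⁆ S i = ≤-trans (θ-cut-≤ S (∁ ⁅ i ⁆) (suc (toℕ i))) (+-monoˡ-≤ ∣ S ∣ (count-∁⁅⁆ i))

  -- With [a,b] the movable interval of S, this says a < k ≤ b: a box of S can be
  -- moved upwards across the line between rows k - 1 and k.
  Active : Subset n → ℕ → Set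
  Active S k = count S k < k × count S k < ∣ S ∣

  active? : (S : Subset n) (k : ℕ) → Dec (Active S k)
  active? S k = (count S k <? k) ×-dec (count S k <? ∣ S ∣)

  inactive : (S : Subset n) (k : ℕ) → ¬ Active S k → count S k ≡ k ⊎ count S k ≡ ∣ S ∣
  inactive S k ¬a with count S k <? k | count S k <? ∣ S ∣
  ... | yes p | yes q = ⊥-elim (¬a (p , q))
  ... | no p  | _     = inj₁ (≤-antisym (count≤k S k) (≮⇒≥ p))
  ... | yes _ | no q  = inj₂ (≤-antisym (count≤∣∣ S k) (≮⇒≥ q))

  -- At an inactive line either all rows above are boxes or no box lies below, so nothing can cross
  -- it. This and the next two bounds are what cancels the inactive columns from an inequality of
  -- the Schubitope.
  θ-below-inactive : (S : Subset n) (k : ℕ) → ¬ Active S k → θcol S (below n k) ≤ count S k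
  θ-below-inactive {n} S k ¬a with inactive S k ¬a
  ... | inj₁ eq = ≤-trans (θ-below≤k S k) (≤-reflexive (sym eq))
  ... | inj₂ eq = ≤-trans (θ≤∣S∣ S (below n k)) (≤-reflexive (sym eq))

  θ-⁅⁆-inactive : (S : Subset n) (i : Fin n) → ¬ Active S (toℕ i) → ¬ Active S (suc (toℕ i)) →
    θcol S ⁅ i ⁆ ≤ bit S (toℕ i)
  θ-⁅⁆-inactive S i ¬a ¬a′ with inactive S (toℕ i) ¬a
  ... | inj₂ eq = ≤-trans (+-cancelʳ-≤ (count S (toℕ i)) _ 0 (≤-trans (θ-⁅⁆ S i) (≤-reflexive (sym eq)))) z≤n
  ... | inj₁ eq with inactive S (suc (toℕ i)) ¬a′
  ...   | inj₁ eq′ = ≤-trans (θ-⁅⁆≤1 S i) (+-cancelʳ-≤ (toℕ i) _ _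
          (≤-reflexive (trans (sym eq′) (trans (count-suc S (toℕ i)) (cong (bit S (toℕ i) +_) eq)))))
  ...   | inj₂ eq′ = +-cancelʳ-≤ (count S (toℕ i)) _ _
          (≤-trans (θ-⁅⁆ S i) (≤-reflexive (trans (sym eq′) (count-suc S (toℕ i)))))

  -- A box leaves row i only upwards, so only the line above the row has to be inactive. For the
  -- upper bound on row i, boxes arriving from below have to be excluded as well.
  θ-∁⁅⁆-inactive : (S : Subset n) (i : Fin n) → ¬ Active S (toℕ i) →
    θcol S (∁ ⁅ i ⁆) + bit S (toℕ i) ≤ ∣ S ∣
  θ-∁⁅⁆-inactive S i ¬a with inactive S (toℕ i) ¬a
  ... | inj₁ eq = +-cancelˡ-≤ (toℕ i) _ _ (≤-trans (≤-reflexive eq₁) (θ-∁⁅⁆ S i))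
    where
    eq₁ : toℕ i + (θcol S (∁ ⁅ i ⁆) + bit S (toℕ i)) ≡ θcol S (∁ ⁅ i ⁆) + count S (suc (toℕ i))
    eq₁ rewrite count-suc S (toℕ i) | eq =
      trans (+-comm (toℕ i) _) (+-assoc (θcol S (∁ ⁅ i ⁆)) (bit S (toℕ i)) (toℕ i))
  ... | inj₂ eq = ≤-trans (+-monoʳ-≤ (θcol S (∁ ⁅ i ⁆)) bit≤0)
      (≤-trans (≤-reflexive (+-identityʳ _)) (θ≤∣S∣ S (∁ ⁅ i ⁆)))
    where
    bit≤0 : bit S (toℕ i) ≤ 0
    bit≤0 = +-cancelʳ-≤ (count S (toℕ i)) _ 0
      (≤-trans (≤-reflexive (sym (count-suc S (toℕ i)))) (≤-trans (count≤∣∣ S _) (≤-reflexive (sym eq))))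

  -- Inactivity by `count S k ≡ ∣ S ∣` is inherited by all later lines, so just before an active
  -- line it must be of the other kind. Dually, `count S k ≡ k` is inherited by earlier lines, which
  -- gives `count-leaving`.
  count-entering : (S : Subset n) {k : ℕ} → ¬ Active S k → Active S (suc k) → count S k ≡ k
  count-entering S {k} ¬a (_ , c′<) with inactive S k ¬a
  ... | inj₁ eq = eq
  ... | inj₂ eq = ⊥-elim (<⇒≱ c′< (subst (_≤ count S (suc k)) eq (count-mono-suc S k)))

  count-leaving : (S : Subset n) {k : ℕ} → Active S k → ¬ Active S (suc k) → count S (suc k) ≡ ∣ S ∣
  count-leaving S {k} (c<k , _) ¬a′ with inactive S (suc k) ¬a′
  ... | inj₁ eq = ⊥-elim (<⇒≱ c<k (≤-pred (subst (_≤ suc (count S k)) eq (count-suc-≤ S k))))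
  ... | inj₂ eq = eq

open Counting

-- Overlaps of movable intervals in terms of active lines.

module MovableIntervals where
  open import Defs
  open import Data.Bool using (Bool; true; false; T)
  open import Data.Bool.Properties using (T-≡; T-∧)
  open import Data.Empty using (⊥-elim)
  open import Data.Nat as ℕ using (ℕ; zero; suc; _≤_; _<_; z≤n; s≤s)
  open import Data.Nat.Properties as ℕ
  open import Data.Fin as Fin using (Fin; zero; suc; toℕ; fromℕ<)
  open import Data.Fin.Properties as Fin using (toℕ-fromℕ<)
  open import Data.Fin.Subset using (Subset; ∣_∣; _∈_; _∩_)
  open import Data.Fin.Subset.Properties using (x∈p∩q⁺; x∈p∩q⁻)
  open import Data.Maybe using (just; nothing)
  open import Data.Vec using (_∷_; tabulate; here; there)
  open import Data.Vec.Properties using (lookup∘tabulate; lookup⇒[]=; []=⇒lookup)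
  open import Data.Product using (∃; ∃₂; _×_; _,_)
  open import Data.Sum using (_⊎_; inj₁; inj₂)
  open import Function.Bundles using (Equivalence)
  open import Relation.Nullary using (¬_; yes; no)
  open import Relation.Nullary.Decidable using (toWitness; fromWitness; ⌊_⌋)
  open import Relation.Binary using (tri<; tri≈; tri>)
  open import Relation.Binary.PropositionalEquality using (_≡_; refl; sym; trans; cong; subst; subst₂)

  private variable n : ℕ

  firstMissing⇒count< : (S : Subset n) {a k : ℕ} → firstMissing S ≡ just a → a < k → count S k < k
  firstMissing⇒count< (false ∷ S) {k = suc k} refl a<k = s≤s (count≤k S k)
  firstMissing⇒count< (true ∷ S) {k = suc k} eq a<k with firstMissing S in fm
  firstMissing⇒count< (true ∷ S) {k = suc k} refl (s≤s a<k) | just a = s≤s (firstMissing⇒count< S fm a<k)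

  count<⇒firstMissing : (S : Subset n) {k : ℕ} → k ≤ n → count S k < k →
    ∃ λ a → firstMissing S ≡ just a × a < k
  count<⇒firstMissing (false ∷ S) {suc k} k≤n c<k = 0 , refl , s≤s z≤n
  count<⇒firstMissing (true ∷ S) {suc k} (s≤s k≤n) (s≤s c<k)
    with firstMissing S | count<⇒firstMissing S k≤n c<k
  ... | just a | .a , refl , a<k = suc a , refl , s≤s a<k

  lastPresent⇒count< : (S : Subset n) {b k : ℕ} → lastPresent S ≡ just b → k ≤ b → count S k < ∣ S ∣
  lastPresent⇒count< (x ∷ S) eq k≤b with lastPresent S in lp
  lastPresent⇒count< (true ∷ S)  {k = zero}  refl k≤b | just b = s≤s z≤n
  lastPresent⇒count< (false ∷ S) {k = zero}  refl k≤b | just b =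
    ≤-<-trans z≤n (lastPresent⇒count< S {k = 0} lp z≤n)
  lastPresent⇒count< (true ∷ S)  {k = suc k} refl (s≤s k≤b) | just b = s≤s (lastPresent⇒count< S lp k≤b)
  lastPresent⇒count< (false ∷ S) {k = suc k} refl (s≤s k≤b) | just b = lastPresent⇒count< S lp k≤b
  lastPresent⇒count< (true ∷ S)  {k = zero}  refl k≤b | nothing = s≤s z≤n

  count<⇒lastPresent : (S : Subset n) {k : ℕ} → count S k < ∣ S ∣ →
    ∃ λ b → lastPresent S ≡ just b × k ≤ b × b < n
  count<⇒lastPresent (true ∷ S) {zero} c< with lastPresent S in lp
  ... | nothing = 0 , refl , z≤n , s≤s z≤n
  ... | just b with count<⇒lastPresent S {zero} (lastPresent⇒count< S lp z≤n)
  ...   | b′ , eq , _ , b′<n with trans (sym lp) eq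
  ...     | refl = suc b , refl , z≤n , s≤s b′<n
  count<⇒lastPresent (false ∷ S) {zero} c<
    with lastPresent S | count<⇒lastPresent S {zero} (subst (_< ∣ S ∣) (sym (count-zero S)) c<)
  ... | just b | .b , refl , _ , b<n = suc b , refl , z≤n , s≤s b<n
  count<⇒lastPresent (true ∷ S) {suc k} (s≤s c<) with lastPresent S | count<⇒lastPresent S c<
  ... | just b | .b , refl , k≤b , b<n = suc b , refl , s≤s k≤b , s≤s b<n
  count<⇒lastPresent (false ∷ S) {suc k} c< with lastPresent S | count<⇒lastPresent S c<
  ... | just b | .b , refl , k≤b , b<n = suc b , refl , s≤s k≤b , s≤s b<n

  Active⇒<n : (S : Subset n) {k : ℕ} → Active S k → k < n
  Active⇒<n S (_ , c<) with count<⇒lastPresent S c<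
  ... | _ , _ , k≤b , b<n = ≤-<-trans k≤b b<n

  private
    ∈-tabulate⁺ : (f : Fin n → Bool) (r : Fin n) → f r ≡ true → r ∈ tabulate f
    ∈-tabulate⁺ f r eq = lookup⇒[]= r (tabulate f) (trans (lookup∘tabulate f r) eq)

    ∈-tabulate⁻ : (f : Fin n → Bool) (r : Fin n) → r ∈ tabulate f → f r ≡ true
    ∈-tabulate⁻ f r r∈ = trans (sym (lookup∘tabulate f r)) ([]=⇒lookup r∈)

  ∈-movable⁺ : (S : Subset n) (r : Fin n) {a b : ℕ} → firstMissing S ≡ just a → lastPresent S ≡ just b →
    a < b → a ≤ toℕ r → toℕ r ≤ b → r ∈ movable S
  ∈-movable⁺ S r {a} {b} fm lp a<b a≤r r≤b rewrite fm | lp =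
    ∈-tabulate⁺ _ r (Equivalence.to T-≡ (Equivalence.from T-∧
      (fromWitness {a? = a <? b} a<b , Equivalence.from T-∧
      (fromWitness {a? = a ≤? toℕ r} a≤r , fromWitness {a? = toℕ r ≤? b} r≤b))))

  ∈-movable⁻ : (S : Subset n) (r : Fin n) → r ∈ movable S → ∃₂ λ a b →
    firstMissing S ≡ just a × lastPresent S ≡ just b × a ≤ toℕ r × toℕ r ≤ b
  ∈-movable⁻ S r r∈ with firstMissing S | lastPresent S
  ... | nothing | just _  with () ← ∈-tabulate⁻ _ r r∈
  ... | nothing | nothing with () ← ∈-tabulate⁻ _ r r∈
  ... | just _  | nothing with () ← ∈-tabulate⁻ _ r r∈
  ... | just a  | just b  =
    let _ , h = Equivalence.to (T-∧ {⌊ a <? b ⌋}) (Equivalence.from T-≡ (∈-tabulate⁻ _ r r∈))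
        a≤r , r≤b = Equivalence.to (T-∧ {⌊ a ≤? toℕ r ⌋}) h
    in a , b , refl , refl , toWitness a≤r , toWitness r≤b

  Active⇒∈movable : (S : Subset n) {k : ℕ} (r : Fin n) → Active S k →
    toℕ r ≡ k ⊎ suc (toℕ r) ≡ k → r ∈ movable S
  Active⇒∈movable S r act@(c<k , c<) r~k
    with count<⇒firstMissing S (<⇒≤ (Active⇒<n S act)) c<k | count<⇒lastPresent S c<
  ... | a , fm , a<k | b , lp , k≤b , _ = ∈-movable⁺ S r fm lp (<-≤-trans a<k k≤b) (a≤r r~k) (r≤b r~k)
    where
    a≤r : toℕ r ≡ _ ⊎ suc (toℕ r) ≡ _ → a ≤ toℕ r
    a≤r (inj₁ refl) = <⇒≤ a<k
    a≤r (inj₂ refl) = ℕ.≤-pred a<k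
    r≤b : toℕ r ≡ _ ⊎ suc (toℕ r) ≡ _ → toℕ r ≤ b
    r≤b (inj₁ refl) = k≤b
    r≤b (inj₂ refl) = <⇒≤ k≤b

  -- The smaller row keeps r′ away from the top row of the interval, so that the line above r′ lies
  -- strictly inside.
  ∈movable⇒Active : (S : Subset n) {r r′ : Fin n} → r Fin.< r′ → r ∈ movable S → r′ ∈ movable S →
    Active S (toℕ r′)
  ∈movable⇒Active S {r} {r′} r<r′ r∈ r′∈ with ∈-movable⁻ S r r∈ | ∈-movable⁻ S r′ r′∈
  ... | _ , _ , fm , _ , a≤r , _ | _ , _ , _ , lp , _ , r′≤b =
    firstMissing⇒count< S fm (≤-<-trans a≤r r<r′) , lastPresent⇒count< S lp r′≤b

  ∈⇒1≤∣∣ : {p : Subset n} {i : Fin n} → i ∈ p → 1 ≤ ∣ p ∣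
  ∈⇒1≤∣∣ here = s≤s z≤n
  ∈⇒1≤∣∣ {p = true  ∷ p} (there i∈) = s≤s z≤n
  ∈⇒1≤∣∣ {p = false ∷ p} (there i∈) = ∈⇒1≤∣∣ i∈

  ∈²⇒2≤∣∣ : {p : Subset n} {i j : Fin n} → i Fin.< j → i ∈ p → j ∈ p → 2 ≤ ∣ p ∣
  ∈²⇒2≤∣∣ i<j here (there j∈) = s≤s (∈⇒1≤∣∣ j∈)
  ∈²⇒2≤∣∣ {p = true  ∷ p} (s≤s i<j) (there i∈) (there j∈) = m≤n⇒m≤1+n (∈²⇒2≤∣∣ i<j i∈ j∈)
  ∈²⇒2≤∣∣ {p = false ∷ p} (s≤s i<j) (there i∈) (there j∈) = ∈²⇒2≤∣∣ i<j i∈ j∈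

  1≤∣∣⇒∈ : (p : Subset n) → 1 ≤ ∣ p ∣ → ∃ λ i → i ∈ p
  1≤∣∣⇒∈ (true  ∷ p) _ = zero , here
  1≤∣∣⇒∈ (false ∷ p) h = let i , i∈ = 1≤∣∣⇒∈ p h in suc i , there i∈

  2≤∣∣⇒∈² : (p : Subset n) → 2 ≤ ∣ p ∣ → ∃₂ λ i j → i Fin.< j × i ∈ p × j ∈ p
  2≤∣∣⇒∈² (true  ∷ p) (s≤s h) = let j , j∈ = 1≤∣∣⇒∈ p h in zero , suc j , s≤s z≤n , here , there j∈
  2≤∣∣⇒∈² (false ∷ p) h =
    let i , j , i<j , i∈ , j∈ = 2≤∣∣⇒∈² p h in suc i , suc j , s≤s i<j , there i∈ , there j∈

  SmallOverlaps : Diagram n → Set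
  SmallOverlaps {n} D = ∀ (i j : Fin n) → i Fin.< j → ∣ movable (D i) ∩ movable (D j) ∣ ≤ 1

  Exclusive : {m : ℕ} → (Fin m → Subset n) → Set
  Exclusive {m = m} D = ∀ (k : ℕ) (i j : Fin m) → Active (D i) k → Active (D j) k → i ≡ j

  -- The rows on both sides of an active line belong to the movable interval, so a common active
  -- line yields two common rows.
  overlap⇒2≤ : (S T : Subset n) {k : ℕ} → Active S k → Active T k → 2 ≤ ∣ movable S ∩ movable T ∣
  overlap⇒2≤ {n} S T {suc k} actS actT =
    ∈²⇒2≤∣∣ (subst₂ _<_ (sym r≡) (sym r′≡) (n<1+n k))
      (x∈p∩q⁺ (Active⇒∈movable S r actS (inj₂ (cong suc r≡)) , Active⇒∈movable T r actT (inj₂ (cong suc r≡))))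
      (x∈p∩q⁺ (Active⇒∈movable S r′ actS (inj₁ r′≡) , Active⇒∈movable T r′ actT (inj₁ r′≡)))
    where
    k<n = Active⇒<n S actS
    r r′ : Fin n
    r  = fromℕ< (<⇒≤ k<n)
    r′ = fromℕ< k<n
    r≡ : toℕ r ≡ k
    r≡ = toℕ-fromℕ< (<⇒≤ k<n)
    r′≡ : toℕ r′ ≡ suc k
    r′≡ = toℕ-fromℕ< k<n

  SmallOverlaps⇒Exclusive : (D : Diagram n) → SmallOverlaps D → Exclusive D
  SmallOverlaps⇒Exclusive D small k i j acti actj with Fin.<-cmp i j
  ... | tri< i<j _ _ = ⊥-elim (<⇒≱ (overlap⇒2≤ (D i) (D j) acti actj) (small i j i<j))
  ... | tri≈ _ i≡j _ = i≡j
  ... | tri> _ _ j<i = ⊥-elim (<⇒≱ (overlap⇒2≤ (D j) (D i) actj acti) (small j i j<i))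

  Exclusive⇒SmallOverlaps : (D : Diagram n) →
    (∀ (k : ℕ) (i j : Fin n) → i Fin.< j → Active (D i) k → ¬ Active (D j) k) → SmallOverlaps D
  Exclusive⇒SmallOverlaps D excl i j i<j with ∣ movable (D i) ∩ movable (D j) ∣ ≤? 1
  ... | yes small = small
  ... | no  large with 2≤∣∣⇒∈² _ (≰⇒> large)
  ...   | r , r′ , r<r′ , r∈ , r′∈ =
    let r∈i  , r∈j  = x∈p∩q⁻ (movable (D i)) (movable (D j)) r∈
        r′∈i , r′∈j = x∈p∩q⁻ (movable (D i)) (movable (D j)) r′∈
    in ⊥-elim (excl (toℕ r′) i j i<j
         (∈movable⇒Active (D i) r<r′ r∈i r′∈i) (∈movable⇒Active (D j) r<r′ r∈j r′∈j))

open MovableIntervals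

-- Finite sums and prefix sums of integer vectors.

module PrefixSums where
  open import Defs
  open import Data.Bool using (true; false)
  open import Data.Nat as ℕ using (ℕ; zero; suc; z≤n; s≤s)
  import Data.Nat.Properties as ℕ
  import Data.Nat.Solver as ℕSolver
  open import Data.Integer using (ℤ; +_; _+_; _-_; _*_; -_; _≤_; 0ℤ; +≤+)
  import Data.Integer.Properties as ℤ
  open import Data.Integer.Solver using (module +-*-Solver)
  open +-*-Solver using (solve; _:+_; _:*_; _:-_; _:=_; con)
  open import Algebra.Properties.Semiring.Sum ℤ.+-*-semiring using (sum; sum-cong-≗; ∑-distrib-+; sum-replicate-zero)
  open import Data.Fin as Fin using (Fin; zero; suc; toℕ; fromℕ<)
  open import Data.Fin.Properties as Fin using (toℕ<n; toℕ-fromℕ<)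
  open import Data.Fin.Subset using (Subset; ∁; ⁅_⁆; ⊥)
  open import Data.Vec using (Vec; []; _∷_; lookup; tabulate)
  open import Data.Vec.Properties using (lookup∘tabulate)
  open import Function using (_∘_)
  open import Relation.Binary.PropositionalEquality using (_≡_; _≢_; refl; sym; trans; cong; cong₂; subst; subst₂)

  private variable n m : ℕ

  -- Linear arithmetic by certificate: the hypotheses are added up with `_⊹_` to one inequality a ≤
  -- b, and the ring solver checks that r - l and b - a agree.
  ≤-by : {a b l r : ℤ} → a ≤ b → r - l ≡ b - a → l ≤ r
  ≤-by a≤b eq = ℤ.0≤i-j⇒j≤i (subst (0ℤ ≤_) (sym eq) (ℤ.i≤j⇒0≤j-i a≤b))

  ≡-by : {a b l r : ℤ} → a ≡ b → r - l ≡ b - a → l ≡ r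
  ≡-by {a} {b} a≡b eq = sym (ℤ.i-j≡0⇒i≡j _ _ (trans eq (ℤ.i≡j⇒i-j≡0 (sym a≡b))))

  infixl 6 _⊹_
  _⊹_ : {a b c d : ℤ} → a ≤ b → c ≤ d → a + c ≤ b + d
  _⊹_ = ℤ.+-mono-≤

  scale : (t : ℕ) {a b : ℕ} → a ℕ.≤ b → + t * + a ≤ + t * + b
  scale t a≤b = ℤ.*-monoˡ-≤-nonNeg (+ t) (+≤+ a≤b)

  private
    +-interchange : ∀ a b c d → (a ℕ.+ b) ℕ.+ (c ℕ.+ d) ≡ (a ℕ.+ c) ℕ.+ (b ℕ.+ d)
    +-interchange = ℕSolver.+-*-Solver.solve 4 (λ a b c d → ((a :⊕ b) :⊕ (c :⊕ d)) :≡ ((a :⊕ c) :⊕ (b :⊕ d))) refl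
      where open ℕSolver.+-*-Solver renaming (_:+_ to _:⊕_; _:=_ to _:≡_)

  sumℕ-+ : (f g : Fin m → ℕ) → sumℕ (λ i → f i ℕ.+ g i) ≡ sumℕ f ℕ.+ sumℕ g
  sumℕ-+ {zero}  f g = refl
  sumℕ-+ {suc m} f g = trans (cong (f zero ℕ.+ g zero ℕ.+_) (sumℕ-+ (f ∘ suc) (g ∘ suc)))
    (+-interchange (f zero) (g zero) (sumℕ (f ∘ suc)) (sumℕ (g ∘ suc)))

  sumℕ-cong : {f g : Fin m → ℕ} → (∀ i → f i ≡ g i) → sumℕ f ≡ sumℕ g
  sumℕ-cong {zero}  f≗g = refl
  sumℕ-cong {suc m} f≗g = cong₂ ℕ._+_ (f≗g zero) (sumℕ-cong (f≗g ∘ suc))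

  sumℕ-mono : {f g : Fin m → ℕ} → (∀ i → f i ℕ.≤ g i) → sumℕ f ℕ.≤ sumℕ g
  sumℕ-mono {zero}  f≤g = z≤n
  sumℕ-mono {suc m} f≤g = ℕ.+-mono-≤ (f≤g zero) (sumℕ-mono (f≤g ∘ suc))

  +-sumℕ : (f : Fin m → ℕ) → + sumℕ f ≡ sum (λ i → + f i)
  +-sumℕ {zero}  f = refl
  +-sumℕ {suc m} f = cong (_+_ (+ f zero)) (+-sumℕ (f ∘ suc))

  sum-mono : {f g : Fin m → ℤ} → (∀ i → f i ≤ g i) → sum f ≤ sum g
  sum-mono {zero}  f≤g = ℤ.≤-refl
  sum-mono {suc m} f≤g = f≤g zero ⊹ sum-mono (f≤g ∘ suc)

  -- Summands compared away from one index j; both sides carry the term at j so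
  -- that no subtraction is needed.
  sum-mono-except : {f g : Fin m → ℤ} (j : Fin m) → (∀ i → i ≢ j → f i ≤ g i) → sum f + g j ≤ sum g + f j
  sum-mono-except {f = f} {g} zero f≤g = ≤-by (sum-mono (λ i → f≤g (suc i) λ ()))
    (solve 4 (λ f₀ g₀ x y → g₀ :+ y :+ f₀ :- (f₀ :+ x :+ g₀) := y :- x) refl
      (f zero) (g zero) (sum (f ∘ suc)) (sum (g ∘ suc)))
  sum-mono-except {f = f} {g} (suc j) f≤g =
    ≤-by (f≤g zero (λ ()) ⊹ sum-mono-except {f = f ∘ suc} {g = g ∘ suc} j (λ i i≢j → f≤g (suc i) (i≢j ∘ Fin.suc-injective)))
    (solve 6 (λ f₀ g₀ x y a b → g₀ :+ y :+ a :- (f₀ :+ x :+ b) := g₀ :+ (y :+ a) :- (f₀ :+ (x :+ b))) refl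
      (f zero) (g zero) (sum (f ∘ suc)) (sum (g ∘ suc)) (f (suc j)) (g (suc j)))

  sum-except : {f g : Fin m → ℤ} (j : Fin m) → (∀ i → i ≢ j → f i ≡ g i) → sum f + g j ≡ sum g + f j
  sum-except j f≡g = ℤ.≤-antisym (sum-mono-except j (λ i i≢j → ℤ.≤-reflexive (f≡g i i≢j)))
    (sum-mono-except j (λ i i≢j → ℤ.≤-reflexive (sym (f≡g i i≢j))))

  sumℕ-mono-except : (f g : Fin m → ℕ) (j : Fin m) → (∀ i → i ≢ j → f i ℕ.≤ g i) →
    sumℕ f ℕ.+ g j ℕ.≤ sumℕ g ℕ.+ f j
  sumℕ-mono-except f g j f≤g = ℤ.drop‿+≤+ (subst₂ (λ x y → x + + g j ≤ y + + f j)
    (sym (+-sumℕ f)) (sym (+-sumℕ g)) (sum-mono-except j (λ i i≢j → +≤+ (f≤g i i≢j))))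

  prefix : Vec ℤ n → ℕ → ℤ
  prefix []      _       = 0ℤ
  prefix (x ∷ v) zero    = 0ℤ
  prefix (x ∷ v) (suc k) = x + prefix v k

  prefix-zero : (v : Vec ℤ n) → prefix v 0 ≡ 0ℤ
  prefix-zero []      = refl
  prefix-zero (_ ∷ _) = refl

  prefix-suc : (v : Vec ℤ n) (i : Fin n) → prefix v (suc (toℕ i)) ≡ prefix v (toℕ i) + lookup v i
  prefix-suc (x ∷ v) zero    = trans (cong (_+_ x) (prefix-zero v)) (ℤ.+-comm x 0ℤ)
  prefix-suc (x ∷ v) (suc i) = trans (cong (_+_ x) (prefix-suc v i)) (sym (ℤ.+-assoc x _ _))

  increments : (P : ℕ → Set) → P 0 → (∀ (i : Fin n) → P (toℕ i) → P (suc (toℕ i))) → ∀ {k} → k ℕ.≤ n → P k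
  increments         P p₀ step z≤n       = p₀
  increments {suc n} P p₀ step (s≤s {k} k≤n) = step′ (increments {suc n} P p₀ step (ℕ.m≤n⇒m≤1+n k≤n))
    where
    k≡ : toℕ (fromℕ< (s≤s k≤n)) ≡ k
    k≡ = toℕ-fromℕ< (s≤s k≤n)
    step′ : P k → P (suc k)
    step′ p = subst (P ∘ suc) k≡ (step (fromℕ< (s≤s k≤n)) (subst P (sym k≡) p))

  differences : (n : ℕ) → (ℕ → ℤ) → Vec ℤ n
  differences n F = tabulate (λ i → F (suc (toℕ i)) - F (toℕ i))

  prefix-differences : (F : ℕ → ℤ) → F 0 ≡ 0ℤ → {k : ℕ} → k ℕ.≤ n → prefix (differences n F) k ≡ F k
  prefix-differences {n} F F0 = increments (λ k → prefix (differences n F) k ≡ F k) (trans (prefix-zero (differences n F)) (sym F0)) λ i eq →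
    trans (prefix-suc (differences n F) i) (trans (cong₂ _+_ eq (lookup∘tabulate _ i))
      (solve 2 (λ a b → a :+ (b :- a) := b) refl (F (toℕ i)) (F (suc (toℕ i)))))

  lookup-ext : {A : Set} {v w : Vec A n} → (∀ i → lookup v i ≡ lookup w i) → v ≡ w
  lookup-ext {v = []}    {[]}    eq = refl
  lookup-ext {v = _ ∷ _} {_ ∷ _} eq = cong₂ _∷_ (eq zero) (lookup-ext (eq ∘ suc))

  lookup-prefix : (v : Vec ℤ n) (i : Fin n) → lookup v i ≡ prefix v (suc (toℕ i)) - prefix v (toℕ i)
  lookup-prefix v i = trans (solve 2 (λ a b → b := a :+ b :- a) refl (prefix v (toℕ i)) (lookup v i))
    (cong (_- prefix v (toℕ i)) (sym (prefix-suc v i)))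

  prefix-injective : {v w : Vec ℤ n} → (∀ {k} → k ℕ.≤ n → prefix v k ≡ prefix w k) → v ≡ w
  prefix-injective {v = v} {w} eq = lookup-ext λ i → trans (lookup-prefix v i)
    (trans (cong₂ _-_ (eq (toℕ<n i)) (eq (ℕ.<⇒≤ (toℕ<n i)))) (sym (lookup-prefix w i)))

  over : Subset n → Vec ℤ n → ℤ
  over []          []      = 0ℤ
  over (true  ∷ I) (x ∷ v) = x + over I v
  over (false ∷ I) (x ∷ v) = over I v

  over-below : (v : Vec ℤ n) (k : ℕ) → over (below n k) v ≡ prefix v k
  over-below []      k       = refl
  over-below (x ∷ v) zero    = trans (over-below v zero) (prefix-zero v)
  over-below (x ∷ v) (suc k) = cong (_+_ x) (over-below v k)

  over-∁ : (I : Subset n) (v : Vec ℤ n) → over (∁ I) v ≡ prefix v n - over I v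
  over-∁ []          []      = refl
  over-∁ (true  ∷ I) (x ∷ v) = trans (over-∁ I v)
    (solve 3 (λ x p o → p :- o := x :+ p :- (x :+ o)) refl x (prefix v _) (over I v))
  over-∁ (false ∷ I) (x ∷ v) = trans (cong (_+_ x) (over-∁ I v)) (sym (ℤ.+-assoc x _ _))

  over-⊥ : (v : Vec ℤ n) → over ⊥ v ≡ 0ℤ
  over-⊥ []      = refl
  over-⊥ (x ∷ v) = over-⊥ v

  over-⁅⁆ : (i : Fin n) (v : Vec ℤ n) → over ⁅ i ⁆ v ≡ lookup v i
  over-⁅⁆ zero    (x ∷ v) = trans (cong (_+_ x) (over-⊥ v)) (ℤ.+-identityʳ x)
  over-⁅⁆ (suc i) (x ∷ v) = over-⁅⁆ i v

  ∑ᵥ : (Fin m → Vec ℤ n) → Vec ℤ n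
  ∑ᵥ w = tabulate (λ i → sum (λ j → lookup (w j) i))

  prefix-∑ᵥ : (w : Fin m → Vec ℤ n) {k : ℕ} → k ℕ.≤ n → prefix (∑ᵥ w) k ≡ sum (λ j → prefix (w j) k)
  prefix-∑ᵥ {m} w = increments (λ k → prefix (∑ᵥ w) k ≡ sum (λ j → prefix (w j) k))
    (trans (prefix-zero (∑ᵥ w)) (sym (trans (sum-cong-≗ (λ j → prefix-zero (w j))) (sum-replicate-zero m))))
    λ i eq → trans (prefix-suc (∑ᵥ w) i) (trans (cong₂ _+_ eq (lookup∘tabulate _ i))
      (trans (sym (∑-distrib-+ (λ j → prefix (w j) (toℕ i)) (λ j → lookup (w j) i)))
        (sum-cong-≗ (λ j → sym (prefix-suc (w j) i)))))

open PrefixSums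

-- Integer points of the dilated column polytopes and of the dilated Schubitope.

module IntegerPolytopes where
  open import Defs
  open import Data.Bool using (Bool; true; false; if_then_else_)
  open import Data.Nat as ℕ using (ℕ; zero; suc; z≤n)
  import Data.Nat.Properties as ℕ
  open import Data.Integer using (ℤ; +_; _+_; _-_; _*_; -_; _≤_; 0ℤ; 1ℤ)
  import Data.Integer.Properties as ℤ
  open import Data.Integer.Solver using (module +-*-Solver)
  open +-*-Solver using (solve; _:+_; _:*_; _:-_; _:=_; con)
  open import Algebra.Properties.Semiring.Sum ℤ.+-*-semiring using (sum; sum-cong-≗; ∑-comm; *-distribˡ-sum; sum-replicate-zero)
  open import Data.Fin using (Fin; zero; suc; toℕ)
  open import Data.Fin.Properties using (toℕ<n)
  open import Data.Fin.Subset using (Subset; ∣_∣)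
  open import Data.Vec using (Vec; []; _∷_; lookup)
  open import Data.Vec.Properties using (lookup∘tabulate)
  open import Data.Product using (_,_)
  open import Function using (_∘_)
  open import Relation.Binary.PropositionalEquality using (_≡_; refl; sym; trans; cong; cong₂; subst; subst₂; module ≡-Reasoning)

  private variable n m : ℕ

  -- F is the prefix-sum function of a point of t·P(SM(S)); "dominates" is the Gale order.
  record Admissible {n : ℕ} (S : Subset n) (t : ℕ) (F : ℕ → ℤ) : Set where
    field
      start     : F 0 ≡ 0ℤ
      increases : ∀ (i : Fin n) → F (toℕ i) ≤ F (suc (toℕ i))
      slope≤    : ∀ (i : Fin n) → F (suc (toℕ i)) ≤ F (toℕ i) + + t
      dominates : ∀ {k} → k ℕ.≤ n → + t * + count S k ≤ F k
      end       : F n ≡ + t * + ∣ S ∣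
  open Admissible

  -- Besides the integer points of the dilate by t, this describes, for t = q, the points of the
  -- Schubitope itself with common denominator q.
  record IntSchubitope {n : ℕ} (D : Diagram n) (t : ℕ) (v : Vec ℤ n) : Set where
    field
      nonneg : ∀ i → 0ℤ ≤ lookup v i
      total  : prefix v n ≡ + t * + size D
      bound  : ∀ I → over I v ≤ + t * + θ D I
  open IntSchubitope

  admissible-cong : {S : Subset n} {t : ℕ} {F G : ℕ → ℤ} → (∀ {k} → k ℕ.≤ n → F k ≡ G k) →
    Admissible S t F → Admissible S t G
  admissible-cong {S = S} {t} F≗G adm = record
    { start     = trans (sym (F≗G z≤n)) (start adm)
    ; increases = λ i → subst₂ _≤_ (F≗G (ℕ.<⇒≤ (toℕ<n i))) (F≗G (toℕ<n i)) (increases adm i)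
    ; slope≤    = λ i → subst₂ (λ x y → x ≤ y + + t) (F≗G (toℕ<n i)) (F≗G (ℕ.<⇒≤ (toℕ<n i))) (slope≤ adm i)
    ; dominates = λ k≤n → subst (+ t * + count S _ ≤_) (F≗G k≤n) (dominates adm k≤n)
    ; end       = trans (sym (F≗G ℕ.≤-refl)) (end adm)
    }

  admissible-differences : {S : Subset n} {t : ℕ} {F : ℕ → ℤ} → Admissible S t F →
    Admissible S t (prefix (differences n F))
  admissible-differences {F = F} adm = admissible-cong (λ k≤n → sym (prefix-differences F (start adm) k≤n)) adm

  over-∷ : (b : Bool) (I : Subset n) (x : ℤ) (v : Vec ℤ n) →
    over (b ∷ I) (x ∷ v) ≡ (if b then x else 0ℤ) + over I v
  over-∷ true  I x v = refl
  over-∷ false I x v = sym (ℤ.+-identityˡ _)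

  over≡sum : (I : Subset n) (v : Vec ℤ n) → over I v ≡ sum (λ i → if lookup I i then lookup v i else 0ℤ)
  over≡sum []      []      = refl
  over≡sum (b ∷ I) (x ∷ v) = trans (over-∷ b I x v) (cong (_+_ (if b then x else 0ℤ)) (over≡sum I v))

  over-∑ᵥ : (I : Subset n) (w : Fin m → Vec ℤ n) → over I (∑ᵥ w) ≡ sum (λ j → over I (w j))
  over-∑ᵥ {n} {m} I w = begin
    over I (∑ᵥ w)                                                   ≡⟨ over≡sum I (∑ᵥ w) ⟩
    sum (λ i → mask i (lookup (∑ᵥ w) i))                            ≡⟨ sum-cong-≗ (λ i → trans (cong (mask i) (lookup∘tabulate _ i)) (mask-sum (lookup I i) _)) ⟩
    sum (λ i → sum (λ j → mask i (lookup (w j) i)))                 ≡⟨ ∑-comm (λ i j → mask i (lookup (w j) i)) ⟩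
    sum (λ j → sum (λ i → mask i (lookup (w j) i)))                 ≡⟨ sum-cong-≗ (λ j → sym (over≡sum I (w j))) ⟩
    sum (λ j → over I (w j)) ∎
    where
    open ≡-Reasoning
    mask : Fin n → ℤ → ℤ
    mask i x = if lookup I i then x else 0ℤ
    mask-sum : (b : Bool) (f : Fin m → ℤ) → (if b then sum f else 0ℤ) ≡ sum (λ j → if b then f j else 0ℤ)
    mask-sum true  f = refl
    mask-sum false f = sym (sum-replicate-zero m)

  -- Split I at the cut: above it there are `count I k` rows worth at most t each, below it
  -- nonnegativity bounds the part in I by the whole rest of the total.
  over-cut : (t : ℕ) (I : Subset n) (w : Vec ℤ n) → (∀ i → 0ℤ ≤ lookup w i) → (∀ i → lookup w i ≤ + t) →
    (k : ℕ) → over I w + prefix w k ≤ + t * + count I k + prefix w n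
  over-cut t [] [] w≥0 w≤t k = ℤ.≤-reflexive (solve 1 (λ t → con 0ℤ := t :* con 0ℤ :+ con 0ℤ) refl (+ t))
  over-cut t (true ∷ I) (x ∷ w) w≥0 w≤t zero with over-cut t I w (w≥0 ∘ suc) (w≤t ∘ suc) 0
  ... | ih rewrite prefix-zero w | count-zero I = ≤-by ih
    (solve 4 (λ x o t p → t :* con 0ℤ :+ (x :+ p) :- (x :+ o :+ con 0ℤ) := t :* con 0ℤ :+ p :- (o :+ con 0ℤ)) refl
      x (over I w) (+ t) (prefix w _))
  over-cut t (false ∷ I) (x ∷ w) w≥0 w≤t zero with over-cut t I w (w≥0 ∘ suc) (w≤t ∘ suc) 0
  ... | ih rewrite prefix-zero w | count-zero I = ≤-by (ih ⊹ w≥0 zero)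
    (solve 4 (λ x o t p → t :* con 0ℤ :+ (x :+ p) :- (o :+ con 0ℤ) := t :* con 0ℤ :+ p :+ x :- (o :+ con 0ℤ :+ con 0ℤ)) refl
      x (over I w) (+ t) (prefix w _))
  over-cut t (true ∷ I) (x ∷ w) w≥0 w≤t (suc k) =
    ≤-by (over-cut t I w (w≥0 ∘ suc) (w≤t ∘ suc) k ⊹ w≤t zero)
    (solve 6 (λ x o t p q c → t :* (con 1ℤ :+ c) :+ (x :+ p) :- (x :+ o :+ (x :+ q)) := t :* c :+ p :+ t :- (o :+ q :+ x)) refl
      x (over I w) (+ t) (prefix w _) (prefix w k) (+ count I k))
  over-cut t (false ∷ I) (x ∷ w) w≥0 w≤t (suc k) = ≤-by (over-cut t I w (w≥0 ∘ suc) (w≤t ∘ suc) k)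
    (solve 5 (λ x o c p q → c :+ (x :+ p) :- (o :+ (x :+ q)) := c :+ p :- (o :+ q)) refl
      x (over I w) (+ t * + count I k) (prefix w _) (prefix w k))

  module _ {S : Subset n} {t : ℕ} (w : Vec ℤ n) (adm : Admissible S t (prefix w)) where

    admissible-≥0 : ∀ i → 0ℤ ≤ lookup w i
    admissible-≥0 i = ≤-by (increases adm i) (trans (ℤ.+-identityʳ _) (lookup-prefix w i))

    admissible-≤t : ∀ i → lookup w i ≤ + t
    admissible-≤t i = ≤-by (slope≤ adm i) (trans (cong (λ x → + t - x) (lookup-prefix w i))
      (solve 3 (λ t a b → t :- (b :- a) := a :+ t :- b) refl (+ t) (prefix w (toℕ i)) (prefix w (suc (toℕ i)))))

    -- At a tight cut k, bounding `prefix w k` from below by `dominates` turns `over-cut` into t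
    -- (`count I k` + `∣ S ∣` - `count S k`), which is tθ.
    over-admissible : (I : Subset n) → over I w ≤ + t * + θcol S I
    over-admissible I =
      let k , k≤n , eq = θ-tightCut S I
      in ≤-by (over-cut t I w admissible-≥0 admissible-≤t k ⊹ dominates adm k≤n)
        (trans (solve 4 (λ t th c o → t :* th :- o := t :* (th :+ c) :- (t :* c :+ o)) refl
            (+ t) (+ θcol S I) (+ count S k) (over I w))
          (trans (cong₂ (λ x y → + t * x - y) (cong +_ eq) refl)
          (trans (solve 6 (λ t ci s cs o p → t :* (ci :+ s) :- (t :* cs :+ o) :=
              t :* ci :+ t :* s :+ p :- (o :+ p :+ t :* cs)) refl
              (+ t) (+ count I k) (+ ∣ S ∣) (+ count S k) (over I w) (prefix w k))
            (cong (λ x → + t * + count I k + x + prefix w k - (over I w + prefix w k + + t * + count S k)) (sym (end adm))))))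

  sum-scale : (t : ℕ) (f : Fin m → ℕ) → sum (λ j → + t * + f j) ≡ + t * + sumℕ f
  sum-scale t f = sym (trans (cong (_*_ (+ t)) (+-sumℕ f)) (*-distribˡ-sum (+ t) (λ j → + f j)))

  -- The inclusion of the Minkowski sum of the column polytopes, valid for every diagram: all the
  -- inequalities add up over the columns.
  schubitope-∑ᵥ : {D : Diagram n} {t : ℕ} (w : Fin n → Vec ℤ n) →
    (∀ j → Admissible (D j) t (prefix (w j))) → IntSchubitope D t (∑ᵥ w)
  schubitope-∑ᵥ {n} {D} {t} w adm = record
    { nonneg = λ i → subst (0ℤ ≤_) (sym (lookup∘tabulate _ i))
        (subst (_≤ sum (λ j → lookup (w j) i)) (sum-replicate-zero n) (sum-mono (λ j → admissible-≥0 (w j) (adm j) i)))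
    ; total  = trans (prefix-∑ᵥ w ℕ.≤-refl) (trans (sum-cong-≗ (λ j → end (adm j))) (sum-scale t (λ j → ∣ D j ∣)))
    ; bound  = λ I → subst₂ _≤_ (sym (over-∑ᵥ I w)) (sum-scale t (λ j → θcol (D j) I))
        (sum-mono (λ j → over-admissible (w j) (adm j) I))
    }

open IntegerPolytopes

-- Splitting a point of the Schubitope into column components.

module Decomposition where
  open import Defs
  open import Data.Bool using (if_then_else_)
  open import Data.Nat as ℕ using (ℕ; suc; z≤n; s≤s)
  import Data.Nat.Properties as ℕ
  open import Data.Integer using (ℤ; +_; _+_; _-_; _*_; -_; _≤_; 0ℤ; 1ℤ)
  import Data.Integer.Properties as ℤ
  open import Data.Integer.Solver using (module +-*-Solver)
  open +-*-Solver using (solve; _:+_; _:*_; _:-_; _:=_; con)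
  open import Algebra.Properties.Semiring.Sum ℤ.+-*-semiring using (sum; sum-cong-≗)
  open import Data.Fin using (Fin; suc; toℕ)
  open import Data.Fin.Properties using (any?)
  open import Data.Fin.Subset using (Subset; ∣_∣; ∁; ⁅_⁆)
  open import Data.Vec using (Vec; lookup)
  open import Data.Product using (_×_; _,_; proj₁; proj₂)
  open import Data.Sum using (_⊎_; inj₁; inj₂)
  open import Relation.Nullary.Decidable using (dec-true; dec-false)
  open import Relation.Nullary using (¬_; yes; no; does)
  open import Relation.Binary.PropositionalEquality using (_≡_; _≢_; refl; sym; trans; cong; cong₂; subst; module ≡-Reasoning)

  open Admissible
  open IntSchubitope

  private variable n m : ℕ

  boxesAbove : Diagram n → ℕ → ℕ
  boxesAbove D k = sumℕ (λ j → count (D j) k)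

  θ-except : (D : Diagram n) (I : Subset n) (g : Fin n → ℕ) (j : Fin n) →
    (∀ i → i ≢ j → θcol (D i) I ℕ.≤ g i) → θ D I ℕ.+ g j ℕ.≤ sumℕ g ℕ.+ θcol (D j) I
  θ-except D I g j = sumℕ-mono-except (λ i → θcol (D i) I) g j

  excess : Diagram n → ℕ → (ℕ → ℤ) → ℕ → ℤ
  excess D t F k = F k - + t * + boxesAbove D k

  onActive : Subset n → ℕ → ℤ → ℤ
  onActive S k z = if does (active? S k) then z else 0ℤ

  onActive-yes : (S : Subset n) {k : ℕ} {z : ℤ} → Active S k → onActive S k z ≡ z
  onActive-yes S {k} {z} act = cong (λ b → if b then z else 0ℤ) (dec-true (active? S k) act)

  onActive-no : (S : Subset n) {k : ℕ} {z : ℤ} → ¬ Active S k → onActive S k z ≡ 0ℤ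
  onActive-no S {k} {z} ¬a = cong (λ b → if b then z else 0ℤ) (dec-false (active? S k) ¬a)

  -- When no line k is active for two columns, the prefix sum F k of a sum of column
  -- points differs from the value t Σ_j |D_j ∩ [0,k)| forced by the inactive columns
  -- only through the one active column, so every column is recovered from F.
  component : Diagram n → ℕ → (ℕ → ℤ) → Fin n → ℕ → ℤ
  component D t F j k = + t * + count (D j) k + onActive (D j) k (excess D t F k)

  component-yes : (D : Diagram n) (t : ℕ) (F : ℕ → ℤ) (j : Fin n) {k : ℕ} → Active (D j) k →
    component D t F j k ≡ + t * + count (D j) k + excess D t F k
  component-yes D t F j {k} act = cong (_+_ (+ t * + count (D j) k)) (onActive-yes (D j) act)

  component-no : (D : Diagram n) (t : ℕ) (F : ℕ → ℤ) (j : Fin n) {k : ℕ} → ¬ Active (D j) k →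
    component D t F j k ≡ + t * + count (D j) k
  component-no D t F j {k} ¬a =
    trans (cong (_+_ (+ t * + count (D j) k)) (onActive-no (D j) ¬a)) (ℤ.+-identityʳ _)

  module _ {D : Diagram n} {t : ℕ} {v : Vec ℤ n} (v∈ : IntSchubitope D t v) where

    -- The inequality for the rows below line k: θ of a column there is at most its number of boxes
    -- below the line, so the rest of the total must lie above.
    excess-≥0 : ∀ k → 0ℤ ≤ excess D t (prefix v) k
    excess-≥0 k = ≤-by
      (bound v∈ (∁ (below n k)) ⊹ scale t (subst (ℕ._≤ size D)
        (sumℕ-+ (λ j → θcol (D j) (∁ (below n k))) (λ j → count (D j) k)) (sumℕ-mono (λ j → θ-above (D j) k))))
      (trans (solve 5 (λ t c s θ p → p :- t :* c :- con 0ℤ :=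
          t :* θ :+ t :* s :- (t :* s :- p :+ t :* (θ :+ c))) refl
          (+ t) (+ boxesAbove D k) (+ size D) (+ θ D (∁ (below n k))) (prefix v k))
        (cong (λ o → + t * + θ D (∁ (below n k)) + + t * + size D - (o + + t * + (θ D (∁ (below n k)) ℕ.+ boxesAbove D k)))
          (sym (trans (over-∁ (below n k) v) (cong₂ _-_ (total v∈) (over-below v k))))))

    prefix≤θ-below : ∀ k → prefix v k ≤ + t * + θ D (below n k)
    prefix≤θ-below k = subst (_≤ + t * + θ D (below n k)) (over-below v k) (bound v∈ (below n k))

    excess≡0 : ∀ k → (∀ j → ¬ Active (D j) k) → excess D t (prefix v) k ≡ 0ℤ
    excess≡0 k ¬a = ℤ.≤-antisym
      (ℤ.i≤j⇒i-j≤0 (ℤ.≤-trans (prefix≤θ-below k) (scale t (sumℕ-mono (λ j → θ-below-inactive (D j) k (¬a j))))))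
      (excess-≥0 k)

    module _ (excl : Exclusive D) where

      others-inactive : ∀ {k} j → Active (D j) k → ∀ i → i ≢ j → ¬ Active (D i) k
      others-inactive {k} j act i i≢j act′ = i≢j (excl k i j act′ act)

      component-≥ : ∀ j k → + t * + count (D j) k ≤ component D t (prefix v) j k
      component-≥ j k with active? (D j) k
      ... | yes act = subst (+ t * + count (D j) k ≤_) (sym (component-yes D t (prefix v) j act))
            (≤-by (excess-≥0 k) (solve 2 (λ a e → a :+ e :- a := e :- con 0ℤ) refl
              (+ t * + count (D j) k) (excess D t (prefix v) k)))
      ... | no  ¬a = ℤ.≤-reflexive (sym (component-no D t (prefix v) j ¬a))

      -- If k is active for column j, the other columns contribute to θ of `below n k` at most their
      -- own counts, which cancel against `boxesAbove`. The maximum with `count` covers the inactive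
      -- case.
      component-≤θ : ∀ j k → component D t (prefix v) j k ≤ + t * + (θcol (D j) (below n k) ℕ.⊔ count (D j) k)
      component-≤θ j k with active? (D j) k
      ... | yes act = ℤ.≤-trans (ℤ.≤-reflexive (component-yes D t (prefix v) j act)) (ℤ.≤-trans
            (≤-by (prefix≤θ-below k ⊹ scale t (θ-except D (below n k) (λ i → count (D i) k) j
               (λ i i≢j → θ-below-inactive (D i) k (others-inactive j act i i≢j))))
             (solve 6 (λ t θ c C x θj → t :* θj :- (t :* c :+ (x :- t :* C)) := t :* θ :+ t :* (C :+ θj) :- (x :+ t :* (θ :+ c))) refl
               (+ t) (+ θ D (below n k)) (+ count (D j) k) (+ boxesAbove D k) (prefix v k) (+ θcol (D j) (below n k))))
            (scale t (ℕ.m≤m⊔n _ (count (D j) k))))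
      ... | no  ¬a = ℤ.≤-trans (ℤ.≤-reflexive (component-no D t (prefix v) j ¬a)) (scale t (ℕ.m≤n⊔m (θcol (D j) (below n k)) _))

      component-≤k : ∀ j k → component D t (prefix v) j k ≤ + t * + k
      component-≤k j k = ℤ.≤-trans (component-≤θ j k) (scale t (ℕ.⊔-lub (θ-below≤k (D j) k) (count≤k (D j) k)))

      component-≤∣∣ : ∀ j k → component D t (prefix v) j k ≤ + t * + ∣ D j ∣
      component-≤∣∣ j k = ℤ.≤-trans (component-≤θ j k) (scale t (ℕ.⊔-lub (θ≤∣S∣ (D j) (below n k)) (count≤∣∣ (D j) k)))

      private
        bits : Fin n → ℕ
        bits i = sumℕ (λ j → bit (D j) (toℕ i))

      -- The inequality for all rows but i: the other columns cannot move a box out of row i, so row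
      -- i carries at least t times their bits, with column j contributing nothing.
      increment-≥ : ∀ j i → Active (D j) (toℕ i) → + t * + bits i ≤ lookup v i + + t * + bit (D j) (toℕ i)
      increment-≥ j i act = ≤-by
        (bound v∈ (∁ ⁅ i ⁆) ⊹ scale t except ⊹ scale t (θ≤∣S∣ (D j) (∁ ⁅ i ⁆)))
        (trans (solve 8 (λ t B x b s d θ θj → x :+ t :* b :- t :* B :=
             t :* θ :+ t :* (s :+ (θj :+ b)) :+ t :* d :- (t :* s :- x :+ t :* (θ :+ B :+ d) :+ t :* θj)) refl
             (+ t) (+ bits i) (lookup v i) (+ bit (D j) (toℕ i)) (+ size D) (+ ∣ D j ∣) (+ θ D (∁ ⁅ i ⁆)) (+ θcol (D j) (∁ ⁅ i ⁆)))
          (cong (λ o → + t * + θ D (∁ ⁅ i ⁆) + + t * + (size D ℕ.+ (θcol (D j) (∁ ⁅ i ⁆) ℕ.+ bit (D j) (toℕ i))) + + t * + ∣ D j ∣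
               - (o + + t * + (θ D (∁ ⁅ i ⁆) ℕ.+ bits i ℕ.+ ∣ D j ∣) + + t * + θcol (D j) (∁ ⁅ i ⁆)))
            (sym (trans (over-∁ ⁅ i ⁆ v) (cong₂ _-_ (total v∈) (over-⁅⁆ i v))))))
        where
        except : (θ D (∁ ⁅ i ⁆) ℕ.+ bits i) ℕ.+ ∣ D j ∣ ℕ.≤ size D ℕ.+ (θcol (D j) (∁ ⁅ i ⁆) ℕ.+ bit (D j) (toℕ i))
        except = subst (λ x → x ℕ.+ ∣ D j ∣ ℕ.≤ size D ℕ.+ (θcol (D j) (∁ ⁅ i ⁆) ℕ.+ bit (D j) (toℕ i)))
          (sumℕ-+ (λ j → θcol (D j) (∁ ⁅ i ⁆)) (λ j → bit (D j) (toℕ i)))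
          (sumℕ-mono-except (λ j → θcol (D j) (∁ ⁅ i ⁆) ℕ.+ bit (D j) (toℕ i)) (λ j → ∣ D j ∣) j
            (λ i′ i′≢j → θ-∁⁅⁆-inactive (D i′) i (others-inactive j act i′ i′≢j)))

      -- The inequality for row i alone: the other columns, inactive on both sides of the row, add
      -- at most t times their bits, and column j adds at most t.
      increment-≤ : ∀ j i → Active (D j) (toℕ i) → Active (D j) (suc (toℕ i)) →
        lookup v i + + t * + bit (D j) (toℕ i) ≤ + t * + bits i + + t
      increment-≤ j i act act′ = ≤-by
        (subst (_≤ + t * + θ D ⁅ i ⁆) (over-⁅⁆ i v) (bound v∈ ⁅ i ⁆)
          ⊹ scale t (θ-except D ⁅ i ⁆ (λ j → bit (D j) (toℕ i)) j (λ i′ i′≢j →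
              θ-⁅⁆-inactive (D i′) i (others-inactive j act i′ i′≢j) (others-inactive j act′ i′ i′≢j)))
          ⊹ scale t (θ-⁅⁆≤1 (D j) i))
        (solve 6 (λ t B x b θ θj → t :* B :+ t :- (x :+ t :* b) :=
            t :* θ :+ t :* (B :+ θj) :+ t :* con 1ℤ :- (x :+ t :* (θ :+ b) :+ t :* θj)) refl
          (+ t) (+ bits i) (lookup v i) (+ bit (D j) (toℕ i)) (+ θ D ⁅ i ⁆) (+ θcol (D j) ⁅ i ⁆))

      component-suc : ∀ j i → Active (D j) (toℕ i) → Active (D j) (suc (toℕ i)) →
        component D t (prefix v) j (suc (toℕ i)) ≡
        component D t (prefix v) j (toℕ i) + (lookup v i + + t * + bit (D j) (toℕ i) - + t * + bits i)
      component-suc j i act act′ = trans (component-yes D t (prefix v) j act′) (trans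
        (cong₂ _+_ (cong (λ c → + t * + c) (count-suc (D j) (toℕ i)))
          (cong₂ (λ p c → p - + t * + c) (prefix-suc v i)
            (trans (sumℕ-cong (λ j → count-suc (D j) (toℕ i))) (sumℕ-+ (λ j → bit (D j) (toℕ i)) (λ j → count (D j) (toℕ i))))))
        (trans (solve 7 (λ t b c x p B C → t :* (b :+ c) :+ (p :+ x :- t :* (B :+ C)) :=
              t :* c :+ (p :- t :* C) :+ (x :+ t :* b :- t :* B)) refl
            (+ t) (+ bit (D j) (toℕ i)) (+ count (D j) (toℕ i)) (lookup v i) (prefix v (toℕ i)) (+ bits i) (+ boxesAbove D (toℕ i)))
          (cong (_+ (lookup v i + + t * + bit (D j) (toℕ i) - + t * + bits i)) (sym (component-yes D t (prefix v) j act)))))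

      private
        t*suc : ∀ c → + t * + suc c ≡ + t * + c + + t
        t*suc c = solve 2 (λ t c → t :* (con 1ℤ :+ c) := t :* c :+ t) refl (+ t) (+ c)

      -- Between two active lines the row inequalities isolate column j. Where its active range
      -- begins or ends, another column may be active on the other side of the row. There the bounds
      -- tk and t|D_j| take over: before the range all rows are full, after it no boxes are left.
      component-step : ∀ j i →
        component D t (prefix v) j (toℕ i) ≤ component D t (prefix v) j (suc (toℕ i)) ×
        component D t (prefix v) j (suc (toℕ i)) ≤ component D t (prefix v) j (toℕ i) + + t
      component-step j i with active? (D j) (toℕ i) | active? (D j) (suc (toℕ i))
      ... | yes act | yes act′ rewrite component-suc j i act act′ =
            ≤-by (increment-≥ j i act) (solve 3 (λ c x B → c :+ (x :- B) :- c := x :- B) refl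
              (component D t (prefix v) j (toℕ i)) (lookup v i + + t * + bit (D j) (toℕ i)) (+ t * + bits i)) ,
            ≤-by (increment-≤ j i act act′) (solve 4 (λ c x B t → c :+ t :- (c :+ (x :- B)) := B :+ t :- x) refl
              (component D t (prefix v) j (toℕ i)) (lookup v i + + t * + bit (D j) (toℕ i)) (+ t * + bits i) (+ t))
      ... | no ¬act | yes act′ rewrite component-no D t (prefix v) j ¬act =
            ℤ.≤-trans (scale t (count-mono-suc (D j) (toℕ i))) (component-≥ j (suc (toℕ i))) ,
            ℤ.≤-trans (component-≤k j (suc (toℕ i)))
              (ℤ.≤-reflexive (trans (t*suc (toℕ i)) (cong (λ c → + t * + c + + t) (sym (count-entering (D j) ¬act act′)))))
      ... | yes act | no ¬act′ rewrite component-no D t (prefix v) j ¬act′ =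
            ℤ.≤-trans (component-≤∣∣ j (toℕ i)) (ℤ.≤-reflexive (cong (λ c → + t * + c) (sym (count-leaving (D j) act ¬act′)))) ,
            ℤ.≤-trans (scale t (count-suc-≤ (D j) (toℕ i)))
              (ℤ.≤-trans (ℤ.≤-reflexive (t*suc _)) (component-≥ j (toℕ i) ⊹ ℤ.≤-refl))
      ... | no ¬act | no ¬act′ rewrite component-no D t (prefix v) j ¬act | component-no D t (prefix v) j ¬act′ =
            scale t (count-mono-suc (D j) (toℕ i)) ,
            ℤ.≤-trans (scale t (count-suc-≤ (D j) (toℕ i))) (ℤ.≤-reflexive (t*suc _))

      component-admissible : ∀ j → Admissible (D j) t (component D t (prefix v) j)
      component-admissible j = record
        { start     = trans (component-no D t (prefix v) j (λ ())) (trans (cong (λ c → + t * + c) (count-zero (D j))) (ℤ.*-zeroʳ (+ t)))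
        ; increases = λ i → proj₁ (component-step j i)
        ; slope≤    = λ i → proj₂ (component-step j i)
        ; dominates = λ {k} _ → component-≥ j k
        ; end       = trans (component-no D t (prefix v) j (λ act → ℕ.<⇒≢ (proj₂ act) (count-all (D j))))
            (cong (λ c → + t * + c) (count-all (D j)))
        }

  sum-component : (D : Diagram n) → Exclusive D → (t : ℕ) (F : ℕ → ℤ) {k : ℕ} →
    ((∀ j → ¬ Active (D j) k) → excess D t F k ≡ 0ℤ) → sum (λ j → component D t F j k) ≡ F k
  sum-component D excl t F {k} none with any? (λ j → active? (D j) k)
  ... | yes (j , act) = ≡-by
    (trans (sum-except j (λ i i≢j → component-no D t F i (λ act′ → i≢j (excl k i j act′ act))))
      (cong₂ _+_ (sum-scale t (λ j → count (D j) k)) (component-yes D t F j act)))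
    (solve 4 (λ s C c x → x :- s := C :+ (c :+ (x :- C)) :- (s :+ c)) refl
      (sum (λ j → component D t F j k)) (+ t * + boxesAbove D k) (+ t * + count (D j) k) (F k))
  ... | no ¬act = begin
    sum (λ j → component D t F j k)  ≡⟨ sum-cong-≗ (λ j → component-no D t F j (λ act → ¬act (j , act))) ⟩
    sum (λ j → + t * + count (D j) k) ≡⟨ sum-scale t (λ j → count (D j) k) ⟩
    + t * + boxesAbove D k            ≡⟨ solve 2 (λ C x → C := x :- (x :- C)) refl (+ t * + boxesAbove D k) (F k) ⟩
    F k - excess D t F k              ≡⟨ cong (λ e → F k - e) (none (λ j act → ¬act (j , act))) ⟩
    F k - 0ℤ                          ≡⟨ ℤ.+-identityʳ (F k) ⟩
    F k ∎
    where open ≡-Reasoning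

  -- A sandwich: the slopes give F k ≤ tk and monotonicity gives F k ≤ F n, and at an inactive line
  -- one of these upper bounds equals the lower bound.
  admissible-inactive : {S : Subset n} {t : ℕ} {F : ℕ → ℤ} → Admissible S t F → {k : ℕ} → k ℕ.≤ n →
    ¬ Active S k → F k ≡ + t * + count S k
  admissible-inactive {n} {S} {t} {F} adm {k} k≤n ¬act = ℤ.≤-antisym (upper (inactive S k ¬act)) (dominates adm k≤n)
    where
    F≤tk : F k ≤ + t * + k
    F≤tk = increments (λ k → F k ≤ + t * + k) (ℤ.≤-reflexive (trans (start adm) (sym (ℤ.*-zeroʳ (+ t)))))
      (λ i ih → ℤ.≤-trans (slope≤ adm i) (ℤ.≤-trans (ih ⊹ ℤ.≤-refl)
        (ℤ.≤-reflexive (solve 2 (λ t k → t :* k :+ t := t :* (con 1ℤ :+ k)) refl (+ t) (+ toℕ i))))) k≤n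
    F≤Fn : k ℕ.≤ n → F k ≤ F n
    F≤Fn = increments (λ l → k ℕ.≤ l → F k ≤ F l) (λ k≤0 → ℤ.≤-reflexive (cong F (ℕ.≤-antisym k≤0 z≤n))) step ℕ.≤-refl
      where
      step : ∀ i → (k ℕ.≤ toℕ i → F k ≤ F (toℕ i)) → k ℕ.≤ suc (toℕ i) → F k ≤ F (suc (toℕ i))
      step i ih k≤ with ℕ.m≤n⇒m<n∨m≡n k≤
      ... | inj₁ (s≤s k≤i) = ℤ.≤-trans (ih k≤i) (increases adm i)
      ... | inj₂ refl      = ℤ.≤-refl
    upper : count S k ≡ k ⊎ count S k ≡ ∣ S ∣ → F k ≤ + t * + count S k
    upper (inj₁ eq) = subst (λ c → F k ≤ + t * + c) (sym eq) F≤tk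
    upper (inj₂ eq) = ℤ.≤-trans (F≤Fn k≤n) (ℤ.≤-reflexive (trans (end adm) (cong (λ c → + t * + c) (sym eq))))

  -- Every column inactive at k has its forced value there, so an active column must take what
  -- remains of F k.
  component-unique : (D : Diagram n) → Exclusive D → (t : ℕ) {F : ℕ → ℤ} (W : Fin n → ℕ → ℤ) →
    (∀ j → Admissible (D j) t (W j)) → {k : ℕ} → k ℕ.≤ n → sum (λ j → W j k) ≡ F k →
    ∀ j → W j k ≡ component D t F j k
  component-unique D excl t {F} W adm {k} k≤n sum≡ j with active? (D j) k
  ... | no ¬act = trans (admissible-inactive (adm j) k≤n ¬act) (sym (component-no D t F j ¬act))
  ... | yes act = trans (≡-by (sym except)
        (solve 4 (λ w s c C → c :+ (s :- C) :- w := s :+ c :- (C :+ w)) refl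
          (W j k) (F k) (+ t * + count (D j) k) (+ t * + boxesAbove D k)))
        (sym (component-yes D t F j act))
    where
    except : F k + + t * + count (D j) k ≡ + t * + boxesAbove D k + W j k
    except = subst (λ s → s + + t * + count (D j) k ≡ _) sum≡ (trans (sum-except j (λ i i≢j → admissible-inactive (adm i) k≤n (λ act′ → i≢j (excl k i j act′ act))))
      (cong (_+ W j k) (sum-scale t (λ j → count (D j) k))))

open Decomposition

-- Clearing denominators of rational points.

module Fractions where
  open import Defs
  open import Data.Bool using (true; false)
  open import Data.Nat as ℕ using (ℕ; zero; suc)
  import Data.Nat.Properties as ℕ
  open import Data.Integer as ℤ using (ℤ; +_; 0ℤ; 1ℤ)
  import Data.Integer.Properties as ℤ
  open import Data.Integer.Solver using (module +-*-Solver)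
  open +-*-Solver using (solve; _:+_; _:*_; _:-_; _:=_; con)
  open import Data.Rational as ℚ using (ℚ; mkℚ; 0ℚ; 1ℚ; _+_; _*_; _≤_; toℚᵘ)
  import Data.Rational.Properties as ℚ
  open import Data.Rational.Unnormalised as ℚᵘ using (mkℚᵘ; *≡*; *≤*)
  import Data.Rational.Unnormalised.Properties as ℚᵘ
  open import Data.Fin using (zero; suc)
  open import Data.Fin.Subset using (Subset)
  open import Data.Vec using (Vec; []; _∷_; lookup; map)
  open import Data.Vec.Properties using (lookup-map)
  open import Data.Product using (∃; ∃₂; _,_)
  open import Relation.Binary.PropositionalEquality using (_≡_; refl; sym; trans; cong; cong₂; subst; subst₂; module ≡-Reasoning)

  private variable n : ℕ

  toℚᵘ-ℤ→ℚ : ∀ z → toℚᵘ (ℤ→ℚ z) ℚᵘ.≃ mkℚᵘ z 0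
  toℚᵘ-ℤ→ℚ z = ℚ.toℚᵘ-fromℚᵘ (mkℚᵘ z 0)

  ℤ→ℚ-+ : ∀ a b → ℤ→ℚ (a ℤ.+ b) ≡ ℤ→ℚ a + ℤ→ℚ b
  ℤ→ℚ-+ a b = ℚ.toℚᵘ-injective (begin
    toℚᵘ (ℤ→ℚ (a ℤ.+ b))                ≈⟨ toℚᵘ-ℤ→ℚ (a ℤ.+ b) ⟩
    mkℚᵘ (a ℤ.+ b) 0                     ≈⟨ *≡* (solve 2 (λ a b → (a :+ b) :* con 1ℤ := (a :* con 1ℤ :+ b :* con 1ℤ) :* con 1ℤ) refl a b) ⟩
    mkℚᵘ a 0 ℚᵘ.+ mkℚᵘ b 0               ≈⟨ ℚᵘ.+-cong (ℚᵘ.≃-sym {toℚᵘ (ℤ→ℚ a)} (toℚᵘ-ℤ→ℚ a)) (ℚᵘ.≃-sym {toℚᵘ (ℤ→ℚ b)} (toℚᵘ-ℤ→ℚ b)) ⟩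
    toℚᵘ (ℤ→ℚ a) ℚᵘ.+ toℚᵘ (ℤ→ℚ b)     ≈⟨ ℚᵘ.≃-sym {toℚᵘ (ℤ→ℚ a + ℤ→ℚ b)} (ℚ.toℚᵘ-homo-+ (ℤ→ℚ a) (ℤ→ℚ b)) ⟩
    toℚᵘ (ℤ→ℚ a + ℤ→ℚ b) ∎)
    where open ℚᵘ.≃-Reasoning

  ℤ→ℚ-* : ∀ a b → ℤ→ℚ (a ℤ.* b) ≡ ℤ→ℚ a * ℤ→ℚ b
  ℤ→ℚ-* a b = ℚ.toℚᵘ-injective (begin
    toℚᵘ (ℤ→ℚ (a ℤ.* b))                ≈⟨ toℚᵘ-ℤ→ℚ (a ℤ.* b) ⟩
    mkℚᵘ a 0 ℚᵘ.* mkℚᵘ b 0               ≈⟨ ℚᵘ.*-cong (ℚᵘ.≃-sym {toℚᵘ (ℤ→ℚ a)} (toℚᵘ-ℤ→ℚ a)) (ℚᵘ.≃-sym {toℚᵘ (ℤ→ℚ b)} (toℚᵘ-ℤ→ℚ b)) ⟩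
    toℚᵘ (ℤ→ℚ a) ℚᵘ.* toℚᵘ (ℤ→ℚ b)     ≈⟨ ℚᵘ.≃-sym {toℚᵘ (ℤ→ℚ a * ℤ→ℚ b)} (ℚ.toℚᵘ-homo-* (ℤ→ℚ a) (ℤ→ℚ b)) ⟩
    toℚᵘ (ℤ→ℚ a * ℤ→ℚ b) ∎)
    where open ℚᵘ.≃-Reasoning

  ℤ→ℚ-mono : ∀ {a b} → a ℤ.≤ b → ℤ→ℚ a ≤ ℤ→ℚ b
  ℤ→ℚ-mono {a} {b} a≤b = ℚ.toℚᵘ-cancel-≤ (begin
    toℚᵘ (ℤ→ℚ a) ≃⟨ toℚᵘ-ℤ→ℚ a ⟩
    mkℚᵘ a 0      ≤⟨ *≤* (subst₂ ℤ._≤_ (sym (ℤ.*-identityʳ a)) (sym (ℤ.*-identityʳ b)) a≤b) ⟩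
    mkℚᵘ b 0      ≃⟨ ℚᵘ.≃-sym {toℚᵘ (ℤ→ℚ b)} (toℚᵘ-ℤ→ℚ b) ⟩
    toℚᵘ (ℤ→ℚ b) ∎)
    where open ℚᵘ.≤-Reasoning

  ℤ→ℚ-cancel-≤ : ∀ {a b} → ℤ→ℚ a ≤ ℤ→ℚ b → a ℤ.≤ b
  ℤ→ℚ-cancel-≤ {a} {b} h = subst₂ ℤ._≤_ (ℤ.*-identityʳ a) (ℤ.*-identityʳ b) (ℚᵘ.drop-*≤* (begin
    mkℚᵘ a 0      ≃⟨ ℚᵘ.≃-sym {toℚᵘ (ℤ→ℚ a)} (toℚᵘ-ℤ→ℚ a) ⟩
    toℚᵘ (ℤ→ℚ a) ≤⟨ ℚ.toℚᵘ-mono-≤ h ⟩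
    toℚᵘ (ℤ→ℚ b) ≃⟨ toℚᵘ-ℤ→ℚ b ⟩
    mkℚᵘ b 0      ∎))
    where open ℚᵘ.≤-Reasoning

  ℤ→ℚ-injective : ∀ {a b} → ℤ→ℚ a ≡ ℤ→ℚ b → a ≡ b
  ℤ→ℚ-injective eq = ℤ.≤-antisym (ℤ→ℚ-cancel-≤ (ℚ.≤-reflexive eq)) (ℤ→ℚ-cancel-≤ (ℚ.≤-reflexive (sym eq)))

  -- Says p = a/q without division and without lowest terms; being a record, it lets unification
  -- recover q, p and a.
  record IsFraction (q : ℕ) (p : ℚ) (a : ℤ) : Set where
    constructor fraction
    field equation : p * ℤ→ℚ (+ q) ≡ ℤ→ℚ a

  module _ {q : ℕ} where

    fraction-0 : IsFraction q 0ℚ 0ℤ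
    fraction-0 = fraction (ℚ.*-zeroˡ (ℤ→ℚ (+ q)))

    fraction-+ : ∀ {p r a b} → IsFraction q p a → IsFraction q r b → IsFraction q (p + r) (a ℤ.+ b)
    fraction-+ {p} {r} {a} {b} (fraction pa) (fraction rb) = fraction
      (trans (ℚ.*-distribʳ-+ (ℤ→ℚ (+ q)) p r) (trans (cong₂ _+_ pa rb) (sym (ℤ→ℚ-+ a b))))

    fraction-ℕ : ∀ t s → IsFraction q (ℕ→ℚ (t ℕ.* s)) (+ (q ℕ.* t) ℤ.* + s)
    fraction-ℕ t s = fraction (trans (sym (ℤ→ℚ-* (+ (t ℕ.* s)) (+ q))) (cong ℤ→ℚ (begin
      + (t ℕ.* s) ℤ.* + q   ≡⟨ cong (ℤ._* + q) (ℤ.pos-* t s) ⟩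
      + t ℤ.* + s ℤ.* + q   ≡⟨ solve 3 (λ t s q → t :* s :* q := q :* t :* s) refl (+ t) (+ s) (+ q) ⟩
      + q ℤ.* + t ℤ.* + s   ≡⟨ cong (ℤ._* + s) (sym (ℤ.pos-* q t)) ⟩
      + (q ℕ.* t) ℤ.* + s   ∎)))
      where open ≡-Reasoning

  module _ {q : ℕ} .{{_ : ℕ.NonZero q}} where

    private instance
      ℤ→ℚ-pos : ℚ.Positive (ℤ→ℚ (+ q))
      ℤ→ℚ-pos = ℚ.normalize-pos q 1

    fraction-mono : ∀ {p r a b} → IsFraction q p a → IsFraction q r b → a ℤ.≤ b → p ≤ r
    fraction-mono (fraction pa) (fraction rb) a≤b = ℚ.*-cancelʳ-≤-pos (ℤ→ℚ (+ q)) (subst₂ _≤_ (sym pa) (sym rb) (ℤ→ℚ-mono a≤b))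

    fraction-cancel : ∀ {p r a b} → IsFraction q p a → IsFraction q r b → p ≤ r → a ℤ.≤ b
    fraction-cancel (fraction pa) (fraction rb) p≤r = ℤ→ℚ-cancel-≤ (subst₂ _≤_ pa rb
      (ℚ.*-monoʳ-≤-nonNeg (ℤ→ℚ (+ q)) {{ℚ.pos⇒nonNeg (ℤ→ℚ (+ q))}} p≤r))

    fraction-≡⁺ : ∀ {p r a b} → IsFraction q p a → IsFraction q r b → a ≡ b → p ≡ r
    fraction-≡⁺ pa rb refl = ℚ.≤-antisym (fraction-mono pa rb ℤ.≤-refl) (fraction-mono rb pa ℤ.≤-refl)

    fraction-≡⁻ : ∀ {p r a b} → IsFraction q p a → IsFraction q r b → p ≡ r → a ≡ b
    fraction-≡⁻ (fraction pa) (fraction rb) refl = ℤ→ℚ-injective (trans (sym pa) rb)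

    fraction-exists : ∀ a → ∃ λ p → IsFraction q p a
    fraction-exists a = ℤ→ℚ a * r , fraction (begin
        ℤ→ℚ a * r * ℤ→ℚ (+ q)   ≡⟨ ℚ.*-assoc (ℤ→ℚ a) r (ℤ→ℚ (+ q)) ⟩
        ℤ→ℚ a * (r * ℤ→ℚ (+ q)) ≡⟨ cong (ℤ→ℚ a *_) (ℚ.*-inverseˡ (ℤ→ℚ (+ q)) {{nz}}) ⟩
        ℤ→ℚ a * 1ℚ              ≡⟨ ℚ.*-identityʳ (ℤ→ℚ a) ⟩
        ℤ→ℚ a ∎)
      where
      open ≡-Reasoning
      nz : ℚ.NonZero (ℤ→ℚ (+ q))
      nz = ℚ.pos⇒nonZero (ℤ→ℚ (+ q))
      r = (ℚ.1/ ℤ→ℚ (+ q)) {{nz}}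

  record IsFractionᵥ (q : ℕ) (x : Vec ℚ n) (v : Vec ℤ n) : Set where
    constructor fractions
    field coordinate : ∀ i → IsFraction q (lookup x i) (lookup v i)
  open IsFractionᵥ

  fractions-tail : ∀ {q p a} {x : Vec ℚ n} {v} → IsFractionᵥ q (p ∷ x) (a ∷ v) → IsFractionᵥ q x v
  fractions-tail xv = fractions (λ i → coordinate xv (suc i))

  fractionᵥ-1 : (v : Vec ℤ n) → IsFractionᵥ 1 (map ℤ→ℚ v) v
  fractionᵥ-1 v = fractions λ i → fraction (trans (ℚ.*-identityʳ _) (lookup-map i ℤ→ℚ v))

  fraction-scale : ∀ {q p a} (r : ℕ) → IsFraction q p a → IsFraction (q ℕ.* r) p (a ℤ.* + r)
  fraction-scale {q} {p} {a} r (fraction pa) = fraction (begin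
    p * ℤ→ℚ (+ (q ℕ.* r))        ≡⟨ cong (λ z → p * ℤ→ℚ z) (ℤ.pos-* q r) ⟩
    p * ℤ→ℚ (+ q ℤ.* + r)        ≡⟨ cong (p *_) (ℤ→ℚ-* (+ q) (+ r)) ⟩
    p * (ℤ→ℚ (+ q) * ℤ→ℚ (+ r)) ≡⟨ sym (ℚ.*-assoc p (ℤ→ℚ (+ q)) (ℤ→ℚ (+ r))) ⟩
    p * ℤ→ℚ (+ q) * ℤ→ℚ (+ r)   ≡⟨ cong (_* ℤ→ℚ (+ r)) pa ⟩
    ℤ→ℚ a * ℤ→ℚ (+ r)           ≡⟨ sym (ℤ→ℚ-* a (+ r)) ⟩
    ℤ→ℚ (a ℤ.* + r) ∎)
    where open ≡-Reasoning

  fractionᵥ-scale : ∀ {q} {x : Vec ℚ n} {v} (r : ℕ) → IsFractionᵥ q x v → IsFractionᵥ (q ℕ.* r) x (map (ℤ._* + r) v)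
  fractionᵥ-scale {v = v} r xv = fractions λ i →
    subst (IsFraction _ _) (sym (lookup-map i (ℤ._* + r) v)) (fraction-scale r (coordinate xv i))

  denominator : ∀ p → ∃₂ λ q a → IsFraction (suc q) p a
  denominator p@(mkℚ a d _) = d , a , fraction (ℚ.toℚᵘ-injective (begin
    toℚᵘ (p * ℤ→ℚ (+ suc d))          ≈⟨ ℚ.toℚᵘ-homo-* p (ℤ→ℚ (+ suc d)) ⟩
    mkℚᵘ a d ℚᵘ.* toℚᵘ (ℤ→ℚ (+ suc d)) ≈⟨ ℚᵘ.*-congˡ {mkℚᵘ a d} (toℚᵘ-ℤ→ℚ (+ suc d)) ⟩
    mkℚᵘ a d ℚᵘ.* mkℚᵘ (+ suc d) 0     ≈⟨ *≡* (trans (ℤ.*-identityʳ _) (cong (λ z → a ℤ.* + z) (sym (ℕ.*-identityʳ (suc d))))) ⟩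
    mkℚᵘ a 0                           ≈⟨ ℚᵘ.≃-sym {toℚᵘ (ℤ→ℚ a)} (toℚᵘ-ℤ→ℚ a) ⟩
    toℚᵘ (ℤ→ℚ a) ∎))
    where open ℚᵘ.≃-Reasoning

  commonDenominator : (x : Vec ℚ n) → ∃₂ λ q v → IsFractionᵥ (suc q) x v
  commonDenominator []      = 0 , [] , fractions λ ()
  commonDenominator (p ∷ x) with denominator p | commonDenominator x
  -- The successor of this number computes to `suc q * suc r`, the product of the two denominators.
  ... | q , a , pa | r , v , xv = r ℕ.+ q ℕ.* suc r , a ℤ.* + suc r ∷ map (ℤ._* + suc q) v , fractions λ where
    zero    → fraction-scale (suc r) pa
    (suc i) → subst (λ d → IsFraction d (lookup x i) (lookup (map (ℤ._* + suc q) v) i))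
      (ℕ.*-comm (suc r) (suc q)) (coordinate (fractionᵥ-scale (suc q) xv) i)

  sumℚ-fraction : ∀ {q} {x : Vec ℚ n} {v} → IsFractionᵥ q x v → IsFraction q (sumℚ (lookup x)) (prefix v n)
  sumℚ-fraction {q = q} {[]}    {[]}    xv = fraction-0 {q}
  sumℚ-fraction         {x = _ ∷ _} {_ ∷ _} xv = fraction-+ (coordinate xv zero) (sumℚ-fraction (fractions-tail xv))

  sumOver-fraction : ∀ {q} (I : Subset n) {x : Vec ℚ n} {v} → IsFractionᵥ q x v →
    IsFraction q (sumOver I x) (over I v)
  sumOver-fraction {q = q} []   {[]}    {[]}    xv = fraction-0 {q}
  sumOver-fraction (true  ∷ I) {_ ∷ _} {_ ∷ _} xv = fraction-+ (coordinate xv zero) (sumOver-fraction I (fractions-tail xv))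
  sumOver-fraction (false ∷ I) {_ ∷ x} {_ ∷ _} xv =
    subst (λ p → IsFraction _ p _) (sym (ℚ.+-identityˡ (sumOver I x))) (sumOver-fraction I (fractions-tail xv))

  module _ {D : Diagram n} {q t : ℕ} .{{_ : ℕ.NonZero q}} {x : Vec ℚ n} {v : Vec ℤ n} (xv : IsFractionᵥ q x v) where

    -- All inequalities are homogeneous in the point and t together, so multiplying by q moves the
    -- point to the dilate by q t.
    schubitope⁻ : InDilatedSchubitope D t x → IntSchubitope D (q ℕ.* t) v
    schubitope⁻ (x≥0 , Σx , Ix) = record
      { nonneg = λ i → fraction-cancel (fraction-0 {q}) (coordinate xv i) (x≥0 i)
      ; total  = fraction-≡⁻ (sumℚ-fraction xv) (fraction-ℕ t (size D)) Σx
      ; bound  = λ I → fraction-cancel (sumOver-fraction I xv) (fraction-ℕ t (θ D I)) (Ix I)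
      }

    schubitope⁺ : IntSchubitope D (q ℕ.* t) v → InDilatedSchubitope D t x
    schubitope⁺ v∈ =
      (λ i → fraction-mono (fraction-0 {q}) (coordinate xv i) (IntSchubitope.nonneg v∈ i)) ,
      fraction-≡⁺ (sumℚ-fraction xv) (fraction-ℕ t (size D)) (IntSchubitope.total v∈) ,
      (λ I → fraction-mono (sumOver-fraction I xv) (fraction-ℕ t (θ D I)) (IntSchubitope.bound v∈ I))

open Fractions

-- The Gale order by counting, and the prefix-sum inequalities on the matroid polytope.

module GaleOrder where
  open import Defs
  open import Data.Bool using (true; false; if_then_else_)
  open import Data.Nat as ℕ using (ℕ; zero; suc; z≤n; s≤s)
  import Data.Nat.Properties as ℕ
  open import Data.Integer as ℤ using (ℤ; +_; 0ℤ; 1ℤ; +≤+)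
  import Data.Integer.Properties as ℤ
  import Data.Integer.DivMod as ℤ
  open import Data.Integer.Solver using (module +-*-Solver)
  open +-*-Solver using (solve; _:+_; _:*_; _:-_; _:=_; con)
  open import Data.Rational as ℚ using (ℚ; 0ℚ; _+_; _*_; _≤_)
  import Data.Rational.Properties as ℚ
  import Data.Rational.Solver as ℚSolver
  open import Data.Fin using (Fin; zero; suc; toℕ)
  open import Data.Fin.Subset using (Subset; ∣_∣)
  open import Data.List as List using (List; []; _∷_; _++_; length)
  import Data.List.Properties as List
  open import Data.List.Relation.Unary.All as All using (All; []; _∷_)
  import Data.List.Relation.Unary.All.Properties as All
  open import Data.List.Relation.Unary.AllPairs as AllPairs using (AllPairs; []; _∷_)
  import Data.List.Relation.Unary.AllPairs.Properties as AllPairs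
  open import Data.List.Relation.Binary.Pointwise as Pointwise using (Pointwise; []; _∷_)
  open import Data.Vec using (Vec; []; _∷_; lookup; map)
  open import Data.Vec.Properties using (lookup-map)
  open import Data.Product using (proj₁; proj₂)
  open import Data.Sum using (inj₁; inj₂)
  open import Function using (_∘_)
  open import Relation.Nullary using (Dec; yes; no)
  open import Relation.Nullary.Decidable using (dec-true; dec-false)
  open import Relation.Binary.PropositionalEquality using (_≡_; refl; sym; trans; cong; cong₂; subst; subst₂; module ≡-Reasoning)

  private variable n : ℕ

  -- The bridge from entrywise comparison of sorted lists to prefix counts: for lists of equal
  -- length, smaller entries mean more entries below every threshold, and conversely.
  countBelow : ℕ → List ℕ → ℕ
  countBelow k []       = 0
  countBelow k (x ∷ xs) = if x ℕ.<ᵇ k then suc (countBelow k xs) else countBelow k xs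

  countBelow-yes : ∀ {k x} xs → x ℕ.< k → countBelow k (x ∷ xs) ≡ suc (countBelow k xs)
  countBelow-yes {k} {x} xs x<k = cong (λ b → if b then suc (countBelow k xs) else countBelow k xs) (dec-true (x ℕ.<? k) x<k)

  countBelow-no : ∀ {k x} xs → k ℕ.≤ x → countBelow k (x ∷ xs) ≡ countBelow k xs
  countBelow-no {k} {x} xs k≤x = cong (λ b → if b then suc (countBelow k xs) else countBelow k xs) (dec-false (x ℕ.<? k) (ℕ.≤⇒≯ k≤x))

  countBelow-none : ∀ {k xs} → All (k ℕ.≤_) xs → countBelow k xs ≡ 0
  countBelow-none []                       = refl
  countBelow-none {xs = _ ∷ xs} (k≤x ∷ k≤) = trans (countBelow-no xs k≤x) (countBelow-none k≤)

  countBelow-map-suc : ∀ k xs → countBelow (suc k) (List.map suc xs) ≡ countBelow k xs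
  countBelow-map-suc k []       = refl
  countBelow-map-suc k (x ∷ xs) rewrite countBelow-map-suc k xs = refl

  countBelow-elems : (S : Subset n) (k : ℕ) → countBelow k (elems S) ≡ count S k
  countBelow-elems S           zero    = trans (countBelow-none (All.universal (λ _ → z≤n) (elems S))) (sym (count-zero S))
  countBelow-elems []          (suc k) = refl
  countBelow-elems (true  ∷ S) (suc k) = cong suc (trans (countBelow-map-suc k (elems S)) (countBelow-elems S k))
  countBelow-elems (false ∷ S) (suc k) = trans (countBelow-map-suc k (elems S)) (countBelow-elems S k)

  length-elems : (S : Subset n) → length (elems S) ≡ ∣ S ∣
  length-elems []          = refl
  length-elems (true  ∷ S) = cong suc (trans (List.length-map suc (elems S)) (length-elems S))
  length-elems (false ∷ S) = trans (List.length-map suc (elems S)) (length-elems S)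

  elems-sorted : (S : Subset n) → AllPairs ℕ._<_ (elems S)
  elems-sorted []          = []
  elems-sorted (true  ∷ S) = All.map⁺ (All.universal (λ _ → s≤s z≤n) (elems S)) ∷ AllPairs.map⁺ (AllPairs.map s≤s (elems-sorted S))
  elems-sorted (false ∷ S) = AllPairs.map⁺ (AllPairs.map s≤s (elems-sorted S))

  pointwise⇒countBelow : ∀ {xs ys} → Pointwise ℕ._≤_ xs ys → ∀ k → countBelow k ys ℕ.≤ countBelow k xs
  pointwise⇒countBelow []                                    k = z≤n
  pointwise⇒countBelow {x ∷ xs} {y ∷ ys} (x≤y ∷ xs≤ys) k with ℕ.<-≤-connex y k
  ... | inj₁ y<k rewrite countBelow-yes ys y<k | countBelow-yes xs (ℕ.≤-<-trans x≤y y<k) = s≤s (pointwise⇒countBelow xs≤ys k)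
  ... | inj₂ k≤y rewrite countBelow-no ys k≤y with ℕ.<-≤-connex x k
  ...   | inj₁ x<k rewrite countBelow-yes xs x<k = ℕ.m≤n⇒m≤1+n (pointwise⇒countBelow xs≤ys k)
  ...   | inj₂ k≤x rewrite countBelow-no xs k≤x = pointwise⇒countBelow xs≤ys k

  countBelow⇒pointwise : ∀ {xs ys} → AllPairs ℕ._<_ xs → AllPairs ℕ._<_ ys → length xs ≡ length ys →
    (∀ k → countBelow k ys ℕ.≤ countBelow k xs) → Pointwise ℕ._≤_ xs ys
  countBelow⇒pointwise [] [] _ _ = []
  countBelow⇒pointwise {x ∷ xs} {y ∷ ys} (x< ∷ xs↗) (y< ∷ ys↗) len c≤ =
    x≤y ∷ countBelow⇒pointwise xs↗ ys↗ (ℕ.suc-injective len) c≤′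
    where
    x≤y : x ℕ.≤ y
    x≤y with ℕ.<-≤-connex y x
    ... | inj₂ x≤y = x≤y
    -- The threshold y + 1 counts y but, by sortedness, nothing of `x ∷ xs`.
    ... | inj₁ y<x with c≤ (suc y)
    ...   | h rewrite countBelow-yes ys (ℕ.n<1+n y) | countBelow-none {suc y} {x ∷ xs} (y<x ∷ All.map (λ x<z → ℕ.<-trans y<x x<z) x<)
      with () ← h
    c≤′ : ∀ k → countBelow k ys ℕ.≤ countBelow k xs
    c≤′ k with ℕ.<-≤-connex y k
    ... | inj₁ y<k = ℕ.≤-pred (subst₂ ℕ._≤_ (countBelow-yes ys y<k) (countBelow-yes xs (ℕ.≤-<-trans x≤y y<k)) (c≤ k))
    ... | inj₂ k≤y = subst (ℕ._≤ countBelow k xs) (sym (countBelow-none (All.map (λ y<z → ℕ.<⇒≤ (ℕ.≤-<-trans k≤y y<z)) y<))) z≤n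

  basis⇒count : (S T : Subset n) → IsBasis S T → ∀ k → count S k ℕ.≤ count T k
  basis⇒count S T T≼S k = subst₂ ℕ._≤_ (countBelow-elems S k) (countBelow-elems T k) (pointwise⇒countBelow T≼S k)

  basis⇒∣∣ : (S T : Subset n) → IsBasis S T → ∣ T ∣ ≡ ∣ S ∣
  basis⇒∣∣ S T T≼S = trans (sym (length-elems T)) (trans (Pointwise.Pointwise-length T≼S) (length-elems S))

  count-≥n : (S : Subset n) {k : ℕ} → n ℕ.≤ k → count S k ≡ ∣ S ∣
  count-≥n []          _         = refl
  count-≥n (true  ∷ S) (s≤s n≤k) = cong suc (count-≥n S n≤k)
  count-≥n (false ∷ S) (s≤s n≤k) = count-≥n S n≤k

  count⇒basis : (S T : Subset n) → ∣ T ∣ ≡ ∣ S ∣ → (∀ {k} → k ℕ.≤ n → count S k ℕ.≤ count T k) → IsBasis S T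
  count⇒basis {n} S T len c≤ = countBelow⇒pointwise (elems-sorted T) (elems-sorted S)
    (trans (length-elems T) (trans len (sym (length-elems S))))
    λ k → subst₂ ℕ._≤_ (sym (countBelow-elems S k)) (sym (countBelow-elems T k)) (c≤′ k)
    where
    c≤′ : ∀ k → count S k ℕ.≤ count T k
    c≤′ k with ℕ.≤-total k n
    ... | inj₁ k≤n = c≤ k≤n
    ... | inj₂ n≤k = ℕ.≤-reflexive (trans (count-≥n S n≤k) (trans (sym len) (sym (count-≥n T n≤k))))

  isBasis? : (S T : Subset n) → Dec (IsBasis S T)
  isBasis? S T = Pointwise.decidable ℕ._≤?_ (elems T) (elems S)

  weigh : {A : Set} → (A → ℚ) → List A → ℚ
  weigh f xs = sumList (List.map f xs)

  module _ {A : Set} where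

    weigh-+ : (f g : A → ℚ) (xs : List A) → weigh (λ x → f x + g x) xs ≡ weigh f xs + weigh g xs
    weigh-+ f g []       = refl
    weigh-+ f g (x ∷ xs) = trans (cong (_+_ (f x + g x)) (weigh-+ f g xs))
      (ℚSolver.+-*-Solver.solve 4 (λ a b c d → a :⊕ b :⊕ (c :⊕ d) :≡ a :⊕ c :⊕ (b :⊕ d)) refl (f x) (g x) (weigh f xs) (weigh g xs))
      where open ℚSolver.+-*-Solver renaming (_:+_ to _:⊕_; _:=_ to _:≡_) using ()

    weigh-cong : {f g : A → ℚ} → (∀ x → f x ≡ g x) → ∀ xs → weigh f xs ≡ weigh g xs
    weigh-cong f≗g xs = cong sumList (List.map-cong f≗g xs)

    weigh-mono : {f g : A → ℚ} → (∀ x → f x ≤ g x) → ∀ xs → weigh f xs ≤ weigh g xs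
    weigh-mono f≤g []       = ℚ.≤-refl
    weigh-mono f≤g (x ∷ xs) = ℚ.+-mono-≤ (f≤g x) (weigh-mono f≤g xs)

    weigh-0 : {f : A → ℚ} → (∀ x → f x ≡ 0ℚ) → ∀ xs → weigh f xs ≡ 0ℚ
    weigh-0 f≗0 []       = refl
    weigh-0 f≗0 (x ∷ xs) = cong₂ _+_ (f≗0 x) (weigh-0 f≗0 xs)

    weigh-* : (f : A → ℚ) (c : ℚ) (xs : List A) → weigh (λ x → f x * c) xs ≡ weigh f xs * c
    weigh-* f c []       = sym (ℚ.*-zeroˡ c)
    weigh-* f c (x ∷ xs) = trans (cong (_+_ (f x * c)) (weigh-* f c xs)) (sym (ℚ.*-distribʳ-+ c (f x) (weigh f xs)))

    weigh-++ : (f : A → ℚ) (xs ys : List A) → weigh f (xs ++ ys) ≡ weigh f xs + weigh f ys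
    weigh-++ f []       ys = sym (ℚ.+-identityˡ _)
    weigh-++ f (x ∷ xs) ys = trans (cong (_+_ (f x)) (weigh-++ f xs ys)) (sym (ℚ.+-assoc (f x) _ _))

    weigh-map : {B : Set} (f : A → ℚ) (h : B → A) (xs : List B) → weigh f (List.map h xs) ≡ weigh (f ∘ h) xs
    weigh-map f h xs = cong sumList (sym (List.map-∘ xs))

  indicator-bit : (T : Subset n) (i : Fin n) → indicator (lookup T i) ≡ ℕ→ℚ (bit T (toℕ i))
  indicator-bit (true  ∷ T) zero    = refl
  indicator-bit (false ∷ T) zero    = refl
  indicator-bit (_     ∷ T) (suc i) = indicator-bit T i

  module _ {S : Subset n} {t : ℕ} {v : Vec ℤ n} (v∈ : InDilatedMatroidPolytope S t (map ℤ→ℚ v)) where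
    private
      λ′  = proj₁ v∈
      λ≥0 = proj₁ (proj₂ v∈)
      λ≡0 = proj₁ (proj₂ (proj₂ v∈))
      Σλ  = proj₁ (proj₂ (proj₂ (proj₂ v∈)))
      vᵢ  = proj₂ (proj₂ (proj₂ (proj₂ v∈)))

      average : (Subset n → ℕ) → ℚ
      average a = weigh (λ T → λ′ T * ℕ→ℚ (a T)) (allSubsets n)

      average-const : ∀ c → average (λ _ → c) ≡ ℤ→ℚ (+ t ℤ.* + c)
      average-const c = trans (weigh-* λ′ (ℕ→ℚ c) (allSubsets n)) (trans (cong (_* ℕ→ℚ c) Σλ) (sym (ℤ→ℚ-* (+ t) (+ c))))

      average-mono : ∀ a b → (∀ T → IsBasis S T → a T ℕ.≤ b T) → average a ≤ average b
      average-mono a b a≤b = weigh-mono mono (allSubsets n)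
        where
        mono : ∀ T → λ′ T * ℕ→ℚ (a T) ≤ λ′ T * ℕ→ℚ (b T)
        mono T with isBasis? S T
        ... | yes T≼S = ℚ.*-monoˡ-≤-nonNeg (λ′ T) {{ℚ.nonNegative (λ≥0 T)}} (ℤ→ℚ-mono (+≤+ (a≤b T T≼S)))
        ... | no  T⋠S rewrite λ≡0 T T⋠S = ℚ.≤-reflexive (trans (ℚ.*-zeroˡ (ℕ→ℚ (a T))) (sym (ℚ.*-zeroˡ (ℕ→ℚ (b T)))))

      average-+ : ∀ a b → average (λ T → a T ℕ.+ b T) ≡ average a + average b
      average-+ a b = trans (weigh-cong (λ T → trans (cong (λ′ T *_) (ℤ→ℚ-+ (+ a T) (+ b T))) (ℚ.*-distribˡ-+ (λ′ T) _ _)) (allSubsets n))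
        (weigh-+ (λ T → λ′ T * ℕ→ℚ (a T)) (λ T → λ′ T * ℕ→ℚ (b T)) (allSubsets n))

      lookup-average : ∀ i → ℤ→ℚ (lookup v i) ≡ average (λ T → bit T (toℕ i))
      lookup-average i = trans (sym (lookup-map i ℤ→ℚ v)) (trans (vᵢ i)
        (weigh-cong (λ T → cong (λ′ T *_) (indicator-bit T i)) (allSubsets n)))

      prefix-average : ∀ {k} → k ℕ.≤ n → ℤ→ℚ (prefix v k) ≡ average (λ T → count T k)
      prefix-average = increments (λ k → ℤ→ℚ (prefix v k) ≡ average (λ T → count T k))
        (trans (cong ℤ→ℚ (prefix-zero v)) (sym (trans
          (weigh-cong (λ T → cong (λ c → λ′ T * ℕ→ℚ c) (count-zero T)) (allSubsets n))
          (trans (average-const 0) (cong ℤ→ℚ (ℤ.*-zeroʳ (+ t)))))))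
        λ i ih → begin
          ℤ→ℚ (prefix v (suc (toℕ i)))                                        ≡⟨ cong ℤ→ℚ (prefix-suc v i) ⟩
          ℤ→ℚ (prefix v (toℕ i) ℤ.+ lookup v i)                               ≡⟨ ℤ→ℚ-+ (prefix v (toℕ i)) (lookup v i) ⟩
          ℤ→ℚ (prefix v (toℕ i)) + ℤ→ℚ (lookup v i)                          ≡⟨ cong₂ _+_ ih (lookup-average i) ⟩
          average (λ T → count T (toℕ i)) + average (λ T → bit T (toℕ i))      ≡⟨ ℚ.+-comm (average (λ T → count T (toℕ i))) _ ⟩
          average (λ T → bit T (toℕ i)) + average (λ T → count T (toℕ i))      ≡⟨ sym (average-+ (λ T → bit T (toℕ i)) (λ T → count T (toℕ i))) ⟩
          average (λ T → bit T (toℕ i) ℕ.+ count T (toℕ i))                    ≡⟨ weigh-cong (λ T → cong (λ c → λ′ T * ℕ→ℚ c) (sym (count-suc T (toℕ i)))) (allSubsets n) ⟩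
          average (λ T → count T (suc (toℕ i))) ∎
        where open ≡-Reasoning

      average-≥ : ∀ z a c → ℤ→ℚ z ≡ average a → (∀ T → IsBasis S T → c ℕ.≤ a T) → + t ℤ.* + c ℤ.≤ z
      average-≥ z a c z≡ c≤a = ℤ→ℚ-cancel-≤ (subst₂ _≤_ (average-const c) (sym z≡) (average-mono (λ _ → c) a c≤a))

      average-≤ : ∀ z a c → ℤ→ℚ z ≡ average a → (∀ T → IsBasis S T → a T ℕ.≤ c) → z ℤ.≤ + t ℤ.* + c
      average-≤ z a c z≡ a≤c = ℤ→ℚ-cancel-≤ (subst₂ _≤_ (sym z≡) (average-const c) (average-mono a (λ _ → c) a≤c))

    -- The weights are a measure of mass t on the bases, and coordinates and prefix sums of v are
    -- the integrals of `bit` and `count`. A bound valid for every basis therefore passes to v with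
    -- the factor t.
    hull⇒admissible : Admissible S t (prefix v)
    hull⇒admissible = record
      { start     = prefix-zero v
      ; increases = λ i → ≤-by (average-≥ (lookup v i) (λ T → bit T (toℕ i)) 0 (lookup-average i) (λ _ _ → z≤n))
          (trans (cong (ℤ._- prefix v (toℕ i)) (prefix-suc v i))
            (solve 3 (λ p x t → p :+ x :- p := x :- t :* con 0ℤ) refl (prefix v (toℕ i)) (lookup v i) (+ t)))
      ; slope≤    = λ i → ≤-by (average-≤ (lookup v i) (λ T → bit T (toℕ i)) 1 (lookup-average i) (λ T _ → bit≤1 T (toℕ i)))
          (trans (cong (λ p → prefix v (toℕ i) ℤ.+ + t ℤ.- p) (prefix-suc v i))
            (solve 3 (λ p x t → p :+ t :- (p :+ x) := t :* con 1ℤ :- x) refl (prefix v (toℕ i)) (lookup v i) (+ t)))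
      ; dominates = λ {k} k≤n → average-≥ (prefix v k) (λ T → count T k) (count S k) (prefix-average k≤n) (λ T T≼S → basis⇒count S T T≼S k)
      ; end       = ℤ.≤-antisym
          (average-≤ (prefix v n) (λ T → count T n) ∣ S ∣ (prefix-average ℕ.≤-refl) (λ T T≼S → ℕ.≤-reflexive (trans (count-all T) (basis⇒∣∣ S T T≼S))))
          (average-≥ (prefix v n) (λ T → count T n) ∣ S ∣ (prefix-average ℕ.≤-refl) (λ T T≼S → ℕ.≤-reflexive (sym (trans (count-all T) (basis⇒∣∣ S T T≼S)))))
      }

open GaleOrder

-- Integer solutions of the prefix-sum inequalities as sums of bases.

module MatroidHull where
  open import Defs
  open import Data.Bool using (true; false; if_then_else_; not)
  open import Data.Empty using (⊥-elim)
  open import Data.Nat as ℕ using (ℕ; zero; suc; z≤n)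
  import Data.Nat.Properties as ℕ
  open import Data.Integer as ℤ using (ℤ; +_; 0ℤ; 1ℤ; +≤+)
  import Data.Integer.Properties as ℤ
  import Data.Integer.DivMod as ℤ
  open import Data.Integer.Solver using (module +-*-Solver)
  open +-*-Solver using (solve; _:+_; _:*_; _:-_; _:=_; con)
  open import Data.Rational as ℚ using (ℚ; 0ℚ; 1ℚ; _+_; _*_; _≤_)
  import Data.Rational.Properties as ℚ
  open import Data.Fin using (Fin; zero; suc; toℕ)
  open import Data.Fin.Properties using (toℕ<n)
  open import Data.Fin.Subset using (Subset; ∣_∣)
  open import Data.List as List using ([]; _∷_)
  open import Data.Vec using (Vec; []; _∷_; lookup; tabulate; map)
  open import Data.Vec.Properties using (lookup∘tabulate; lookup-map)
  open import Data.Product using (∃; _×_; _,_; proj₁; proj₂)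
  open import Data.Sum using (_⊎_; inj₁; inj₂)
  open import Function using (_∘_)
  open import Relation.Nullary using (¬_; yes; no; does)
  open import Relation.Nullary.Decidable using (dec-true; dec-false)
  open import Relation.Binary.PropositionalEquality using (_≡_; _≢_; refl; sym; trans; cong; cong₂; subst; subst₂)
  open Admissible

  private variable n : ℕ

  -- Monotonicity of rounding down: q ≥ q′ + 1 would make the left side exceed the right, because r′
  -- < t + 1. A remainder 0 gives comparison with exact multiples of t + 1.
  quotient-≤ : ∀ t {q q′ : ℤ} (r r′ : ℕ) → r′ ℕ.≤ t →
    + r ℤ.+ q ℤ.* + suc t ℤ.≤ + r′ ℤ.+ q′ ℤ.* + suc t → q ℤ.≤ q′
  quotient-≤ t {q} {q′} r r′ r′≤t h with q ℤ.≤? q′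
  ... | yes q≤q′ = q≤q′
  ... | no  q≰q′ = ⊥-elim (1≰0 (≤-by
      (ℤ.*-monoˡ-≤-nonNeg (+ suc t) (ℤ.i<j⇒suc[i]≤j (ℤ.≰⇒> q≰q′)) ⊹ h ⊹ +≤+ r′≤t ⊹ +≤+ (z≤n {r}))
      (solve 5 (λ t q q′ r r′ → con 0ℤ :- con 1ℤ :=
          (con 1ℤ :+ t) :* q :+ (r′ :+ q′ :* (con 1ℤ :+ t)) :+ t :+ r :-
          ((con 1ℤ :+ t) :* (con 1ℤ :+ q′) :+ (r :+ q :* (con 1ℤ :+ t)) :+ r′ :+ con 0ℤ)) refl
        (+ t) q q′ (+ r) (+ r′))))
    where
    1≰0 : ¬ (1ℤ ℤ.≤ 0ℤ)
    1≰0 (+≤+ ())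

  unit-interval : ∀ {a b} → a ℤ.≤ b → b ℤ.≤ a ℤ.+ 1ℤ → b ≡ a ⊎ b ≡ a ℤ.+ 1ℤ
  unit-interval {a} {b} a≤b b≤a+1 with b ℤ.≟ a
  ... | yes b≡a = inj₁ b≡a
  ... | no  b≢a = inj₂ (ℤ.≤-antisym b≤a+1 (subst (ℤ._≤ b) (ℤ.+-comm 1ℤ a)
      (ℤ.i<j⇒suc[i]≤j (ℤ.≤∧≢⇒< a≤b (b≢a ∘ sym)))))

  -- The integer points of (t + 1)·P split into a vertex and an integer point of t·P:
  -- rounding down F / (t + 1) gives the prefix sums of the vertex.
  module _ {S : Subset n} {t : ℕ} {F : ℕ → ℤ} (adm : Admissible S (suc t) F) where
    private
      Q G : ℕ → ℤ
      Q k = F k ℤ./ℕ suc t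
      G k = F k ℤ.- Q k
      R : ℕ → ℕ
      R k = F k ℤ.%ℕ suc t
      R≤t : ∀ k → R k ℕ.≤ t
      R≤t k = ℕ.≤-pred (ℤ.n%ℕd<d (F k) (suc t))
      F≡ : ∀ k → F k ≡ + R k ℤ.+ Q k ℤ.* + suc t
      F≡ k = ℤ.a≡a%ℕn+[a/ℕn]*n (F k) (suc t)

      F≡⇒Q≡ : ∀ {k c} → F k ≡ + suc t ℤ.* c → Q k ≡ c
      F≡⇒Q≡ {k} {c} eq = ℤ.≤-antisym (quotient-≤ t (R k) 0 z≤n (ℤ.≤-reflexive eq′)) (quotient-≤ t 0 (R k) (R≤t k) (ℤ.≤-reflexive (sym eq′)))
        where
        eq′ : + R k ℤ.+ Q k ℤ.* + suc t ≡ + 0 ℤ.+ c ℤ.* + suc t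
        eq′ = trans (sym (F≡ k)) (trans eq (trans (ℤ.*-comm (+ suc t) c) (sym (ℤ.+-identityˡ _))))

      Q-dominates : ∀ {k} → k ℕ.≤ n → + count S k ℤ.≤ Q k
      Q-dominates {k} k≤n = quotient-≤ t 0 (R k) (R≤t k) (subst₂ ℤ._≤_
        (trans (ℤ.*-comm (+ suc t) (+ count S k)) (sym (ℤ.+-identityˡ _))) (F≡ k) (dominates adm k≤n))

      Q-increases : ∀ (i : Fin n) → Q (toℕ i) ℤ.≤ Q (suc (toℕ i))
      Q-increases i = quotient-≤ t (R (toℕ i)) (R (suc (toℕ i))) (R≤t _)
        (subst₂ ℤ._≤_ (F≡ (toℕ i)) (F≡ (suc (toℕ i))) (increases adm i))

      Q-slope≤ : ∀ (i : Fin n) → Q (suc (toℕ i)) ℤ.≤ Q (toℕ i) ℤ.+ 1ℤ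
      Q-slope≤ i = quotient-≤ t (R (suc (toℕ i))) (R (toℕ i)) (R≤t _)
        (subst₂ ℤ._≤_ (F≡ (suc (toℕ i))) (trans (cong (ℤ._+ + suc t) (F≡ (toℕ i)))
          (solve 3 (λ r q d → r :+ q :* d :+ d := r :+ (q :+ con 1ℤ) :* d) refl (+ R (toℕ i)) (Q (toℕ i)) (+ suc t))) (slope≤ adm i))

      -- G = R + tQ. If Q stays, the step is R′ - R: at least 0 as F increases, at most t as R′ ≤ t.
      -- If Q jumps, it is t + R′ - R: at least 0 as R ≤ t, at most t as F rises by at most t + 1.
      G-step : ∀ (i : Fin n) → G (toℕ i) ℤ.≤ G (suc (toℕ i)) × G (suc (toℕ i)) ℤ.≤ G (toℕ i) ℤ.+ + t
      G-step i with unit-interval (Q-increases i) (Q-slope≤ i)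
      ... | inj₁ eq =
        ≤-by (increases adm i) (trans (cong (λ q → F k′ ℤ.- q ℤ.- (F k ℤ.- Q k)) eq)
          (solve 3 (λ f f′ q → f′ :- q :- (f :- q) := f′ :- f) refl (F k) (F k′) (Q k))) ,
        ≤-by (+≤+ (R≤t k′) ⊹ +≤+ (z≤n {R k})) (trans (cong₂ (λ f f′ → f ℤ.- Q k ℤ.+ + t ℤ.- (f′ ℤ.- Q k′)) (F≡ k) (F≡ k′))
          (trans (cong (λ q → + R k ℤ.+ Q k ℤ.* + suc t ℤ.- Q k ℤ.+ + t ℤ.- (+ R k′ ℤ.+ q ℤ.* + suc t ℤ.- q)) eq)
          (solve 5 (λ r q d r′ t → r :+ q :* d :- q :+ t :- (r′ :+ q :* d :- q) := t :+ r :- (r′ :+ con 0ℤ)) refl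
            (+ R k) (Q k) (+ suc t) (+ R k′) (+ t))))
        where k = toℕ i ; k′ = suc (toℕ i)
      ... | inj₂ eq =
        ≤-by (+≤+ (R≤t k) ⊹ +≤+ (z≤n {R k′})) (trans (cong₂ (λ f f′ → f′ ℤ.- Q k′ ℤ.- (f ℤ.- Q k)) (F≡ k) (F≡ k′))
          (trans (cong (λ q → + R k′ ℤ.+ q ℤ.* + suc t ℤ.- q ℤ.- (+ R k ℤ.+ Q k ℤ.* + suc t ℤ.- Q k)) eq)
          (solve 4 (λ r q r′ t → r′ :+ (q :+ con 1ℤ) :* (con 1ℤ :+ t) :- (q :+ con 1ℤ) :- (r :+ q :* (con 1ℤ :+ t) :- q) := t :+ r′ :- (r :+ con 0ℤ)) refl
            (+ R k) (Q k) (+ R k′) (+ t)))) ,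
        ≤-by (slope≤ adm i) (trans (cong (λ q → F k ℤ.- Q k ℤ.+ + t ℤ.- (F k′ ℤ.- q)) eq)
          (solve 4 (λ f f′ q t → f :- q :+ t :- (f′ :- (q :+ con 1ℤ)) := f :+ (con 1ℤ :+ t) :- f′) refl (F k) (F k′) (Q k) (+ t)))
        where k = toℕ i ; k′ = suc (toℕ i)

    admissible-split : ∃ λ Q → Admissible S 1 Q × Admissible S t (λ k → F k ℤ.- Q k)
    admissible-split = Q , record
      { start     = Q0
      ; increases = Q-increases
      ; slope≤    = Q-slope≤
      ; dominates = λ k≤n → subst (ℤ._≤ Q _) (sym (ℤ.*-identityˡ _)) (Q-dominates k≤n)
      ; end       = trans (F≡⇒Q≡ (end adm)) (sym (ℤ.*-identityˡ _))
      } , record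
      { start     = cong₂ ℤ._-_ (start adm) Q0
      ; increases = proj₁ ∘ G-step
      ; slope≤    = proj₂ ∘ G-step
      ; dominates = λ {k} k≤n → ≤-by (ℤ.*-monoˡ-≤-nonNeg (+ t) (Q-dominates k≤n) ⊹ +≤+ (z≤n {R k}))
          (trans (cong (λ f → f ℤ.- Q k ℤ.- + t ℤ.* + count S k) (F≡ k))
          (solve 4 (λ r q t c → r :+ q :* (con 1ℤ :+ t) :- q :- t :* c := t :* q :+ r :- (t :* c :+ con 0ℤ)) refl
            (+ R k) (Q k) (+ t) (+ count S k)))
      ; end       = trans (cong₂ ℤ._-_ (end adm) (F≡⇒Q≡ (end adm)))
          (solve 2 (λ t s → (con 1ℤ :+ t) :* s :- s := t :* s) refl (+ t) (+ ∣ S ∣))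
      }
      where
      Q0 : Q 0 ≡ 0ℤ
      Q0 = F≡⇒Q≡ (trans (start adm) (sym (ℤ.*-zeroʳ (+ suc t))))

  bit-lookup : (T : Subset n) (i : Fin n) → bit T (toℕ i) ≡ (if lookup T i then 1 else 0)
  bit-lookup (_ ∷ T) zero    = refl
  bit-lookup (_ ∷ T) (suc i) = bit-lookup T i

  -- A function with steps 0 and 1 counts the rows where it jumps; for this set of rows, `dominates`
  -- is the Gale order in its counting form.
  admissible-1⇒basis : {S : Subset n} {Q : ℕ → ℤ} → Admissible S 1 Q →
    ∃ λ T → IsBasis S T × (∀ {k} → k ℕ.≤ n → + count T k ≡ Q k)
  admissible-1⇒basis {n} {S} {Q} adm = T , count⇒basis S T T≡S S≤T , count≡
    where
    T = tabulate (λ i → not (does (Q (suc (toℕ i)) ℤ.≟ Q (toℕ i))))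
    bit≡ : ∀ i → Q (suc (toℕ i)) ≡ Q (toℕ i) ℤ.+ + bit T (toℕ i)
    bit≡ i = trans (jump (unit-interval (increases adm i) (slope≤ adm i)))
      (cong (λ b → Q (toℕ i) ℤ.+ + b) (sym (trans (bit-lookup T i) (cong (λ b → if b then 1 else 0) (lookup∘tabulate _ i)))))
      where
      jump : Q (suc (toℕ i)) ≡ Q (toℕ i) ⊎ Q (suc (toℕ i)) ≡ Q (toℕ i) ℤ.+ 1ℤ →
        Q (suc (toℕ i)) ≡ Q (toℕ i) ℤ.+ + (if not (does (Q (suc (toℕ i)) ℤ.≟ Q (toℕ i))) then 1 else 0)
      jump (inj₁ eq) = trans eq (trans (sym (ℤ.+-identityʳ _))
        (cong (λ b → Q (toℕ i) ℤ.+ + (if not b then 1 else 0)) (sym (dec-true (Q (suc (toℕ i)) ℤ.≟ Q (toℕ i)) eq))))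
      jump (inj₂ eq) = trans eq
        (cong (λ b → Q (toℕ i) ℤ.+ + (if not b then 1 else 0)) (sym (dec-false (Q (suc (toℕ i)) ℤ.≟ Q (toℕ i))
          (λ eq′ → 1≢0 (trans (solve 1 (λ q → con 1ℤ := q :+ con 1ℤ :- q) refl (Q (toℕ i))) (ℤ.i≡j⇒i-j≡0 (trans (sym eq) eq′)))))))
        where
        1≢0 : 1ℤ ≢ 0ℤ
        1≢0 ()
    count≡ : ∀ {k} → k ℕ.≤ n → + count T k ≡ Q k
    count≡ = increments (λ k → + count T k ≡ Q k) (trans (cong +_ (count-zero T)) (sym (start adm)))
      λ i ih → trans (cong +_ (count-suc T (toℕ i))) (trans (ℤ.+-comm (+ bit T (toℕ i)) (+ count T (toℕ i)))
        (trans (cong (ℤ._+ + bit T (toℕ i)) ih) (sym (bit≡ i))))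
    T≡S : ∣ T ∣ ≡ ∣ S ∣
    T≡S = trans (sym (count-all T)) (ℤ.+-injective (trans (count≡ ℕ.≤-refl) (trans (end adm) (ℤ.*-identityˡ _))))
    S≤T : ∀ {k} → k ℕ.≤ n → count S k ℕ.≤ count T k
    S≤T k≤n = ℤ.drop‿+≤+ (subst₂ ℤ._≤_ (ℤ.*-identityˡ _) (sym (count≡ k≤n)) (dominates adm k≤n))

  -- The recursion follows that of `allSubsets`, so that sums against it can be evaluated one half
  -- at a time.
  pointMass : Subset n → Subset n → ℚ
  pointMass []          []          = 1ℚ
  pointMass (true  ∷ T) (true  ∷ U) = pointMass T U
  pointMass (false ∷ T) (false ∷ U) = pointMass T U
  pointMass (_     ∷ _) (_     ∷ _) = 0ℚ

  pointMass-≥0 : (T U : Subset n) → 0ℚ ≤ pointMass T U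
  pointMass-≥0 []          []          = ℤ→ℚ-mono (+≤+ (z≤n {1}))
  pointMass-≥0 (true  ∷ T) (true  ∷ U) = pointMass-≥0 T U
  pointMass-≥0 (false ∷ T) (false ∷ U) = pointMass-≥0 T U
  pointMass-≥0 (true  ∷ T) (false ∷ U) = ℚ.≤-refl
  pointMass-≥0 (false ∷ T) (true  ∷ U) = ℚ.≤-refl

  pointMass-≢ : (T U : Subset n) → T ≢ U → pointMass T U ≡ 0ℚ
  pointMass-≢ []          []          T≢U = ⊥-elim (T≢U refl)
  pointMass-≢ (true  ∷ T) (true  ∷ U) T≢U = pointMass-≢ T U (T≢U ∘ cong (true ∷_))
  pointMass-≢ (false ∷ T) (false ∷ U) T≢U = pointMass-≢ T U (T≢U ∘ cong (false ∷_))
  pointMass-≢ (true  ∷ T) (false ∷ U) T≢U = refl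
  pointMass-≢ (false ∷ T) (true  ∷ U) T≢U = refl

  weigh-pointMass : (T : Subset n) (f : Subset n → ℚ) → weigh (λ U → pointMass T U * f U) (allSubsets n) ≡ f T
  weigh-pointMass []      f = trans (ℚ.+-identityʳ _) (ℚ.*-identityˡ (f []))
  weigh-pointMass {suc n} (b ∷ T) f = trans (weigh-++ g (List.map (false ∷_) (allSubsets n)) (List.map (true ∷_) (allSubsets n)))
    (trans (cong₂ _+_ (weigh-map g (false ∷_) (allSubsets n)) (weigh-map g (true ∷_) (allSubsets n))) (split b refl))
    where
    g : Subset (suc n) → ℚ
    g U = pointMass (b ∷ T) U * f U
    split : ∀ b′ → b ≡ b′ → weigh (g ∘ (false ∷_)) (allSubsets n) + weigh (g ∘ (true ∷_)) (allSubsets n) ≡ f (b ∷ T)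
    split true  refl = trans (cong₂ _+_ (weigh-0 (λ U → ℚ.*-zeroˡ (f (false ∷ U))) (allSubsets n)) (weigh-pointMass T (f ∘ (true ∷_)))) (ℚ.+-identityˡ _)
    split false refl = trans (cong₂ _+_ (weigh-pointMass T (f ∘ (false ∷_))) (weigh-0 (λ U → ℚ.*-zeroˡ (f (true ∷ U))) (allSubsets n))) (ℚ.+-identityʳ _)

  hull-0 : (S : Subset n) (x : Vec ℚ n) → (∀ i → lookup x i ≡ 0ℚ) → InDilatedMatroidPolytope S 0 x
  hull-0 {n} S x x≡0 = (λ _ → 0ℚ) , (λ _ → ℚ.≤-refl) , (λ _ _ → refl) , weigh-0 (λ _ → refl) (allSubsets n) ,
    λ i → trans (x≡0 i) (sym (weigh-0 (λ T → ℚ.*-zeroˡ (indicator (lookup T i))) (allSubsets n)))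

  hull-suc : (S T : Subset n) (t : ℕ) (x y : Vec ℚ n) → IsBasis S T → InDilatedMatroidPolytope S t x →
    (∀ i → lookup y i ≡ indicator (lookup T i) + lookup x i) → InDilatedMatroidPolytope S (suc t) y
  hull-suc {n} S T t x y T≼S (μ , μ≥0 , μ≡0 , Σμ , x≡) y≡ =
    (λ U → pointMass T U + μ U) ,
    (λ U → ℚ.+-mono-≤ (pointMass-≥0 T U) (μ≥0 U)) ,
    (λ U U⋠S → cong₂ _+_ (pointMass-≢ T U (λ T≡U → U⋠S (subst (IsBasis S) T≡U T≼S))) (μ≡0 U U⋠S)) ,
    trans (weigh-+ (pointMass T) μ (allSubsets n)) (trans
      (cong₂ _+_ (trans (weigh-cong (λ U → sym (ℚ.*-identityʳ (pointMass T U))) (allSubsets n)) (weigh-pointMass T (λ _ → 1ℚ))) Σμ)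
      (sym (ℤ→ℚ-+ 1ℤ (+ t)))) ,
    λ i → trans (y≡ i) (trans
      (cong₂ _+_ (sym (weigh-pointMass T (λ U → indicator (lookup U i)))) (x≡ i))
      (trans (sym (weigh-+ (λ U → pointMass T U * indicator (lookup U i)) (λ U → μ U * indicator (lookup U i)) (allSubsets n)))
        (weigh-cong (λ U → sym (ℚ.*-distribʳ-+ (indicator (lookup U i)) (pointMass T U) (μ U))) (allSubsets n))))

  -- The integer decomposition property of the matroid polytope: v is a sum of t indicator vectors
  -- of bases, and their multiplicities serve as weights.
  admissible⇒hull : (S : Subset n) (t : ℕ) (v : Vec ℤ n) → Admissible S t (prefix v) →
    InDilatedMatroidPolytope S t (map ℤ→ℚ v)
  admissible⇒hull S zero    v adm = hull-0 S (map ℤ→ℚ v) (λ i → trans (lookup-map i ℤ→ℚ v)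
    (cong ℤ→ℚ (ℤ.≤-antisym (admissible-≤t v adm i) (admissible-≥0 v adm i))))
  admissible⇒hull {n} S (suc t) v adm =
    let Q , admQ , admG = admissible-split adm
        T , T≼S , count≡ = admissible-1⇒basis admQ
        G : ℕ → ℤ
        G k = prefix v k ℤ.- Q k
        lookup≡ : ∀ i → lookup v i ≡ + bit T (toℕ i) ℤ.+ lookup (differences n G) i
        lookup≡ i = trans (lookup-prefix v i) (trans
          (trans (solve 4 (λ f f′ q b → f′ :- f := b :+ (f′ :- (b :+ q) :- (f :- q))) refl (prefix v (toℕ i)) (prefix v (suc (toℕ i))) (Q (toℕ i)) (+ bit T (toℕ i)))
            (cong (λ q → + bit T (toℕ i) ℤ.+ (prefix v (suc (toℕ i)) ℤ.- q ℤ.- G (toℕ i)))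
              (trans (cong (ℤ._+_ (+ bit T (toℕ i))) (sym (count≡ (ℕ.<⇒≤ (toℕ<n i)))))
                (trans (cong +_ (sym (count-suc T (toℕ i)))) (count≡ (toℕ<n i))))))
          (cong (ℤ._+_ (+ bit T (toℕ i))) (sym (lookup∘tabulate _ i))))
    in hull-suc S T t (map ℤ→ℚ (differences n G)) (map ℤ→ℚ v) T≼S (admissible⇒hull S t (differences n G) (admissible-differences admG)) λ i → trans (lookup-map i ℤ→ℚ v)
         (trans (cong ℤ→ℚ (lookup≡ i)) (trans (ℤ→ℚ-+ (+ bit T (toℕ i)) (lookup (differences n G) i))
           (cong₂ _+_ (sym (indicator-bit T i)) (sym (lookup-map i ℤ→ℚ (differences n G))))))

open MatroidHull

-- A line active for two columns yields a lattice point that is not a vertex.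

module Midpoints where
  open import Defs
  open import Data.Bool using (if_then_else_)
  open import Data.Nat as ℕ using (ℕ; zero; suc; z≤n; s≤s; _⊓_; _⊔_)
  import Data.Nat.Properties as ℕ
  open import Data.Integer as ℤ using (ℤ; +_; 0ℤ; +≤+; _+_; _-_; _≤_)
  import Data.Integer.Properties as ℤ
  open import Data.Integer.Solver using (module +-*-Solver)
  open +-*-Solver using (solve; _:+_; _:*_; _:-_; _:=_; con)
  open import Algebra.Properties.Semiring.Sum ℤ.+-*-semiring using (sum; sum-cong-≗)
  import Data.Rational as ℚ
  open import Data.Fin as Fin using (Fin; zero; suc; toℕ)
  open import Data.Fin.Properties as Fin using (toℕ<n)
  open import Data.Fin.Subset using (Subset)
  open import Data.Vec using (Vec; lookup; map)
  open import Data.Vec.Properties using (lookup-map)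
  open import Data.Product using (_×_; _,_; proj₁; proj₂)
  open import Data.Sum using (_⊎_; inj₁; inj₂)
  open import Function using (_∘_)
  open import Function.Bundles using (Equivalence)
  open import Relation.Nullary using (¬_; Dec; yes; no; does)
  open import Relation.Nullary.Decidable using (dec-true; dec-false)
  open import Relation.Binary using (tri<; tri≈; tri>)
  open import Relation.Binary.PropositionalEquality using (_≡_; _≢_; refl; sym; trans; cong; cong₂; subst; module ≡-Reasoning)
  open Admissible
  open IntSchubitope
  open IsFractionᵥ

  private variable n : ℕ

  count-mono : (S : Subset n) {k m : ℕ} → k ℕ.≤ m → count S k ℕ.≤ count S m
  count-mono S {k} {zero}  z≤n = ℕ.≤-refl
  count-mono S {k} {suc m} k≤m with ℕ.m≤n⇒m<n∨m≡n k≤m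
  ... | inj₁ (s≤s k≤m′) = ℕ.≤-trans (count-mono S k≤m′) (count-mono-suc S m)
  ... | inj₂ refl       = ℕ.≤-refl

  -- Prefix counts of two bases of SM(S) for k active, for τ = k + 1 and τ = k: the
  -- first contains row k but not row k - 1, the second is obtained from it by moving
  -- the element k up to k - 1.
  module _ (S : Subset n) (k : ℕ) where
    private
      g : ℕ
      g = count S k
      -- `L` may run one ahead of `count S`, capped by m and g, so that it reaches g one line before
      -- the jump even if S has a box in row k - 1. `R` follows S but is at least g + 1 from the
      -- jump on.
      L R : ℕ → ℕ
      L m = m ⊓ (suc (count S m) ⊓ g)
      R m = count S m ⊔ suc g

    stepAt : ℕ → ℕ → ℕ
    stepAt τ m = if does (m ℕ.<? τ) then L m else R m

    private
      stepAt-< : ∀ {τ m} → m ℕ.< τ → stepAt τ m ≡ L m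
      stepAt-< {τ} {m} m<τ = cong (λ b → if b then L m else R m) (dec-true (m ℕ.<? τ) m<τ)

      stepAt-≥ : ∀ {τ m} → τ ℕ.≤ m → stepAt τ m ≡ R m
      stepAt-≥ {τ} {m} τ≤m = cong (λ b → if b then L m else R m) (dec-false (m ℕ.<? τ) (ℕ.≤⇒≯ τ≤m))

      L≡g : ∀ {m} → g ℕ.≤ m → g ℕ.≤ suc (count S m) → L m ≡ g
      L≡g g≤m g≤c = trans (cong (_ ⊓_) (ℕ.m≥n⇒m⊓n≡n g≤c)) (ℕ.m≥n⇒m⊓n≡n g≤m)

      stepAt-step : ∀ {τ} → (∀ {m} → suc m ≡ τ → L m ≡ g × R (suc m) ≡ suc g) →
        ∀ m → stepAt τ m ℕ.≤ stepAt τ (suc m) × stepAt τ (suc m) ℕ.≤ suc (stepAt τ m)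
      stepAt-step {τ} jump m with ℕ.<-cmp (suc m) τ
      ... | tri< m+1<τ _ _ rewrite stepAt-< m+1<τ | stepAt-< (ℕ.<⇒≤ m+1<τ) =
        ℕ.⊓-mono-≤ (ℕ.n≤1+n m) (ℕ.⊓-mono-≤ (s≤s (count-mono-suc S m)) ℕ.≤-refl) ,
        ℕ.⊓-mono-≤ (ℕ.≤-refl {suc m}) (ℕ.⊓-mono-≤ (s≤s (count-suc-≤ S m)) (ℕ.n≤1+n g))
      ... | tri≈ _ refl _ rewrite stepAt-≥ (ℕ.≤-refl {suc m}) | stepAt-< (ℕ.n<1+n m) | proj₁ (jump refl) | proj₂ (jump refl) =
        ℕ.n≤1+n g , ℕ.≤-refl
      ... | tri> _ _ τ<m+1 rewrite stepAt-≥ (ℕ.<⇒≤ τ<m+1) | stepAt-≥ (ℕ.≤-pred τ<m+1) =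
        ℕ.⊔-mono-≤ (count-mono-suc S m) ℕ.≤-refl ,
        ℕ.⊔-mono-≤ (count-suc-≤ S m) (ℕ.n≤1+n (suc g))

    stepAt-admissible : Active S k → ∀ {τ} → τ ≡ k ⊎ τ ≡ suc k → Admissible S 1 (λ m → + stepAt τ m)
    stepAt-admissible act@(g<k , g<) {τ} τ~k = record
      { start     = cong +_ (stepAt-< (0<τ τ~k))
      ; increases = λ i → +≤+ (proj₁ (stepAt-step (jump τ~k) (toℕ i)))
      ; slope≤    = λ i → ℤ.≤-trans (+≤+ (proj₂ (stepAt-step (jump τ~k) (toℕ i)))) (ℤ.≤-reflexive (cong +_ (ℕ.+-comm 1 _)))
      ; dominates = λ {m} _ → subst (_≤ + stepAt τ m) (sym (ℤ.*-identityˡ _)) (+≤+ (count≤ m))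
      ; end       = trans (cong +_ (trans (stepAt-≥ (ℕ.≤-trans (τ≤k+1 τ~k) (Active⇒<n S act)))
          (trans (cong (_⊔ suc g) (count-all S)) (ℕ.m≥n⇒m⊔n≡m g<)))) (sym (ℤ.*-identityˡ _))
      }
      where
      0<τ : τ ≡ k ⊎ τ ≡ suc k → 0 ℕ.< τ
      0<τ (inj₁ refl) = ℕ.≤-<-trans z≤n g<k
      0<τ (inj₂ refl) = s≤s z≤n
      τ≤k+1 : τ ≡ k ⊎ τ ≡ suc k → τ ℕ.≤ suc k
      τ≤k+1 (inj₁ refl) = ℕ.n≤1+n k
      τ≤k+1 (inj₂ refl) = ℕ.≤-refl
      jump : τ ≡ k ⊎ τ ≡ suc k → ∀ {m} → suc m ≡ τ → L m ≡ g × R (suc m) ≡ suc g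
      jump (inj₁ refl) refl = L≡g (ℕ.≤-pred g<k) (count-suc-≤ S _) , ℕ.m≤n⇒m⊔n≡n (ℕ.n≤1+n g)
      jump (inj₂ refl) refl = L≡g (ℕ.<⇒≤ g<k) (ℕ.n≤1+n g) , ℕ.m≤n⇒m⊔n≡n (count-suc-≤ S k)
      count≤ : ∀ m → count S m ℕ.≤ stepAt τ m
      count≤ m with ℕ.<-≤-connex m τ
      ... | inj₁ m<τ rewrite stepAt-< m<τ = ℕ.⊓-glb (count≤k S m)
            (ℕ.⊓-glb (ℕ.n≤1+n _) (count-mono S (ℕ.≤-pred (ℕ.≤-trans m<τ (τ≤k+1 τ~k)))))
      ... | inj₂ τ≤m rewrite stepAt-≥ τ≤m = ℕ.m≤m⊔n _ _

    stepAt-k : Active S k → ∀ m → stepAt k m ≡ stepAt (suc k) m ℕ.+ (if does (m ℕ.≟ k) then 1 else 0)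
    stepAt-k (g<k , _) m with ℕ.<-cmp m k
    ... | tri< m<k m≢k _ rewrite stepAt-< m<k | stepAt-< (ℕ.m<n⇒m<1+n m<k) | dec-false (m ℕ.≟ k) m≢k = sym (ℕ.+-identityʳ _)
    ... | tri> _ m≢k k<m rewrite stepAt-≥ (ℕ.<⇒≤ k<m) | stepAt-≥ k<m | dec-false (m ℕ.≟ k) m≢k = sym (ℕ.+-identityʳ _)
    ... | tri≈ _ refl _ rewrite stepAt-≥ (ℕ.≤-refl {k}) | stepAt-< (ℕ.n<1+n k) | dec-true (k ℕ.≟ k) refl
          | L≡g (ℕ.<⇒≤ g<k) (ℕ.n≤1+n g) | ℕ.m≤n⇒m⊔n≡n (ℕ.n≤1+n g) = ℕ.+-comm 1 g

  spike : ℕ → ℕ → ℤ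
  spike k m = + (if does (m ℕ.≟ k) then 1 else 0)

  -- The common base point of the constructions; a column for which k is inactive keeps its own
  -- boxes.
  lowered : Subset n → ℕ → ℕ → ℤ
  lowered S k m = + (if does (active? S k) then stepAt S k (suc k) m else count S m)

  lowered-admissible : (S : Subset n) (k : ℕ) → Admissible S 1 (lowered S k)
  lowered-admissible S k = by (active? S k)
    where
    by : (a : Dec (Active S k)) → Admissible S 1 (λ m → + (if does a then stepAt S k (suc k) m else count S m))
    by (yes act) = stepAt-admissible S k act (inj₂ refl)
    by (no _)    = record
      { start     = cong +_ (count-zero S)
      ; increases = λ i → +≤+ (count-mono-suc S (toℕ i))
      ; slope≤    = λ i → ℤ.≤-trans (+≤+ (count-suc-≤ S (toℕ i))) (ℤ.≤-reflexive (cong +_ (ℕ.+-comm 1 _)))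
      ; dominates = λ _ → ℤ.≤-reflexive (ℤ.*-identityˡ _)
      ; end       = trans (cong +_ (count-all S)) (sym (ℤ.*-identityˡ _))
      }

  lowered+spike-admissible : (S : Subset n) (k : ℕ) → Active S k → Admissible S 1 (λ m → lowered S k m + spike k m)
  lowered+spike-admissible S k act = admissible-cong (λ {m} _ → trans (cong +_ (stepAt-k S k act m))
      (cong (λ b → + (if b then stepAt S k (suc k) m else count S m) + spike k m) (sym (dec-true (active? S k) act))))
    (stepAt-admissible S k act (inj₁ refl))

  columnSum : (Fin n → ℕ → ℤ) → Vec ℤ n
  columnSum {n} F = ∑ᵥ (λ j → differences n (F j))

  module _ {D : Diagram n} {t : ℕ} {F : Fin n → ℕ → ℤ} (adm : ∀ j → Admissible (D j) t (F j)) where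

    columnSum-∈ : IntSchubitope D t (columnSum F)
    columnSum-∈ = schubitope-∑ᵥ (λ j → differences n (F j)) (λ j → admissible-differences (adm j))

    prefix-columnSum : ∀ {k} → k ℕ.≤ n → prefix (columnSum F) k ≡ sum (λ j → F j k)
    prefix-columnSum k≤n = trans (prefix-∑ᵥ (λ j → differences n (F j)) k≤n)
      (sum-cong-≗ (λ j → prefix-differences (F j) (start (adm j)) k≤n))

  midpoint-lookup : (u v w : Vec ℤ n) → (∀ {k} → k ℕ.≤ n → prefix u k + prefix u k ≡ prefix v k + prefix w k) →
    ∀ i → lookup u i + lookup u i ≡ lookup v i + lookup w i
  midpoint-lookup u v w mid i = begin
    lookup u i + lookup u i                       ≡⟨ cong₂ _+_ (lookup-prefix u i) (lookup-prefix u i) ⟩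
    (u′ - u₀) + (u′ - u₀)                         ≡⟨ rearrange u′ u₀ u′ u₀ ⟩
    (u′ + u′) - (u₀ + u₀)                         ≡⟨ cong₂ _-_ (mid (toℕ<n i)) (mid (ℕ.<⇒≤ (toℕ<n i))) ⟩
    (v′ + w′) - (v₀ + w₀)                         ≡⟨ sym (rearrange v′ v₀ w′ w₀) ⟩
    (v′ - v₀) + (w′ - w₀)                         ≡⟨ sym (cong₂ _+_ (lookup-prefix v i) (lookup-prefix w i)) ⟩
    lookup v i + lookup w i                       ∎
    where
    open ≡-Reasoning
    u₀ = prefix u (toℕ i) ; u′ = prefix u (suc (toℕ i))
    v₀ = prefix v (toℕ i) ; v′ = prefix v (suc (toℕ i))
    w₀ = prefix w (toℕ i) ; w′ = prefix w (suc (toℕ i))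
    rearrange : ∀ a b c d → (a - b) + (c - d) ≡ (a + c) - (b + d)
    rearrange = solve 4 (λ a b c d → (a :- b) :+ (c :- d) := (a :+ c) :- (b :+ d)) refl

  -- If k is active for columns i ≠ j, moving a box over the line k in both columns,
  -- in neither, or in exactly one of them gives three collinear lattice points.
  module _ (D : Diagram n) (k : ℕ) (i j : Fin n) (i<j : i Fin.< j) (acti : Active (D i) k) (actj : Active (D j) k) where
    private
      base one two : Fin n → ℕ → ℤ
      base l = lowered (D l) k
      one l m = if does (l Fin.≟ i) then base l m + spike k m else base l m
      two l m = if does (l Fin.≟ j) then base l m + spike k m else one l m

      one-adm : ∀ l → Admissible (D l) 1 (one l)
      one-adm l with l Fin.≟ i
      ... | yes refl = lowered+spike-admissible (D l) k acti
      ... | no _     = lowered-admissible (D l) k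
      two-adm : ∀ l → Admissible (D l) 1 (two l)
      two-adm l with l Fin.≟ j
      ... | yes refl = lowered+spike-admissible (D l) k actj
      ... | no _     = one-adm l

      sum-one : ∀ m → sum (λ l → one l m) ≡ sum (λ l → base l m) + spike k m
      sum-one m = ≡-by (sum-except {f = λ l → one l m} {g = λ l → base l m} i
          (λ l l≢i → cong (λ b → if b then base l m + spike k m else base l m) (dec-false (l Fin.≟ i) l≢i)))
        (trans (solve 4 (λ s o b x → s :+ x :- o := s :+ (b :+ x) :- (o :+ b)) refl (sum (λ l → base l m)) (sum (λ l → one l m)) (base i m) (spike k m))
          (cong (λ b → sum (λ l → base l m) + (if b then base i m + spike k m else base i m) - (sum (λ l → one l m) + base i m)) (sym (dec-true (i Fin.≟ i) refl))))

      one-j : ∀ m → one j m ≡ base j m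
      one-j m = cong (λ b → if b then base j m + spike k m else base j m) (dec-false (j Fin.≟ i) (Fin.<⇒≢ i<j ∘ sym))

      sum-two : ∀ m → sum (λ l → two l m) ≡ sum (λ l → base l m) + spike k m + spike k m
      sum-two m = trans (≡-by (sum-except {f = λ l → two l m} {g = λ l → one l m} j
          (λ l l≢j → cong (λ b → if b then base l m + spike k m else one l m) (dec-false (l Fin.≟ j) l≢j)))
        (trans (solve 4 (λ s o b x → s :+ x :- o := s :+ (b :+ x) :- (o :+ b)) refl (sum (λ l → one l m)) (sum (λ l → two l m)) (base j m) (spike k m))
          (cong₂ (λ b o → sum (λ l → one l m) + (if b then base j m + spike k m else one j m) - (sum (λ l → two l m) + o)) (sym (dec-true (j Fin.≟ j) refl)) (sym (one-j m)))))
        (cong (_+ spike k m) (sum-one m))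

      x y z : Vec ℤ n
      x = columnSum one
      y = columnSum base
      z = columnSum two

      inside : ∀ {F} → (∀ l → Admissible (D l) 1 (F l)) → InSchubitope D (map ℤ→ℚ (columnSum F))
      inside {F} adm = schubitope⁺ (fractionᵥ-1 (columnSum F)) (columnSum-∈ adm)

      base-adm : ∀ l → Admissible (D l) 1 (base l)
      base-adm l = lowered-admissible (D l) k

      mid : ∀ l → lookup x l + lookup x l ≡ lookup y l + lookup z l
      mid = midpoint-lookup x y z λ {m} m≤n → begin
        prefix x m + prefix x m ≡⟨ cong (λ p → p + p) (trans (prefix-columnSum one-adm m≤n) (sum-one m)) ⟩
        sum (λ l → base l m) + spike k m + (sum (λ l → base l m) + spike k m)
          ≡⟨ solve 2 (λ s x → s :+ x :+ (s :+ x) := s :+ (s :+ x :+ x)) refl (sum (λ l → base l m)) (spike k m) ⟩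
        sum (λ l → base l m) + (sum (λ l → base l m) + spike k m + spike k m)
          ≡⟨ sym (cong₂ _+_ (prefix-columnSum base-adm m≤n) (trans (prefix-columnSum two-adm m≤n) (sum-two m))) ⟩
        prefix y m + prefix z m ∎
        where open ≡-Reasoning

      midℚ : ∀ l → lookup (map ℤ→ℚ x) l ℚ.+ lookup (map ℤ→ℚ x) l ≡ lookup (map ℤ→ℚ y) l ℚ.+ lookup (map ℤ→ℚ z) l
      midℚ l = begin
        lookup (map ℤ→ℚ x) l ℚ.+ lookup (map ℤ→ℚ x) l ≡⟨ cong (λ p → p ℚ.+ p) (lookup-map l ℤ→ℚ x) ⟩
        ℤ→ℚ (lookup x l) ℚ.+ ℤ→ℚ (lookup x l)         ≡⟨ sym (ℤ→ℚ-+ (lookup x l) (lookup x l)) ⟩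
        ℤ→ℚ (lookup x l + lookup x l)                   ≡⟨ cong ℤ→ℚ (mid l) ⟩
        ℤ→ℚ (lookup y l + lookup z l)                   ≡⟨ ℤ→ℚ-+ (lookup y l) (lookup z l) ⟩
        ℤ→ℚ (lookup y l) ℚ.+ ℤ→ℚ (lookup z l)         ≡⟨ sym (cong₂ ℚ._+_ (lookup-map l ℤ→ℚ y) (lookup-map l ℤ→ℚ z)) ⟩
        lookup (map ℤ→ℚ y) l ℚ.+ lookup (map ℤ→ℚ z) l ∎
        where open ≡-Reasoning

      k≤n : k ℕ.≤ n
      k≤n = ℕ.<⇒≤ (Active⇒<n (D i) acti)

      0≢-2spike : 0ℤ ≢ 0ℤ - (spike k k + spike k k)
      0≢-2spike rewrite dec-true (k ℕ.≟ k) refl = λ ()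

      y≢z : map ℤ→ℚ y ≢ map ℤ→ℚ z
      y≢z eq = 0≢-2spike (trans (sym (ℤ.i≡j⇒i-j≡0 (trans (sym (prefix-columnSum base-adm k≤n))
          (trans (cong (λ u → prefix u k) y≡z) (trans (prefix-columnSum two-adm k≤n) (sum-two k))))))
        (solve 2 (λ s x → s :- (s :+ x :+ x) := con 0ℤ :- (x :+ x)) refl (sum (λ l → base l k)) (spike k k)))
        where
        y≡z : y ≡ z
        y≡z = lookup-ext λ l → ℤ→ℚ-injective (trans (sym (lookup-map l ℤ→ℚ y)) (trans (cong (λ u → lookup u l) eq) (lookup-map l ℤ→ℚ z)))

    overlap⇒¬LatticeFree : ¬ LatticeFree D
    overlap⇒¬LatticeFree free = y≢z (proj₂ (Equivalence.to (free (map ℤ→ℚ x)) (inside one-adm , x , refl))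
      (map ℤ→ℚ y) (map ℤ→ℚ z) (inside base-adm) (inside two-adm) midℚ)

open Midpoints

-- Lattice points and vertices when no line is active for two columns.

module LatticeFreeness where
  open import Defs
  open import Data.Bool using (if_then_else_)
  open import Data.Empty using (⊥-elim)
  open import Data.Nat as ℕ using (ℕ; zero; suc)
  import Data.Nat.Properties as ℕ
  open import Data.Integer as ℤ using (ℤ; +_; 0ℤ; 1ℤ; -1ℤ; _+_; _-_; _*_; _≤_)
  import Data.Integer.Properties as ℤ
  open import Data.Integer.Divisibility.Signed using (_∣_; _∣?_; divides; ∣m∣n⇒∣m+n; ∣m∣n⇒∣m-n; ∣m⇒∣m*n; ∣-refl)
  open import Data.Integer.Solver using (module +-*-Solver)
  open +-*-Solver using (solve; _:+_; _:*_; _:-_; _:=_; con)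
  open import Algebra.Properties.Semiring.Sum ℤ.+-*-semiring using (sum; sum-cong-≗; ∑-distrib-+; *-distribˡ-sum; sum-replicate-zero)
  open import Data.Rational as ℚ using (ℚ)
  open import Data.Fin using (Fin; zero; suc; toℕ)
  open import Data.Fin.Properties using (toℕ<n; any?)
  open import Data.Fin.Subset using (Subset; ∣_∣)
  open import Data.Vec using (Vec; []; _∷_; lookup; tabulate; map)
  open import Data.Vec.Properties using (lookup∘tabulate; lookup-map)
  open import Data.Product using (∃; ∃₂; _×_; _,_; proj₁; proj₂)
  open import Data.Sum using (_⊎_; inj₁; inj₂)
  open import Function using (_∘_)
  open import Function.Bundles using (Equivalence; _⇔_; mk⇔)
  open import Relation.Nullary using (¬_; yes; no; does)
  open import Relation.Nullary.Decidable using (dec-true; dec-false)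
  open import Relation.Binary.PropositionalEquality using (_≡_; _≢_; refl; sym; trans; cong; cong₂; subst; module ≡-Reasoning)
  open Admissible
  open IntSchubitope
  open IsFractionᵥ

  private variable n : ℕ

  commonDenominator₂ : (x y : Vec ℚ n) → ∃ λ q → ∃₂ λ v w → IsFractionᵥ (suc q) x v × IsFractionᵥ (suc q) y w
  commonDenominator₂ x y with commonDenominator x | commonDenominator y
  ... | q , v , xv | r , w , yw = r ℕ.+ q ℕ.* suc r , map (_* + suc r) v , map (_* + suc q) w ,
    fractionᵥ-scale (suc r) xv ,
    subst (λ d → IsFractionᵥ d y (map (_* + suc q) w)) (ℕ.*-comm (suc r) (suc q)) (fractionᵥ-scale (suc q) yw)

  fractionᵥ-injective : ∀ {q} {x y : Vec ℚ n} {v} → IsFractionᵥ (suc q) x v → IsFractionᵥ (suc q) y v → x ≡ y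
  fractionᵥ-injective xv yv = lookup-ext λ i → fraction-≡⁺ (coordinate xv i) (coordinate yv i) refl

  fractionᵥ-exists : ∀ q (v : Vec ℤ n) → ∃ λ x → IsFractionᵥ (suc q) x v
  fractionᵥ-exists q v = tabulate (λ i → proj₁ (fraction-exists {suc q} (lookup v i))) ,
    fractions λ i → subst (λ p → IsFraction (suc q) p (lookup v i)) (sym (lookup∘tabulate _ i)) (proj₂ (fraction-exists {suc q} (lookup v i)))

  schubitope-1 : (D : Diagram n) {q : ℕ} {x : Vec ℚ n} {v : Vec ℤ n} → IsFractionᵥ (suc q) x v →
    InSchubitope D x ⇔ IntSchubitope D (suc q) v
  schubitope-1 D {q} {x} {v} xv = mk⇔
    (λ x∈ → subst (λ t → IntSchubitope D t v) (ℕ.*-identityʳ (suc q)) (schubitope⁻ xv x∈))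
    (λ v∈ → schubitope⁺ xv (subst (λ t → IntSchubitope D t v) (sym (ℕ.*-identityʳ (suc q))) v∈))

  schubitope-lattice : (D : Diagram n) (t : ℕ) (v : Vec ℤ n) →
    InDilatedSchubitope D t (map ℤ→ℚ v) ⇔ IntSchubitope D t v
  schubitope-lattice D t v = mk⇔
    (λ x∈ → subst (λ t → IntSchubitope D t v) (ℕ.*-identityˡ t) (schubitope⁻ (fractionᵥ-1 v) x∈))
    (λ v∈ → schubitope⁺ (fractionᵥ-1 v) (subst (λ t → IntSchubitope D t v) (sym (ℕ.*-identityˡ t)) v∈))

  -- The components of a lattice point have increments 0 or 1, the extreme values
  -- allowed, so its only decomposition as a midpoint is the trivial one.
  module _ {D : Diagram n} (excl : Exclusive D) {N : ℕ} (u v w : Vec ℤ n)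
    (u∈ : IntSchubitope D 1 u) (v∈ : IntSchubitope D N v) (w∈ : IntSchubitope D N w)
    (mid : ∀ k → + N * (prefix u k + prefix u k) ≡ prefix v k + prefix w k) where
    private
      U V W : Fin n → ℕ → ℤ
      U = component D 1 (prefix u)
      V = component D N (prefix v)
      W = component D N (prefix w)
      admU : ∀ j → Admissible (D j) 1 (U j)
      admU = component-admissible u∈ excl
      admV : ∀ j → Admissible (D j) N (V j)
      admV = component-admissible v∈ excl
      admW : ∀ j → Admissible (D j) N (W j)
      admW = component-admissible w∈ excl

      -- `component` is linear in the dilation factor and the prefix sum jointly, so the midpoint
      -- relation passes to every column.
      component-mid : ∀ j k → + N * (U j k + U j k) ≡ V j k + W j k
      component-mid j k with active? (D j) k
      ... | no ¬act rewrite component-no D 1 (prefix u) j ¬act | component-no D N (prefix v) j ¬act | component-no D N (prefix w) j ¬act =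
        solve 2 (λ N c → N :* (con 1ℤ :* c :+ con 1ℤ :* c) := N :* c :+ N :* c) refl (+ N) (+ count (D j) k)
      ... | yes act rewrite component-yes D 1 (prefix u) j act | component-yes D N (prefix v) j act | component-yes D N (prefix w) j act =
        ≡-by (mid k) (solve 6 (λ N c C u v w →
            N :* c :+ (v :- N :* C) :+ (N :* c :+ (w :- N :* C)) :- N :* (con 1ℤ :* c :+ (u :- con 1ℤ :* C) :+ (con 1ℤ :* c :+ (u :- con 1ℤ :* C)))
            := v :+ w :- N :* (u :+ u)) refl
          (+ N) (+ count (D j) k) (+ boxesAbove D k) (prefix u k) (prefix v k) (prefix w k))

      increment≡ : ∀ j (i : Fin n) → V j (suc (toℕ i)) - V j (toℕ i) ≡ W j (suc (toℕ i)) - W j (toℕ i)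
      increment≡ j i = by (unit-interval (increases (admU j) i) (slope≤ (admU j) i))
        where
        a = U j (toℕ i) ; a′ = U j (suc (toℕ i))
        b = V j (toℕ i) ; b′ = V j (suc (toℕ i))
        c = W j (toℕ i) ; c′ = W j (suc (toℕ i))
        mid₀ : + N * (a + a) ≡ b + c
        mid₀ = component-mid j (toℕ i)
        mid₁ : + N * (a′ + a′) ≡ b′ + c′
        mid₁ = component-mid j (suc (toℕ i))
        by : a′ ≡ a ⊎ a′ ≡ a + 1ℤ → b′ - b ≡ c′ - c
        by (inj₁ eq) = ℤ.≤-antisym
          (≤-by (increases (admW j) i ⊹ increases (admW j) i ⊹ ℤ.≤-reflexive bc)
            (solve 4 (λ b b′ c c′ → c′ :- c :- (b′ :- b) := c′ :+ c′ :+ (b :+ c) :- (c :+ c :+ (b′ :+ c′))) refl b b′ c c′))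
          (≤-by (increases (admV j) i ⊹ increases (admV j) i ⊹ ℤ.≤-reflexive bc)
            (solve 4 (λ b b′ c c′ → b′ :- b :- (c′ :- c) := b′ :+ b′ :+ (b :+ c) :- (b :+ b :+ (b′ :+ c′))) refl b b′ c c′))
          where
          bc : b′ + c′ ≡ b + c
          bc = trans (sym mid₁) (trans (cong (λ x → + N * (x + x)) eq) mid₀)
        by (inj₂ eq) = ℤ.≤-antisym
          (≤-by (slope≤ (admV j) i ⊹ slope≤ (admV j) i ⊹ ℤ.≤-reflexive (sym bc))
            (solve 5 (λ b b′ c c′ N → c′ :- c :- (b′ :- b) := b :+ N :+ (b :+ N) :+ (b′ :+ c′) :- (b′ :+ b′ :+ (b :+ c :+ (N :+ N)))) refl b b′ c c′ (+ N)))
          (≤-by (slope≤ (admW j) i ⊹ slope≤ (admW j) i ⊹ ℤ.≤-reflexive (sym bc))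
            (solve 5 (λ b b′ c c′ N → b′ :- b :- (c′ :- c) := c :+ N :+ (c :+ N) :+ (b′ :+ c′) :- (c′ :+ c′ :+ (b :+ c :+ (N :+ N)))) refl b b′ c c′ (+ N)))
          where
          bc : b′ + c′ ≡ b + c + (+ N + + N)
          bc = trans (sym mid₁) (trans (cong (λ x → + N * (x + x)) eq)
            (trans (solve 2 (λ N a → N :* (a :+ con 1ℤ :+ (a :+ con 1ℤ)) := N :* (a :+ a) :+ (N :+ N)) refl (+ N) a)
              (cong (_+ (+ N + + N)) mid₀)))

      component≡ : ∀ j {k} → k ℕ.≤ n → V j k ≡ W j k
      component≡ j = increments (λ k → V j k ≡ W j k) (trans (start (admV j)) (sym (start (admW j))))
        λ i ih → trans (solve 2 (λ b b′ → b′ := b′ :- b :+ b) refl (V j (toℕ i)) (V j (suc (toℕ i))))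
          (trans (cong₂ _+_ (increment≡ j i) ih)
            (solve 2 (λ b b′ → b′ :- b :+ b := b′) refl (W j (toℕ i)) (W j (suc (toℕ i)))))

    endpoints≡ : v ≡ w
    endpoints≡ = prefix-injective λ {k} k≤n → trans
      (sym (sum-component D excl N (prefix v) (excess≡0 v∈ k)))
      (trans (sum-cong-≗ (λ j → component≡ j k≤n)) (sum-component D excl N (prefix w) (excess≡0 w∈ k)))

  -- With a common denominator N, y and z become integer points of the dilate by N while u stays in
  -- the undilated polytope; this is the factor N in the hypothesis of `endpoints≡`.
  latticePoint⇒vertex : (D : Diagram n) → Exclusive D → (x : Vec ℚ n) → InSchubitope D x → IsLatticePoint x → IsVertex D x
  latticePoint⇒vertex D excl x x∈ (u , refl) = x∈ , λ y z y∈ z∈ mid →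
    let q , v , w , yv , zw = commonDenominator₂ y z
        v∈ = Equivalence.to (schubitope-1 D yv) y∈
        w∈ = Equivalence.to (schubitope-1 D zw) z∈
        lookup-mid : ∀ i → lookup u i * + suc q + lookup u i * + suc q ≡ lookup v i + lookup w i
        lookup-mid i = fraction-≡⁻
          (subst (λ d → IsFraction d (lookup (map ℤ→ℚ u) i ℚ.+ lookup (map ℤ→ℚ u) i) (lookup u i * + suc q + lookup u i * + suc q)) (ℕ.*-identityˡ (suc q))
            (fraction-+ (fraction-scale (suc q) (coordinate (fractionᵥ-1 u) i)) (fraction-scale (suc q) (coordinate (fractionᵥ-1 u) i))))
          (fraction-+ (coordinate yv i) (coordinate zw i)) (mid i)
        v≡w = endpoints≡ excl u v w (Equivalence.to (schubitope-lattice D 1 u) x∈) v∈ w∈ (prefix-mid q u v w lookup-mid)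
    in fractionᵥ-injective yv (subst (IsFractionᵥ (suc q) z) (sym v≡w) zw)
    where
    prefix-mid : ∀ {n} q (u v w : Vec ℤ n) → (∀ i → lookup u i * + suc q + lookup u i * + suc q ≡ lookup v i + lookup w i) →
      ∀ k → + suc q * (prefix u k + prefix u k) ≡ prefix v k + prefix w k
    prefix-mid q []      []      []      eq k       = ℤ.*-zeroʳ (+ suc q)
    prefix-mid q (_ ∷ _) (_ ∷ _) (_ ∷ _) eq zero    = ℤ.*-zeroʳ (+ suc q)
    prefix-mid q (a ∷ u) (b ∷ v) (c ∷ w) eq (suc k) = trans
      (solve 3 (λ Q a u → Q :* (a :+ u :+ (a :+ u)) := a :* Q :+ a :* Q :+ Q :* (u :+ u)) refl (+ suc q) a (prefix u k))
      (trans (cong₂ _+_ (eq zero) (prefix-mid q u v w (eq ∘ suc) k))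
        (solve 4 (λ b c v w → b :+ c :+ (v :+ w) := b :+ v :+ (c :+ w)) refl b c (prefix v k) (prefix w k)))

  -- The direction of the perturbation: after scaling by q, multiples of q stand for integers, so
  -- exactly the non-integral prefix sums move, by 1/q.
  nonMultiple : ℕ → ℤ → ℤ
  nonMultiple q z = if does (+ q ∣? z) then 0ℤ else 1ℤ

  nonMultiple-0 : ∀ q z → + q ∣ z → nonMultiple q z ≡ 0ℤ
  nonMultiple-0 q z q∣z = cong (λ b → if b then 0ℤ else 1ℤ) (dec-true (+ q ∣? z) q∣z)

  nonMultiple-1 : ∀ q z → ¬ (+ q ∣ z) → nonMultiple q z ≡ 1ℤ
  nonMultiple-1 q z q∤z = cong (λ b → if b then 0ℤ else 1ℤ) (dec-false (+ q ∣? z) q∤z)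

  nonMultiple-cong : ∀ q y z → + q ∣ y - z → nonMultiple q y ≡ nonMultiple q z
  nonMultiple-cong q y z q∣ with + q ∣? z
  ... | yes q∣z = trans (nonMultiple-0 q y (subst (+ q ∣_) (solve 2 (λ y z → y :- z :+ z := y) refl y z) (∣m∣n⇒∣m+n q∣ q∣z))) (sym (nonMultiple-0 q z q∣z))
  ... | no  q∤z = trans (nonMultiple-1 q y (λ q∣y → q∤z (subst (+ q ∣_) (solve 2 (λ y z → y :- (y :- z) := z) refl y z) (∣m∣n⇒∣m-n q∣y q∣)))) (sym (nonMultiple-1 q z q∤z))

  ∣q* : ∀ q c → + q ∣ + q * c
  ∣q* q c = ∣m⇒∣m*n c ∣-refl

  <⇒1+≤ : ∀ {a b} → a ≤ b → a ≢ b → a + 1ℤ ≤ b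
  <⇒1+≤ {a} {b} a≤b a≢b = subst (_≤ b) (ℤ.+-comm 1ℤ a) (ℤ.i<j⇒suc[i]≤j (ℤ.≤∧≢⇒< a≤b a≢b))

  -- All bounds in Admissible S q are multiples of q, so a prefix sum that is not a
  -- multiple of q keeps a distance of at least 1 from them.
  perturb-admissible : {S : Subset n} {q : ℕ} {F : ℕ → ℤ} (σ : ℤ) → -1ℤ ≤ σ → σ ≤ 1ℤ → Admissible S q F →
    Admissible S q (λ k → F k + σ * nonMultiple q (F k))
  perturb-admissible {n} {S} {q} {F} σ -1≤σ σ≤1 adm = record
    { start     = trans (fixed (subst (+ q ∣_) (sym (trans (start adm) (sym (ℤ.*-zeroʳ (+ q))))) (∣q* q 0ℤ))) (start adm)
    ; increases = λ i → proj₁ (step i)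
    ; slope≤    = λ i → proj₂ (step i)
    ; dominates = dominates′
    ; end       = trans (fixed (subst (+ q ∣_) (sym (end adm)) (∣q* q _))) (end adm)
    }
    where
    fixed : ∀ {k} → + q ∣ F k → F k + σ * nonMultiple q (F k) ≡ F k
    fixed {k} q∣ = trans (cong (λ e → F k + σ * e) (nonMultiple-0 q (F k) q∣)) (solve 2 (λ f s → f :+ s :* con 0ℤ := f) refl (F k) σ)
    moved : ∀ {k} → ¬ (+ q ∣ F k) → F k + σ * nonMultiple q (F k) ≡ F k + σ
    moved {k} q∤ = trans (cong (λ e → F k + σ * e) (nonMultiple-1 q (F k) q∤)) (solve 2 (λ f s → f :+ s :* con 1ℤ := f :+ s) refl (F k) σ)
    dominates′ : ∀ {k} → k ℕ.≤ n → + q * + count S k ≤ F k + σ * nonMultiple q (F k)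
    dominates′ {k} k≤n with + q ∣? F k
    ... | yes q∣ = subst (+ q * + count S k ≤_) (sym (fixed q∣)) (dominates adm k≤n)
    ... | no  q∤ = subst (+ q * + count S k ≤_) (sym (moved q∤))
      (≤-by (<⇒1+≤ (dominates adm k≤n) (λ eq → q∤ (subst (+ q ∣_) eq (∣q* q _))) ⊹ -1≤σ)
        (solve 3 (λ f s c → f :+ s :- c := f :+ s :- (c :+ con 1ℤ :+ con -1ℤ)) refl (F k) σ (+ q * + count S k)))
    step : ∀ (i : Fin n) → let F′ = λ k → F k + σ * nonMultiple q (F k) in
      F′ (toℕ i) ≤ F′ (suc (toℕ i)) × F′ (suc (toℕ i)) ≤ F′ (toℕ i) + + q
    step i with + q ∣? F (toℕ i) | + q ∣? F (suc (toℕ i))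
    ... | yes q∣ | yes q∣′ rewrite fixed q∣ | fixed q∣′ = increases adm i , slope≤ adm i
    ... | no  q∤ | no  q∤′ rewrite moved q∤ | moved q∤′ = increases adm i ⊹ ℤ.≤-refl ,
      ≤-by (slope≤ adm i) (solve 4 (λ f f′ s q → f :+ s :+ q :- (f′ :+ s) := f :+ q :- f′) refl (F (toℕ i)) (F (suc (toℕ i))) σ (+ q))
    ... | yes q∣ | no  q∤′ rewrite fixed q∣ | moved q∤′ =
      ≤-by (<⇒1+≤ (increases adm i) (λ eq → q∤′ (subst (+ q ∣_) eq q∣)) ⊹ -1≤σ)
        (solve 3 (λ f f′ s → f′ :+ s :- f := f′ :+ s :- (f :+ con 1ℤ :+ con -1ℤ)) refl (F (toℕ i)) (F (suc (toℕ i))) σ) ,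
      ≤-by (<⇒1+≤ (slope≤ adm i) (λ eq → q∤′ (subst (+ q ∣_) (sym eq) (∣m∣n⇒∣m+n q∣ ∣-refl))) ⊹ σ≤1)
        (solve 4 (λ f f′ s q → f :+ q :- (f′ :+ s) := f :+ q :+ con 1ℤ :- (f′ :+ con 1ℤ :+ s)) refl (F (toℕ i)) (F (suc (toℕ i))) σ (+ q))
    ... | no  q∤ | yes q∣′ rewrite moved q∤ | fixed q∣′ =
      ≤-by (<⇒1+≤ (increases adm i) (λ eq → q∤ (subst (+ q ∣_) (sym eq) q∣′)) ⊹ σ≤1)
        (solve 3 (λ f f′ s → f′ :- (f :+ s) := f′ :+ con 1ℤ :- (f :+ con 1ℤ :+ s)) refl (F (toℕ i)) (F (suc (toℕ i))) σ) ,
      ≤-by (<⇒1+≤ (slope≤ adm i) (λ eq → q∤ (subst (+ q ∣_) (solve 2 (λ f q → f :+ q :- q := f) refl (F (toℕ i)) (+ q))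
          (∣m∣n⇒∣m-n (subst (+ q ∣_) eq q∣′) ∣-refl))) ⊹ -1≤σ)
        (solve 4 (λ f f′ s q → f :+ s :+ q :- f′ := f :+ q :+ s :- (f′ :+ con 1ℤ :+ con -1ℤ)) refl (F (toℕ i)) (F (suc (toℕ i))) σ (+ q))

  module _ {D : Diagram n} (excl : Exclusive D) {q : ℕ} {v : Vec ℤ n} (v∈ : IntSchubitope D q v) where
    private
      V : Fin n → ℕ → ℤ
      V = component D q (prefix v)

    -- Inactive columns take multiples of q, and the active one agrees with the prefix sum modulo q.
    -- So perturbing the columns perturbs the total in the same way.
    sum-nonMultiple : ∀ k → sum (λ j → nonMultiple q (V j k)) ≡ nonMultiple q (prefix v k)
    sum-nonMultiple k with any? (λ j → active? (D j) k)
    ... | yes (j , act) = ≡-by (sum-except {f = λ i → nonMultiple q (V i k)} {g = λ _ → 0ℤ} j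
            (λ i i≢j → inactive-0 i (others-inactive v∈ excl j act i i≢j)))
          (trans (cong (λ e → e - sum (λ i → nonMultiple q (V i k))) (sym active-≡))
            (trans (solve 2 (λ s e → e :- s := con 0ℤ :+ e :- (s :+ con 0ℤ)) refl (sum (λ i → nonMultiple q (V i k))) (nonMultiple q (V j k)))
              (cong (λ z → z + nonMultiple q (V j k) - (sum (λ i → nonMultiple q (V i k)) + 0ℤ)) (sym (sum-replicate-zero n)))))
      where
      inactive-0 : ∀ i → ¬ Active (D i) k → nonMultiple q (V i k) ≡ 0ℤ
      inactive-0 i ¬act = nonMultiple-0 q (V i k) (subst (+ q ∣_) (sym (component-no D q (prefix v) i ¬act)) (∣q* q _))
      active-≡ : nonMultiple q (V j k) ≡ nonMultiple q (prefix v k)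
      active-≡ = nonMultiple-cong q (V j k) (prefix v k) (subst (+ q ∣_)
        (sym (trans (cong (_- prefix v k) (component-yes D q (prefix v) j act))
          (solve 4 (λ q c C x → q :* c :+ (x :- q :* C) :- x := q :* (c :- C)) refl (+ q) (+ count (D j) k) (+ boxesAbove D k) (prefix v k))))
        (∣q* q _))
    ... | no ¬act = trans (sum-cong-≗ (λ i → nonMultiple-0 q (V i k) (subst (+ q ∣_) (sym (component-no D q (prefix v) i (λ act → ¬act (i , act)))) (∣q* q _))))
      (trans (sum-replicate-zero n) (sym (nonMultiple-0 q (prefix v k) (subst (+ q ∣_)
        (sym (ℤ.i-j≡0⇒i≡j (prefix v k) (+ q * + boxesAbove D k) (excess≡0 v∈ k (λ i act → ¬act (i , act))))) (∣q* q _)))))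

    perturbed : ℤ → Vec ℤ n
    perturbed σ = columnSum (λ j k → V j k + σ * nonMultiple q (V j k))

    module _ (σ : ℤ) (-1≤σ : -1ℤ ≤ σ) (σ≤1 : σ ≤ 1ℤ) where
      private
        adm : ∀ j → Admissible (D j) q (λ k → V j k + σ * nonMultiple q (V j k))
        adm j = perturb-admissible σ -1≤σ σ≤1 (component-admissible v∈ excl j)

      perturbed-∈ : IntSchubitope D q (perturbed σ)
      perturbed-∈ = columnSum-∈ adm

      prefix-perturbed : ∀ {k} → k ℕ.≤ n → prefix (perturbed σ) k ≡ prefix v k + σ * nonMultiple q (prefix v k)
      prefix-perturbed {k} k≤n = begin
        prefix (perturbed σ) k                                          ≡⟨ prefix-columnSum adm k≤n ⟩
        sum (λ j → V j k + σ * nonMultiple q (V j k))                   ≡⟨ ∑-distrib-+ (λ j → V j k) (λ j → σ * nonMultiple q (V j k)) ⟩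
        sum (λ j → V j k) + sum (λ j → σ * nonMultiple q (V j k))       ≡⟨ cong₂ _+_ (sum-component D excl q (prefix v) (excess≡0 v∈ k)) (sym (*-distribˡ-sum σ (λ j → nonMultiple q (V j k)))) ⟩
        prefix v k + σ * sum (λ j → nonMultiple q (V j k))              ≡⟨ cong (λ s → prefix v k + σ * s) (sum-nonMultiple k) ⟩
        prefix v k + σ * nonMultiple q (prefix v k) ∎
        where open ≡-Reasoning

    private
      w⁺ w⁻ : Vec ℤ n
      w⁺ = perturbed 1ℤ
      w⁻ = perturbed -1ℤ
      nd : ℕ → ℤ
      nd k = nonMultiple q (prefix v k)

      w⁺∈ : IntSchubitope D q w⁺
      w⁺∈ = perturbed-∈ 1ℤ ℤ.-≤+ ℤ.≤-refl
      w⁻∈ : IntSchubitope D q w⁻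
      w⁻∈ = perturbed-∈ -1ℤ ℤ.≤-refl ℤ.-≤+

      prefix⁺ : ∀ {k} → k ℕ.≤ n → prefix w⁺ k ≡ prefix v k + 1ℤ * nd k
      prefix⁺ = prefix-perturbed 1ℤ ℤ.-≤+ ℤ.≤-refl
      prefix⁻ : ∀ {k} → k ℕ.≤ n → prefix w⁻ k ≡ prefix v k + -1ℤ * nd k
      prefix⁻ = prefix-perturbed -1ℤ ℤ.≤-refl ℤ.-≤+

      mid : ∀ i → lookup v i + lookup v i ≡ lookup w⁺ i + lookup w⁻ i
      mid = midpoint-lookup v w⁺ w⁻ λ {k} k≤n → trans
        (solve 2 (λ p e → p :+ p := p :+ con 1ℤ :* e :+ (p :+ con -1ℤ :* e)) refl (prefix v k) (nd k))
        (sym (cong₂ _+_ (prefix⁺ k≤n) (prefix⁻ k≤n)))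

      1+1≢0 : 1ℤ + 1ℤ ≢ 0ℤ
      1+1≢0 ()

      -- A prefix sum that is not a multiple of q would differ by 2 between the two perturbed
      -- points.
      w⁺≡w⁻⇒∣prefix : w⁺ ≡ w⁻ → ∀ {k} → k ℕ.≤ n → + q ∣ prefix v k
      w⁺≡w⁻⇒∣prefix w⁺≡w⁻ {k} k≤n with + q ∣? prefix v k
      ... | yes q∣ = q∣
      ... | no  q∤ = ⊥-elim (1+1≢0 (trans (trans (cong (λ e → e + e) (sym (nonMultiple-1 q (prefix v k) q∤)))
          (solve 2 (λ p e → e :+ e := p :+ con 1ℤ :* e :- (p :+ con -1ℤ :* e)) refl (prefix v k) (nd k)))
          (ℤ.i≡j⇒i-j≡0 (trans (sym (prefix⁺ k≤n)) (trans (cong (λ w → prefix w k) w⁺≡w⁻) (prefix⁻ k≤n))))))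

      w⁺≡w⁻⇒∣ : w⁺ ≡ w⁻ → ∀ i → + q ∣ lookup v i
      w⁺≡w⁻⇒∣ w⁺≡w⁻ i = subst (+ q ∣_) (sym (lookup-prefix v i))
        (∣m∣n⇒∣m-n (w⁺≡w⁻⇒∣prefix w⁺≡w⁻ (toℕ<n i)) (w⁺≡w⁻⇒∣prefix w⁺≡w⁻ (ℕ.<⇒≤ (toℕ<n i))))

    vertex⇒∣ : .{{_ : ℕ.NonZero q}} {x y z : Vec ℚ n} → IsFractionᵥ q x v →
      IsFractionᵥ q y w⁺ → IsFractionᵥ q z w⁻ → IsVertex D x → ∀ i → + q ∣ lookup v i
    vertex⇒∣ {x} {y} {z} xv yw zw (_ , extreme) = w⁺≡w⁻⇒∣ (lookup-ext λ i →
      fraction-≡⁻ (coordinate yw i) (coordinate zw i) (cong (λ u → lookup u i) y≡z))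
      where
      y≡z : y ≡ z
      y≡z = extreme y z (inSchubitope yw w⁺∈) (inSchubitope zw w⁻∈)
        (λ i → fraction-≡⁺ (fraction-+ (coordinate xv i) (coordinate xv i)) (fraction-+ (coordinate yw i) (coordinate zw i)) (mid i))
        where
        inSchubitope : ∀ {y w} → IsFractionᵥ q y w → IntSchubitope D q w → InSchubitope D y
        inSchubitope {w = w} yw w∈ = schubitope⁺ yw (subst (λ t → IntSchubitope D t w) (sym (ℕ.*-identityʳ q)) w∈)

  multiple-fraction : ∀ {q a} (q∣a : + q ∣ a) → IsFraction q (ℤ→ℚ (_∣_.quotient q∣a)) a
  multiple-fraction {q} (divides r refl) = fraction (sym (ℤ→ℚ-* r (+ q)))

  multiples⇒latticePoint : {q : ℕ} {x : Vec ℚ n} {v : Vec ℤ n} → IsFractionᵥ (suc q) x v →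
    (∀ i → + suc q ∣ lookup v i) → IsLatticePoint x
  multiples⇒latticePoint xv q∣v = tabulate (λ i → _∣_.quotient (q∣v i)) , lookup-ext λ i →
    trans (fraction-≡⁺ (coordinate xv i) (multiple-fraction (q∣v i)) refl)
      (sym (trans (lookup-map i ℤ→ℚ (tabulate (λ i → _∣_.quotient (q∣v i)))) (cong ℤ→ℚ (lookup∘tabulate _ i))))

  vertex⇒latticePoint : (D : Diagram n) → Exclusive D → (x : Vec ℚ n) → IsVertex D x → IsLatticePoint x
  vertex⇒latticePoint D excl x vertex =
    let q , v , xv = commonDenominator x
        v∈ = Equivalence.to (schubitope-1 D xv) (proj₁ vertex)
        _ , yw = fractionᵥ-exists q (perturbed excl v∈ 1ℤ)
        _ , zw = fractionᵥ-exists q (perturbed excl v∈ -1ℤ)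
    in multiples⇒latticePoint xv (vertex⇒∣ excl v∈ xv yw zw vertex)

  latticeFree⇔smallOverlaps : (D : Diagram n) → LatticeFree D ⇔ SmallOverlaps D
  latticeFree⇔smallOverlaps D = mk⇔
    (λ free → Exclusive⇒SmallOverlaps D (λ k i j i<j acti actj → overlap⇒¬LatticeFree D k i j i<j acti actj free))
    (λ small x → let excl = SmallOverlaps⇒Exclusive D small in mk⇔
      (λ (x∈ , lattice) → latticePoint⇒vertex D excl x x∈ lattice)
      (λ vertex → proj₁ vertex , vertex⇒latticePoint D excl x vertex))

open LatticeFreeness

-- Counting lattice points when no line is active for two columns.

module PointCounts where
  open import Defs
  open import Data.Empty using (⊥-elim)
  open import Data.Nat as ℕ using (ℕ; zero; suc)
  import Data.Nat.Properties as ℕ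
  open import Data.Integer using (ℤ)
  import Data.Integer.Properties as ℤ
  open import Data.Integer.Solver using (module +-*-Solver)
  open +-*-Solver using (solve; _:+_; _:*_; _:-_; _:=_; con)
  open import Algebra.Properties.Semiring.Sum ℤ.+-*-semiring using (sum; sum-cong-≗)
  open import Data.Fin as Fin using (Fin; zero; suc)
  import Data.Fin.Properties as Fin
  open import Data.Vec using (Vec; []; _∷_; lookup; tabulate; map)
  open import Data.Vec.Properties using (lookup∘tabulate)
  open import Data.Product using (_,_; proj₁; proj₂)
  open import Function using (_∘_)
  open import Function.Bundles using (Equivalence; _⇔_)
  open import Relation.Binary.PropositionalEquality using (_≡_; refl; sym; trans; cong; cong₂; subst; module ≡-Reasoning)

  open import Data.List as List using (List; []; _∷_; length; cartesianProductWith)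
  import Data.List.Properties as List
  open import Data.List.Membership.Propositional as List using () renaming (_∈_ to _∈ₗ_)
  import Data.List.Membership.Propositional.Properties as List
  open import Data.List.Relation.Unary.Any as Any using (here)
  import Data.List.Relation.Unary.Any.Properties as Any
  open import Data.List.Relation.Unary.Unique.Propositional using (Unique; []; _∷_)
  import Data.List.Relation.Unary.Unique.Propositional.Properties as Unique
  import Data.List.Relation.Unary.All as All
  open import Data.Vec.Properties using (∷-injective)

  open Admissible
  open IntSchubitope

  private variable
    n m : ℕ
    A B : Set

  unique-lookup-injective : {xs : List A} → Unique xs → ∀ i j → List.lookup xs i ≡ List.lookup xs j → i ≡ j
  unique-lookup-injective (x∉ ∷ xs!) zero    zero    eq = refl
  unique-lookup-injective (x∉ ∷ xs!) zero    (suc j) eq = ⊥-elim (All.lookup x∉ (List.∈-lookup j) eq)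
  unique-lookup-injective (x∉ ∷ xs!) (suc i) zero    eq = ⊥-elim (All.lookup x∉ (List.∈-lookup i) (sym eq))
  unique-lookup-injective (x∉ ∷ xs!) (suc i) (suc j) eq = cong suc (unique-lookup-injective xs! i j eq)

  unique-injection-≤ : {xs : List A} {ys : List B} → Unique xs → (f : A → B) →
    (∀ {x} → x ∈ₗ xs → f x ∈ₗ ys) → (∀ {x y} → x ∈ₗ xs → y ∈ₗ xs → f x ≡ f y → x ≡ y) →
    length xs ℕ.≤ length ys
  unique-injection-≤ {xs = xs} {ys} xs! f f∈ f-inj = Fin.injective⇒≤ {f = position} position-inj
    where
    fx∈ : ∀ i → f (List.lookup xs i) ∈ₗ ys
    fx∈ i = f∈ (List.∈-lookup i)
    position : Fin (length xs) → Fin (length ys)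
    position i = Any.index (fx∈ i)
    position-inj : ∀ {i j} → position i ≡ position j → i ≡ j
    position-inj {i} {j} eq = unique-lookup-injective xs! i j (f-inj (List.∈-lookup i) (List.∈-lookup j)
      (trans (Any.lookup-index (fx∈ i)) (trans (cong (List.lookup ys) eq) (sym (Any.lookup-index (fx∈ j))))))

  tuples : (Fin m → List A) → List (Vec A m)
  tuples {zero}  L = [] ∷ []
  tuples {suc m} L = cartesianProductWith _∷_ (L zero) (tuples (L ∘ suc))

  length-cartesianProductWith : {C : Set} (f : A → B → C) (xs : List A) (ys : List B) →
    length (cartesianProductWith f xs ys) ≡ length xs ℕ.* length ys
  length-cartesianProductWith f []       ys = refl
  length-cartesianProductWith f (x ∷ xs) ys = trans (List.length-++ (List.map (f x) ys))
    (cong₂ ℕ._+_ (List.length-map (f x) ys) (length-cartesianProductWith f xs ys))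

  length-tuples : (L : Fin m → List A) → length (tuples L) ≡ prodℕ (λ i → length (L i))
  length-tuples {zero}  L = refl
  length-tuples {suc m} L = trans (length-cartesianProductWith _∷_ (L zero) (tuples (L ∘ suc)))
    (cong (length (L zero) ℕ.*_) (length-tuples (L ∘ suc)))

  tuples-unique : {L : Fin m → List A} → (∀ i → Unique (L i)) → Unique (tuples L)
  tuples-unique {zero}  L! = All.[] ∷ []
  tuples-unique {suc m} L! = Unique.cartesianProductWith⁺ _∷_ ∷-injective (L! zero) (tuples-unique (L! ∘ suc))

  ∈-tuples⁺ : {L : Fin m → List A} {xs : Vec A m} → (∀ i → lookup xs i ∈ₗ L i) → xs ∈ₗ tuples L
  ∈-tuples⁺ {zero}  {xs = []}    xs∈ = here refl
  ∈-tuples⁺ {suc m} {xs = _ ∷ _} xs∈ = List.∈-cartesianProductWith⁺ _∷_ (xs∈ zero) (∈-tuples⁺ (xs∈ ∘ suc))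

  ∈-tuples⁻ : {L : Fin m → List A} {xs : Vec A m} → xs ∈ₗ tuples L → ∀ i → lookup xs i ∈ₗ L i
  ∈-tuples⁻ {suc m} {L = L} xs∈ i with List.∈-cartesianProductWith⁻ _∷_ (L zero) (tuples (L ∘ suc)) xs∈
  ∈-tuples⁻ {suc m} {L = L} xs∈ zero    | _ , _ , x∈ , _   , refl = x∈
  ∈-tuples⁻ {suc m} {L = L} xs∈ (suc i) | _ , _ , _  , xs∈′ , refl = ∈-tuples⁻ xs∈′ i

  CountsMultiply : Diagram n → Set
  CountsMultiply {n} D = ∀ (t N : ℕ) (Ns : Fin n → ℕ) →
    HasLatticeCount (InDilatedSchubitope D t) N →
    (∀ j → HasLatticeCount (InDilatedMatroidPolytope (D j) t) (Ns j)) →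
    N ≡ prodℕ Ns

  prodℕ-cong : {f g : Fin m → ℕ} → (∀ i → f i ≡ g i) → prodℕ f ≡ prodℕ g
  prodℕ-cong {zero}  f≗g = refl
  prodℕ-cong {suc m} f≗g = cong₂ ℕ._*_ (f≗g zero) (prodℕ-cong (f≗g ∘ suc))

  -- Two injections between duplicate-free lists: `split` is injective because the components sum to
  -- v, and `join` because the columns of a sum are unique.
  exclusive⇒countsMultiply : (D : Diagram n) → Exclusive D → CountsMultiply D
  exclusive⇒countsMultiply {n} D excl t N Ns (vs , vs! , vs-length , vs∈) counts = begin
    N                                ≡⟨ sym vs-length ⟩
    length vs                        ≡⟨ ℕ.≤-antisym
      (unique-injection-≤ vs! split (λ {v} → split-∈ {v}) (λ {v} {w} → split-injective {v} {w}))
      (unique-injection-≤ (tuples-unique (λ j → proj₁ (proj₂ (counts j)))) join join-∈ join-injective) ⟩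
    length (tuples ws)               ≡⟨ length-tuples ws ⟩
    prodℕ (λ j → length (ws j))      ≡⟨ prodℕ-cong (λ j → proj₁ (proj₂ (proj₂ (counts j)))) ⟩
    prodℕ Ns                         ∎
    where
    open ≡-Reasoning
    ws : Fin n → List (Vec ℤ n)
    ws j = proj₁ (counts j)

    ∈ws⇔ : ∀ j {w} → (w ∈ₗ ws j) ⇔ InDilatedMatroidPolytope (D j) t (map ℤ→ℚ w)
    ∈ws⇔ j {w} = proj₂ (proj₂ (proj₂ (counts j))) w

    ∈vs⇒ : ∀ {v} → v ∈ₗ vs → IntSchubitope D t v
    ∈vs⇒ {v} v∈ = Equivalence.to (schubitope-lattice D t v) (Equivalence.to (vs∈ v) v∈)

    split : Vec ℤ n → Vec (Vec ℤ n) n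
    split v = tabulate (λ j → differences n (component D t (prefix v) j))

    join : Vec (Vec ℤ n) n → Vec ℤ n
    join u = ∑ᵥ (lookup u)

    split-∈ : ∀ {v} → v ∈ₗ vs → split v ∈ₗ tuples ws
    split-∈ {v} v∈ = ∈-tuples⁺ λ j → subst (_∈ₗ ws j) (sym (lookup∘tabulate _ j))
      (Equivalence.from (∈ws⇔ j) (admissible⇒hull (D j) t (differences n (component D t (prefix v) j))
        (admissible-differences (component-admissible (∈vs⇒ v∈) excl j))))

    prefix-split : ∀ {v} → v ∈ₗ vs → ∀ {k} → k ℕ.≤ n → prefix v k ≡ sum (λ j → prefix (lookup (split v) j) k)
    prefix-split {v} v∈ {k} k≤n = trans (sym (sum-component D excl t (prefix v) (excess≡0 (∈vs⇒ v∈) k)))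
      (sum-cong-≗ λ j → sym (trans (cong (λ w → prefix w k) (lookup∘tabulate _ j))
        (prefix-differences (component D t (prefix v) j) (start (component-admissible (∈vs⇒ v∈) excl j)) k≤n)))

    split-injective : ∀ {v w} → v ∈ₗ vs → w ∈ₗ vs → split v ≡ split w → v ≡ w
    split-injective v∈ w∈ eq = prefix-injective λ {k} k≤n → trans (prefix-split v∈ k≤n)
      (trans (cong (λ u → sum (λ j → prefix (lookup u j) k)) eq) (sym (prefix-split w∈ k≤n)))

    columns-admissible : ∀ {u} → u ∈ₗ tuples ws → ∀ j → Admissible (D j) t (prefix (lookup u j))
    columns-admissible {u} u∈ j = hull⇒admissible {v = lookup u j} (Equivalence.to (∈ws⇔ j) (∈-tuples⁻ {xs = u} u∈ j))

    join-∈ : ∀ {u} → u ∈ₗ tuples ws → join u ∈ₗ vs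
    join-∈ {u} u∈ = Equivalence.from (vs∈ (join u)) (Equivalence.from (schubitope-lattice D t (join u))
      (schubitope-∑ᵥ (lookup u) (columns-admissible u∈)))

    join-injective : ∀ {u u′} → u ∈ₗ tuples ws → u′ ∈ₗ tuples ws → join u ≡ join u′ → u ≡ u′
    join-injective {u} {u′} u∈ u′∈ eq = lookup-ext λ j → prefix-injective λ {k} k≤n → trans
      (component-unique D excl t {F = prefix (join u)} (λ j → prefix (lookup u j)) (columns-admissible u∈) k≤n (sym (prefix-∑ᵥ (lookup u) k≤n)) j)
      (trans (cong (λ v → component D t (prefix v) j k) eq)
        (sym (component-unique D excl t {F = prefix (join u′)} (λ j → prefix (lookup u′ j)) (columns-admissible u′∈) k≤n (sym (prefix-∑ᵥ (lookup u′) k≤n)) j)))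

open PointCounts

-- Existence and growth of the lattice point counts.

module Growth where
  open import Defs
  open import Data.Bool using (true; false; if_then_else_)
  open import Data.Nat as ℕ using (ℕ; zero; suc; z≤n; s≤s)
  import Data.Nat.Properties as ℕ
  open import Data.Integer as ℤ using (ℤ; +_; 0ℤ; 1ℤ; +≤+; _+_; _-_; _*_; _≤_)
  import Data.Integer.Properties as ℤ
  open import Data.Integer.Solver using (module +-*-Solver)
  import Data.Nat.Solver
  module ℕSolver = Data.Nat.Solver.+-*-Solver
  open +-*-Solver using (solve; _:+_; _:*_; _:-_; _:=_; con)
  open import Algebra.Properties.Semiring.Sum ℤ.+-*-semiring using (sum)
  open import Data.Rational using (ℚ)
  open import Data.Fin as Fin using (Fin; zero; suc; toℕ)
  open import Data.Fin.Properties as Fin using (toℕ<n; any?)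
  open import Data.Fin.Subset using (Subset; ∣_∣; ⁅_⁆)
  open import Data.Vec using (Vec; lookup; tabulate; map)
  open import Data.Vec.Properties using (lookup∘tabulate)
  open import Data.Product using (∃; _×_; _,_; proj₁; proj₂)
  open import Data.Sum using (inj₁; inj₂)
  open import Function using (_∘_)
  open import Function.Bundles using (Equivalence; _⇔_; mk⇔)
  open import Relation.Nullary using (¬_; Dec; yes; no; does)
  open import Relation.Nullary.Decidable using (dec-true; dec-false)
  open import Relation.Binary.PropositionalEquality using (_≡_; _≢_; refl; sym; trans; cong; cong₂; subst; subst₂; module ≡-Reasoning)

  open import Data.List as List using (List; length; upTo)
  import Data.List.Properties as List
  open import Data.List.Membership.Propositional as List using () renaming (_∈_ to _∈ₗ_)
  import Data.List.Membership.Propositional.Properties as List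
  open import Data.List.Relation.Unary.Unique.Propositional using (Unique)
  import Data.List.Relation.Unary.Unique.Propositional.Properties as Unique

  open Admissible
  open IntSchubitope

  open import Data.Fin.Subset.Properties using (anySubset?)
  open import Relation.Nullary.Decidable using (map′; _×-dec_; ¬?)

  open import Algebra.Properties.CommutativeMonoid.Sum ℕ.*-1-commutativeMonoid using () renaming (sum to ∏; ∑-comm to ∏-comm)

  private variable
    n m : ℕ

  admissible? : (S : Subset n) (t : ℕ) (F : ℕ → ℤ) → Dec (Admissible S t F)
  admissible? {n} S t F = map′
    (λ (s , i , l , d , e) → record
      { start = s ; increases = i ; slope≤ = l ; end = e
      ; dominates = λ {k} k≤n → subst (λ k → + t * + count S k ≤ F k) (Fin.toℕ-fromℕ< (s≤s k≤n)) (d (Fin.fromℕ< (s≤s k≤n))) })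
    (λ adm → start adm , increases adm , slope≤ adm , (λ k → dominates adm (ℕ.≤-pred (toℕ<n k))) , end adm)
    (F 0 ℤ.≟ 0ℤ ×-dec Fin.all? (λ i → F (toℕ i) ℤ.≤? F (suc (toℕ i)))
      ×-dec Fin.all? (λ i → F (suc (toℕ i)) ℤ.≤? F (toℕ i) + + t)
      ×-dec Fin.all? {suc n} (λ k → + t * + count S (toℕ k) ℤ.≤? F (toℕ k))
      ×-dec F n ℤ.≟ + t * + ∣ S ∣)

  intSchubitope? : (D : Diagram n) (t : ℕ) (v : Vec ℤ n) → Dec (IntSchubitope D t v)
  intSchubitope? {n} D t v = map′
    (λ (p , s , b) → record { nonneg = p ; total = s ; bound = λ I → ℤ.≮⇒≥ (λ lt → b (I , lt)) })
    (λ v∈ → nonneg v∈ , total v∈ , λ (I , lt) → ℤ.<⇒≱ lt (bound v∈ I))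
    (Fin.all? (λ i → 0ℤ ℤ.≤? lookup v i) ×-dec prefix v n ℤ.≟ + t * + size D
      ×-dec ¬? (anySubset? (λ I → + t * + θ D I ℤ.<? over I v)))

  -- A bounded decidable set of integer points is enumerated by filtering the box of all vectors
  -- with entries from 0 to b.
  latticeCount-exists : {P : Vec ℚ n → Set} {Q : Vec ℤ n → Set} → (∀ v → Q v ⇔ P (map ℤ→ℚ v)) → (∀ v → Dec (Q v)) →
    (b : ℕ) → (∀ v → Q v → ∀ i → 0ℤ ≤ lookup v i × lookup v i ≤ + b) → ∃ λ N → HasLatticeCount P N
  latticeCount-exists {n} {P} {Q} Q⇔P Q? b bounded = length points , points , Unique.filter⁺ Q? box! , refl , λ v → mk⇔
    (λ v∈ → Equivalence.to (Q⇔P v) (proj₂ (List.∈-filter⁻ Q? {xs = box} v∈)))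
    (λ Pv → let Qv = Equivalence.from (Q⇔P v) Pv in List.∈-filter⁺ Q? (∈-tuples⁺ (λ i → in-range (bounded v Qv i))) Qv)
    where
    range : List ℤ
    range = List.map +_ (upTo (suc b))
    in-range : ∀ {a} → 0ℤ ≤ a × a ≤ + b → a ∈ₗ range
    in-range (+≤+ _ , +≤+ a≤b) = List.∈-map⁺ +_ (List.∈-upTo⁺ (s≤s a≤b))
    box points : List (Vec ℤ n)
    box = tuples (λ _ → range)
    points = List.filter Q? box
    box! : Unique box
    box! = tuples-unique (λ _ → Unique.map⁺ ℤ.+-injective (Unique.upTo⁺ (suc b)))

  schubitopeCount-exists : (D : Diagram n) (t : ℕ) → ∃ λ N → HasLatticeCount (InDilatedSchubitope D t) N
  schubitopeCount-exists D t = latticeCount-exists {P = InDilatedSchubitope D t}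
    (λ v → mk⇔ (Equivalence.from (schubitope-lattice D t v)) (Equivalence.to (schubitope-lattice D t v)))
    (intSchubitope? D t) (t ℕ.* size D)
    λ v v∈ i → nonneg v∈ i , (begin
      lookup v i                 ≡⟨ sym (over-⁅⁆ i v) ⟩
      over ⁅ i ⁆ v               ≤⟨ bound v∈ ⁅ i ⁆ ⟩
      + t * + θ D ⁅ i ⁆          ≤⟨ scale t (sumℕ-mono (λ j → θ≤∣S∣ (D j) ⁅ i ⁆)) ⟩
      + t * + size D             ≡⟨ sym (ℤ.pos-* t (size D)) ⟩
      + (t ℕ.* size D)           ∎)
    where open ℤ.≤-Reasoning

  matroidCount-exists : (S : Subset n) (t : ℕ) → ∃ λ N → HasLatticeCount (InDilatedMatroidPolytope S t) N
  matroidCount-exists S t = latticeCount-exists {P = InDilatedMatroidPolytope S t}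
    (λ v → mk⇔ (admissible⇒hull S t v) (hull⇒admissible {S = S} {t} {v}))
    (λ v → admissible? S t (prefix v)) t
    λ v adm i → admissible-≥0 v adm i , admissible-≤t v adm i

  -- Convexity in integral form: together with `admissible-*`, sums of dilates take the place of
  -- convex combinations.
  admissible-+ : {S : Subset n} {s t : ℕ} {F G : ℕ → ℤ} → Admissible S s F → Admissible S t G →
    Admissible S (s ℕ.+ t) (λ k → F k + G k)
  admissible-+ {n} {S} {s} {t} {F} {G} f g = record
    { start     = cong₂ _+_ (start f) (start g)
    ; increases = λ i → increases f i ⊹ increases g i
    ; slope≤    = λ i → ≤-by (slope≤ f i ⊹ slope≤ g i)
        (solve 6 (λ a b c d s t → a :+ b :+ (s :+ t) :- (c :+ d) := a :+ s :+ (b :+ t) :- (c :+ d)) refl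
          (F (toℕ i)) (G (toℕ i)) (F (suc (toℕ i))) (G (suc (toℕ i))) (+ s) (+ t))
    ; dominates = λ {k} k≤n → ≤-by (dominates f k≤n ⊹ dominates g k≤n)
        (solve 5 (λ a b s t c → a :+ b :- (s :+ t) :* c := a :+ b :- (s :* c :+ t :* c)) refl (F k) (G k) (+ s) (+ t) (+ count S k))
    ; end       = trans (cong₂ _+_ (end f) (end g)) (sym (ℤ.*-distribʳ-+ (+ ∣ S ∣) (+ s) (+ t)))
    }

  admissible-* : {S : Subset n} (a : ℕ) {t : ℕ} {F : ℕ → ℤ} → Admissible S t F → Admissible S (a ℕ.* t) (λ k → + a * F k)
  admissible-* {n} {S} a {t} {F} f = record
    { start     = trans (cong (λ x → + a * x) (start f)) (ℤ.*-zeroʳ (+ a))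
    ; increases = λ i → ℤ.*-monoˡ-≤-nonNeg (+ a) (increases f i)
    ; slope≤    = λ i → ℤ.≤-trans (ℤ.*-monoˡ-≤-nonNeg (+ a) (slope≤ f i))
        (ℤ.≤-reflexive (trans (ℤ.*-distribˡ-+ (+ a) (F (toℕ i)) (+ t)) (cong (λ x → + a * F (toℕ i) + x) (sym (ℤ.pos-* a t)))))
    ; dominates = λ {k} k≤n → subst (_≤ + a * F k) (at (count S k)) (ℤ.*-monoˡ-≤-nonNeg (+ a) (dominates f k≤n))
    ; end       = trans (cong (λ x → + a * x) (end f)) (at ∣ S ∣)
    }
    where
    at : ∀ c → + a * (+ t * + c) ≡ + (a ℕ.* t) * + c
    at c = trans (sym (ℤ.*-assoc (+ a) (+ t) (+ c))) (cong (_* + c) (sym (ℤ.pos-* a t)))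

  admissible-∑ : {S : Subset n} {t : ℕ} (F : Fin m → ℕ → ℤ) → (∀ i → Admissible S t (F i)) →
    Admissible S (m ℕ.* t) (λ k → sum (λ i → F i k))
  admissible-∑ {m = zero} {S} F adm = record
    { start = refl ; increases = λ _ → ℤ.≤-refl ; slope≤ = λ _ → ℤ.≤-refl
    ; dominates = λ {k} _ → ℤ.≤-reflexive (ℤ.*-zeroˡ (+ count S k)) ; end = sym (ℤ.*-zeroˡ (+ ∣ S ∣)) }
  admissible-∑ {m = suc m} F adm = admissible-+ (adm zero) (admissible-∑ (F ∘ suc) (adm ∘ suc))

  choices : Subset n → ℕ → ℕ → ℕ
  choices S M k = if does (active? S k) then suc M else 1

  choices-yes : (S : Subset n) (M k : ℕ) → Active S k → choices S M k ≡ suc M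
  choices-yes S M k act = cong (λ b → if b then suc M else 1) (dec-true (active? S k) act)

  choices-no : (S : Subset n) (M k : ℕ) → ¬ Active S k → choices S M k ≡ 1
  choices-no S M k ¬act = cong (λ b → if b then suc M else 1) (dec-false (active? S k) ¬act)

  choices-≥1 : (S : Subset n) (M k : ℕ) → 1 ℕ.≤ choices S M k
  choices-≥1 S M k with does (active? S k)
  ... | true  = s≤s z≤n
  ... | false = s≤s z≤n

  -- The prefix sum at each active k can be varied independently over M + 1 values:
  -- P(SM(S)) has dimension the number of active k.
  module _ (S : Subset n) (M : ℕ) where

    wiggle : ℕ → ℕ → ℕ → ℤ
    wiggle δ k m = + M * lowered S k m + + δ * spike k m

    -- At an active line this is M - δ copies of `lowered` plus δ copies of `lowered` with the spike
    -- added; at an inactive line δ = 0 is the only choice.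
    wiggle-admissible : ∀ {δ k} → δ ℕ.< choices S M k → Admissible S M (wiggle δ k)
    wiggle-admissible {δ} {k} δ< with active? S k
    ... | yes act = subst (λ t → Admissible S t (wiggle δ k)) t≡M
        (admissible-cong (λ {m} _ → trans
            (solve 4 (λ e d l s → e :* l :+ d :* (l :+ s) := (e :+ d) :* l :+ d :* s) refl (+ (M ℕ.∸ δ)) (+ δ) (lowered S k m) (spike k m))
            (cong (λ t → + t * lowered S k m + + δ * spike k m) (ℕ.m∸n+n≡m δ≤M)))
          (admissible-+ (admissible-* (M ℕ.∸ δ) (lowered-admissible S k)) (admissible-* δ (lowered+spike-admissible S k act))))
      where
      δ≤M : δ ℕ.≤ M
      δ≤M = ℕ.≤-pred (subst (δ ℕ.<_) (choices-yes S M k act) δ<)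
      t≡M : (M ℕ.∸ δ) ℕ.* 1 ℕ.+ δ ℕ.* 1 ≡ M
      t≡M = trans (cong₂ ℕ._+_ (ℕ.*-identityʳ (M ℕ.∸ δ)) (ℕ.*-identityʳ δ)) (ℕ.m∸n+n≡m δ≤M)
    ... | no ¬act = subst (λ t → Admissible S t (wiggle δ k)) (ℕ.*-identityʳ M)
        (admissible-cong (λ {m} _ → trans (sym (ℤ.+-identityʳ (+ M * lowered S k m)))
            (cong (λ d → + M * lowered S k m + d) (trans (sym (ℤ.*-zeroˡ (spike k m))) (cong (λ d → + d * spike k m) (sym δ≡0)))))
          (admissible-* M (lowered-admissible S k)))
      where
      δ≡0 : δ ≡ 0
      δ≡0 = ℕ.n<1⇒n≡0 (subst (δ ℕ.<_) (choices-no S M k ¬act) δ<)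

    wiggled : Vec ℕ n → Vec ℤ n
    wiggled δ = differences n (λ m → sum (λ i → wiggle (lookup δ i) (toℕ i) m))

    deltas : List (Vec ℕ n)
    deltas = tuples (λ i → upTo (choices S M (toℕ i)))

    ∑wiggle-admissible : ∀ {δ} → δ ∈ₗ deltas → Admissible S (n ℕ.* M) (λ m → sum (λ i → wiggle (lookup δ i) (toℕ i) m))
    ∑wiggle-admissible {δ} δ∈ = admissible-∑ (λ i → wiggle (lookup δ i) (toℕ i))
      (λ i → wiggle-admissible (List.∈-upTo⁻ (∈-tuples⁻ {xs = δ} δ∈ i)))

    -- In the prefix sum at line i only the i-th summand has a spike, so its coefficient can be read
    -- off there.
    wiggled-injective : ∀ {δ ε} → δ ∈ₗ deltas → ε ∈ₗ deltas → wiggled δ ≡ wiggled ε → δ ≡ ε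
    wiggled-injective {δ} {ε} δ∈ ε∈ eq = lookup-ext λ i → ℤ.+-injective
      (≡-by (sym (sum-except {f = terms δ i} {g = terms ε i} i (λ i′ i′≢i →
          cong (λ x → + M * lowered S (toℕ i′) (toℕ i) + x) (trans (spike-0 i i′ i′≢i (lookup δ i′)) (sym (spike-0 i i′ i′≢i (lookup ε i′)))))))
        (trans (solve 5 (λ s l d e M → e :- d := s :+ (M :* l :+ e :* con 1ℤ) :- (s :+ (M :* l :+ d :* con 1ℤ))) refl
            (sum (terms δ i)) (lowered S (toℕ i) (toℕ i)) (+ lookup δ i) (+ lookup ε i) (+ M))
          (cong₂ (λ x s → sum (terms δ i) + (+ M * lowered S (toℕ i) (toℕ i) + + lookup ε i * x) - (s + (+ M * lowered S (toℕ i) (toℕ i) + + lookup δ i * x)))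
            (sym (spike-1 i)) (sums≡ i))))
      where
      terms : Vec ℕ n → Fin n → Fin n → ℤ
      terms δ i i′ = wiggle (lookup δ i′) (toℕ i′) (toℕ i)
      spike-0 : ∀ (i i′ : Fin n) → i′ ≢ i → ∀ d → + d * spike (toℕ i′) (toℕ i) ≡ 0ℤ
      spike-0 i i′ i′≢i d = trans (cong (λ b → + d * + (if b then 1 else 0)) (dec-false (toℕ i ℕ.≟ toℕ i′) (i′≢i ∘ sym ∘ Fin.toℕ-injective))) (ℤ.*-zeroʳ (+ d))
      spike-1 : ∀ (i : Fin n) → spike (toℕ i) (toℕ i) ≡ 1ℤ
      spike-1 i = cong (λ b → + (if b then 1 else 0)) (dec-true (toℕ i ℕ.≟ toℕ i) refl)
      prefix-wiggled : ∀ {δ} → δ ∈ₗ deltas → ∀ i → prefix (wiggled δ) (toℕ i) ≡ sum (terms δ i)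
      prefix-wiggled {δ} δ∈ i = prefix-differences (λ m → sum (λ i → wiggle (lookup δ i) (toℕ i) m)) (start (∑wiggle-admissible {δ} δ∈)) (ℕ.<⇒≤ (toℕ<n i))
      sums≡ : ∀ i → sum (terms δ i) ≡ sum (terms ε i)
      sums≡ i = trans (sym (prefix-wiggled {δ} δ∈ i)) (trans (cong (λ v → prefix v (toℕ i)) eq) (prefix-wiggled {ε} ε∈ i))

    matroidCount-≥ : ∀ {N} → HasLatticeCount (InDilatedMatroidPolytope S (n ℕ.* M)) N →
      prodℕ (λ (i : Fin n) → choices S M (toℕ i)) ℕ.≤ N
    matroidCount-≥ {N} (vs , _ , refl , vs∈) = subst (ℕ._≤ length vs)
      (trans (length-tuples {m = n} _) (prodℕ-cong {n} (λ i → List.length-upTo (choices S M (toℕ i)))))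
      (unique-injection-≤ (tuples-unique {m = n} (λ i → Unique.upTo⁺ (choices S M (toℕ i)))) wiggled
        (λ {δ} δ∈ → Equivalence.from (vs∈ (wiggled δ)) (admissible⇒hull S (n ℕ.* M) (wiggled δ)
          (admissible-differences (∑wiggle-admissible {δ} δ∈))))
        (λ {δ} {ε} → wiggled-injective {δ} {ε}))

  -- Per unit of t, the distance between the lower bound `excess-≥0` and the upper bound
  -- `prefix≤θ-below` on the prefix sum at line k.
  slack : Diagram n → ℕ → ℕ
  slack {n} D k = θ D (below n k) ℕ.∸ boxesAbove D k

  slack≡0 : (D : Diagram n) (k : ℕ) → (∀ j → ¬ Active (D j) k) → slack D k ≡ 0
  slack≡0 D k ¬act = ℕ.m≤n⇒m∸n≡0 (sumℕ-mono (λ j → θ-below-inactive (D j) k (¬act j)))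

  slack≤size : (D : Diagram n) (k : ℕ) → slack D k ℕ.≤ size D
  slack≤size {n} D k = ℕ.≤-trans (ℕ.m∸n≤m _ (boxesAbove D k)) (sumℕ-mono (λ j → θ≤∣S∣ (D j) (below n k)))

  ∣excess∣≤ : {D : Diagram n} {t : ℕ} {v : Vec ℤ n} → IntSchubitope D t v → ∀ k →
    ℤ.∣ excess D t (prefix v) k ∣ ℕ.≤ t ℕ.* slack D k
  ∣excess∣≤ {n} {D} {t} {v} v∈ k = ℤ.drop‿+≤+ (subst₂ _≤_ (sym (ℤ.0≤i⇒+∣i∣≡i (excess-≥0 v∈ k))) (sym (ℤ.pos-* t (slack D k)))
    (≤-by (prefix≤θ-below v∈ k ⊹ scale t (ℕ.m≤n+m∸n (θ D (below n k)) (boxesAbove D k)))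
      (solve 5 (λ t θ C s p → t :* s :- (p :- t :* C) := t :* θ :+ t :* (C :+ s) :- (p :+ t :* θ)) refl
        (+ t) (+ θ D (below n k)) (+ boxesAbove D k) (+ slack D k) (prefix v k))))

  schubitopeCount-≤ : (D : Diagram n) (t : ℕ) {N : ℕ} → HasLatticeCount (InDilatedSchubitope D t) N →
    N ℕ.≤ prodℕ (λ (i : Fin n) → suc (t ℕ.* slack D (toℕ i)))
  schubitopeCount-≤ {n} D t (vs , vs! , refl , vs∈) = subst (length vs ℕ.≤_)
    (trans (length-tuples ranges) (prodℕ-cong {n} (λ i → List.length-upTo (suc (t ℕ.* slack D (toℕ i))))))
    (unique-injection-≤ vs! excesses
      (λ {v} v∈ → ∈-tuples⁺ λ i → subst (_∈ₗ ranges i) (sym (lookup∘tabulate _ i)) (List.∈-upTo⁺ (s≤s (∣excess∣≤ (∈vs⇒ v∈) (toℕ i)))))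
      (λ {v} {w} → excesses-injective {v} {w}))
    where
    ranges : Fin n → List ℕ
    ranges i = upTo (suc (t ℕ.* slack D (toℕ i)))
    excesses : Vec ℤ n → Vec ℕ n
    excesses v = tabulate (λ i → ℤ.∣ excess D t (prefix v) (toℕ i) ∣)
    ∈vs⇒ : ∀ {v} → v ∈ₗ vs → IntSchubitope D t v
    ∈vs⇒ {v} v∈ = Equivalence.to (schubitope-lattice D t v) (Equivalence.to (vs∈ v) v∈)
    excesses-injective : ∀ {v w} → v ∈ₗ vs → w ∈ₗ vs → excesses v ≡ excesses w → v ≡ w
    excesses-injective {v} {w} v∈ w∈ eq = prefix-injective prefix≡
      where
      excess≡ : ∀ i → excess D t (prefix v) (toℕ i) ≡ excess D t (prefix w) (toℕ i)
      excess≡ i = trans (sym (ℤ.0≤i⇒+∣i∣≡i (excess-≥0 (∈vs⇒ v∈) (toℕ i))))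
        (trans (cong +_ (trans (sym (lookup∘tabulate _ i)) (trans (cong (λ e → lookup e i) eq) (lookup∘tabulate _ i))))
          (ℤ.0≤i⇒+∣i∣≡i (excess-≥0 (∈vs⇒ w∈) (toℕ i))))
      prefix≡ : ∀ {k} → k ℕ.≤ n → prefix v k ≡ prefix w k
      prefix≡ {k} k≤n with ℕ.m≤n⇒m<n∨m≡n k≤n
      ... | inj₂ refl = trans (total (∈vs⇒ v∈)) (sym (total (∈vs⇒ w∈)))
      ... | inj₁ k<n  = subst (λ k → prefix v k ≡ prefix w k) (Fin.toℕ-fromℕ< k<n)
        (≡-by (excess≡ (Fin.fromℕ< k<n)) (solve 3 (λ a b c → b :- a := b :- c :- (a :- c)) refl
          (prefix v (toℕ (Fin.fromℕ< k<n))) (prefix w (toℕ (Fin.fromℕ< k<n))) (+ t * + boxesAbove D (toℕ (Fin.fromℕ< k<n)))))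

  prodℕ≡∏ : (f : Fin m → ℕ) → prodℕ f ≡ ∏ f
  prodℕ≡∏ {zero}  f = refl
  prodℕ≡∏ {suc m} f = cong (f zero ℕ.*_) (prodℕ≡∏ (f ∘ suc))

  prodℕ-comm : (f : Fin m → Fin n → ℕ) → prodℕ (λ i → prodℕ (f i)) ≡ prodℕ (λ j → prodℕ (λ i → f i j))
  prodℕ-comm {m} {n} f = begin
    prodℕ (λ i → prodℕ (f i))           ≡⟨ prodℕ-cong (λ i → prodℕ≡∏ (f i)) ⟩
    prodℕ (λ i → ∏ (f i))               ≡⟨ prodℕ≡∏ (λ i → ∏ (f i)) ⟩
    ∏ (λ i → ∏ (f i))                   ≡⟨ ∏-comm f ⟩
    ∏ (λ j → ∏ (λ i → f i j))           ≡⟨ sym (prodℕ≡∏ (λ j → ∏ (λ i → f i j))) ⟩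
    prodℕ (λ j → ∏ (λ i → f i j))       ≡⟨ prodℕ-cong (λ j → sym (prodℕ≡∏ (λ i → f i j))) ⟩
    prodℕ (λ j → prodℕ (λ i → f i j))   ∎
    where open ≡-Reasoning

  prodℕ-mono : {f g : Fin m → ℕ} → (∀ i → f i ℕ.≤ g i) → prodℕ f ℕ.≤ prodℕ g
  prodℕ-mono {zero}  f≤g = ℕ.≤-refl
  prodℕ-mono {suc m} f≤g = ℕ.*-mono-≤ (f≤g zero) (prodℕ-mono (f≤g ∘ suc))

  prodℕ-≥1 : {f : Fin m → ℕ} → (∀ i → 1 ℕ.≤ f i) → 1 ℕ.≤ prodℕ f
  prodℕ-≥1 {zero}  1≤f = ℕ.≤-refl
  prodℕ-≥1 {suc m} 1≤f = ℕ.*-mono-≤ (1≤f zero) (prodℕ-≥1 (1≤f ∘ suc))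

  prodℕ-≥ : {f : Fin m → ℕ} → (∀ i → 1 ℕ.≤ f i) → ∀ i → f i ℕ.≤ prodℕ f
  prodℕ-≥ {suc m} {f} 1≤f zero    = subst (ℕ._≤ prodℕ f) (ℕ.*-identityʳ (f zero)) (ℕ.*-monoʳ-≤ (f zero) (prodℕ-≥1 (1≤f ∘ suc)))
  prodℕ-≥ {suc m} {f} 1≤f (suc i) = subst (ℕ._≤ prodℕ f) (ℕ.*-identityˡ (f (suc i))) (ℕ.*-mono-≤ (1≤f zero) (prodℕ-≥ (1≤f ∘ suc) i))

  prodℕ-≥² : {f : Fin m → ℕ} → (∀ i → 1 ℕ.≤ f i) → ∀ {i j} → i Fin.< j → f i ℕ.* f j ℕ.≤ prodℕ f
  prodℕ-≥² {suc m} {f} 1≤f {zero}  {suc j} _         = ℕ.*-monoʳ-≤ (f zero) (prodℕ-≥ (1≤f ∘ suc) j)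
  prodℕ-≥² {suc m} {f} 1≤f {suc i} {suc j} (s≤s i<j) = subst (ℕ._≤ prodℕ f) (ℕ.*-identityˡ (f (suc i) ℕ.* f (suc j)))
    (ℕ.*-mono-≤ (1≤f zero) (prodℕ-≥² (1≤f ∘ suc) i<j))

  private
    *-swap : ∀ a b c d → (a ℕ.* b) ℕ.* (c ℕ.* d) ≡ (a ℕ.* c) ℕ.* (b ℕ.* d)
    *-swap a b c d = ℕSolver.solve 4 (λ a b c d → (a ℕSolver.:* b) ℕSolver.:* (c ℕSolver.:* d) ℕSolver.:= (a ℕSolver.:* c) ℕSolver.:* (b ℕSolver.:* d)) refl a b c d

  prodℕ-≤-scaled : {A B : Fin m → ℕ} (G : ℕ) → (∀ k → B k ℕ.≤ G ℕ.* A k) → prodℕ B ℕ.≤ G ℕ.^ m ℕ.* prodℕ A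
  prodℕ-≤-scaled {zero}          G B≤ = ℕ.≤-refl
  prodℕ-≤-scaled {suc m} {A} {B} G B≤ = ℕ.≤-trans (ℕ.*-mono-≤ (B≤ zero) (prodℕ-≤-scaled G (B≤ ∘ suc)))
    (ℕ.≤-reflexive (*-swap G (A zero) (G ℕ.^ m) (prodℕ (A ∘ suc))))

  -- A gain of c at one index survives in the product, as every index, this one included, loses only
  -- a factor G.
  prodℕ-≤-scaled-at : {A B : Fin m → ℕ} (G c : ℕ) → (∀ k → B k ℕ.≤ G ℕ.* A k) → (k : Fin m) → c ℕ.* B k ℕ.≤ G ℕ.* A k →
    c ℕ.* prodℕ B ℕ.≤ G ℕ.^ m ℕ.* prodℕ A
  prodℕ-≤-scaled-at {suc m} {A} {B} G c B≤ zero    cB≤ = subst₂ ℕ._≤_ (ℕ.*-assoc c (B zero) (prodℕ (B ∘ suc)))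
    (*-swap G (A zero) (G ℕ.^ m) (prodℕ (A ∘ suc)))
    (ℕ.*-mono-≤ cB≤ (prodℕ-≤-scaled G (B≤ ∘ suc)))
  prodℕ-≤-scaled-at {suc m} {A} {B} G c B≤ (suc k) cB≤ = subst₂ ℕ._≤_
    (ℕSolver.solve 3 (λ b c p → b ℕSolver.:* (c ℕSolver.:* p) ℕSolver.:= c ℕSolver.:* (b ℕSolver.:* p)) refl (B zero) c (prodℕ (B ∘ suc)))
    (*-swap G (A zero) (G ℕ.^ m) (prodℕ (A ∘ suc)))
    (ℕ.*-mono-≤ (B≤ zero) (prodℕ-≤-scaled-at G c (B≤ ∘ suc) k cB≤))

  -- The dilate t = n M is taken with M = G^n. If k₀ is active for two columns, the
  -- product of the matroid counts is at least M + 1 times larger than the bound on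
  -- the Schubitope count, up to the constant factor G^n.
  countsMultiply⇒noOverlap : (D : Diagram n) → CountsMultiply D → ∀ k i j → i Fin.< j →
    Active (D i) k → ¬ Active (D j) k
  countsMultiply⇒noOverlap {n} D multiply k₀ i j i<j acti actj = ℕ.<⇒≱ M<M+1 (ℕ.*-cancelʳ-≤ (suc M) M N {{ℕ.>-nonZero 1≤N}} (begin
    suc M ℕ.* N               ≤⟨ ℕ.*-monoʳ-≤ (suc M) (schubitopeCount-≤ D t N-count) ⟩
    suc M ℕ.* prodℕ B         ≤⟨ prodℕ-≤-scaled-at G (suc M) B≤GA k₀′ B₀≤GA ⟩
    M ℕ.* prodℕ A             ≤⟨ ℕ.*-monoʳ-≤ M A≤N ⟩
    M ℕ.* N                   ∎))
    where
    open ℕ.≤-Reasoning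
    G M t N : ℕ
    -- Chosen so that every `B k` is at most G (M + 1), as the slack is at most `size D`. Losing G
    -- at each of the n lines costs G^n = M in total, which the extra factor M + 1 beats.
    G = suc (n ℕ.* size D)
    M = G ℕ.^ n
    t = n ℕ.* M
    M<M+1 : M ℕ.< suc M
    M<M+1 = ℕ.n<1+n M
    N = proj₁ (schubitopeCount-exists D t)
    N-count : HasLatticeCount (InDilatedSchubitope D t) N
    N-count = proj₂ (schubitopeCount-exists D t)
    choice : Fin n → Fin n → ℕ
    choice j k = choices (D j) M (toℕ k)
    1≤choice : ∀ k j → 1 ℕ.≤ choice j k
    1≤choice k j = choices-≥1 (D j) M (toℕ k)
    A B : Fin n → ℕ
    A k = prodℕ (λ j → choice j k)
    B k = suc (t ℕ.* slack D (toℕ k))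

    A≤N : prodℕ A ℕ.≤ N
    A≤N = begin
      prodℕ A                                               ≡⟨ sym (prodℕ-comm choice) ⟩
      prodℕ (λ j → prodℕ (choice j))                        ≤⟨ prodℕ-mono (λ j → matroidCount-≥ (D j) M (proj₂ (matroidCount-exists (D j) t))) ⟩
      prodℕ (λ j → proj₁ (matroidCount-exists (D j) t))     ≡⟨ sym (multiply t N _ N-count (λ j → proj₂ (matroidCount-exists (D j) t))) ⟩
      N                                                     ∎

    1≤N : 1 ℕ.≤ N
    1≤N = ℕ.≤-trans (prodℕ-≥1 (λ k → prodℕ-≥1 (1≤choice k))) A≤N

    B≤G*M+1 : ∀ k → B k ℕ.≤ G ℕ.* suc M
    B≤G*M+1 k = begin
      suc (n ℕ.* M ℕ.* slack D (toℕ k))              ≤⟨ s≤s (ℕ.*-monoʳ-≤ (n ℕ.* M) (slack≤size D (toℕ k))) ⟩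
      suc (n ℕ.* M ℕ.* size D)                       ≤⟨ s≤s (ℕ.m≤m+n _ (M ℕ.+ n ℕ.* size D)) ⟩
      suc (n ℕ.* M ℕ.* size D ℕ.+ (M ℕ.+ n ℕ.* size D))  ≡⟨ ℕSolver.solve 3 (λ n M s →
          ℕSolver.con 1 ℕSolver.:+ (n ℕSolver.:* M ℕSolver.:* s ℕSolver.:+ (M ℕSolver.:+ n ℕSolver.:* s))
          ℕSolver.:= (ℕSolver.con 1 ℕSolver.:+ n ℕSolver.:* s) ℕSolver.:* (ℕSolver.con 1 ℕSolver.:+ M)) refl n M (size D) ⟩
      G ℕ.* suc M                                    ∎

    B≤GA : ∀ k → B k ℕ.≤ G ℕ.* A k
    B≤GA k with any? (λ j → active? (D j) (toℕ k))
    -- One active column already supplies the factor M + 1; with none, the slack vanishes and `B k`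
    -- is 1.
    ... | yes (j , act) = ℕ.≤-trans (B≤G*M+1 k) (ℕ.*-monoʳ-≤ G
            (subst (ℕ._≤ A k) (choices-yes (D j) M (toℕ k) act) (prodℕ-≥ (1≤choice k) j)))
    ... | no ¬act = subst (ℕ._≤ G ℕ.* A k)
            (sym (cong suc (trans (cong (t ℕ.*_) (slack≡0 D (toℕ k) (λ j act → ¬act (j , act)))) (ℕ.*-zeroʳ t))))
            (ℕ.*-mono-≤ (s≤s (z≤n {n ℕ.* size D})) (prodℕ-≥1 (1≤choice k)))

    k₀<n : k₀ ℕ.< n
    k₀<n = Active⇒<n (D i) acti
    k₀′ : Fin n
    k₀′ = Fin.fromℕ< k₀<n

    choice-k₀ : ∀ j → Active (D j) k₀ → choice j k₀′ ≡ suc M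
    choice-k₀ j act = choices-yes (D j) M (toℕ k₀′) (subst (Active (D j)) (sym (Fin.toℕ-fromℕ< k₀<n)) act)

    B₀≤GA : suc M ℕ.* B k₀′ ℕ.≤ G ℕ.* A k₀′
    B₀≤GA = begin
      suc M ℕ.* B k₀′                           ≤⟨ ℕ.*-monoʳ-≤ (suc M) (B≤G*M+1 k₀′) ⟩
      suc M ℕ.* (G ℕ.* suc M)                   ≡⟨ ℕSolver.solve 2 (λ G m → m ℕSolver.:* (G ℕSolver.:* m) ℕSolver.:= G ℕSolver.:* (m ℕSolver.:* m)) refl G (suc M) ⟩
      G ℕ.* (suc M ℕ.* suc M)                   ≡⟨ cong (G ℕ.*_) (sym (cong₂ ℕ._*_ (choice-k₀ i acti) (choice-k₀ j actj))) ⟩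
      G ℕ.* (choice i k₀′ ℕ.* choice j k₀′)     ≤⟨ ℕ.*-monoʳ-≤ G (prodℕ-≥² (1≤choice k₀′) i<j) ⟩
      G ℕ.* A k₀′                               ∎

  smallOverlaps⇔countsMultiply : (D : Diagram n) → SmallOverlaps D ⇔ CountsMultiply D
  smallOverlaps⇔countsMultiply D = mk⇔
    (λ small → exclusive⇒countsMultiply D (SmallOverlaps⇒Exclusive D small))
    (λ multiply → Exclusive⇒SmallOverlaps D (countsMultiply⇒noOverlap D multiply))

open Growth

open import Defs
open import Data.Nat using (ℕ; _≥_; _≤_)
open import Data.Fin using (Fin; _<_)
open import Data.Fin.Subset using (_∩_; ∣_∣)
open import Data.Product using (_×_; _,_)
open import Function.Bundles using (_⇔_)
open import Relation.Binary.PropositionalEquality using (_≡_)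

theorem1p1 : (n : ℕ) → n ≥ 1 → (D : Diagram n) →
    (LatticeFree D ⇔ (∀ (i j : Fin n) → i < j → ∣ movable (D i) ∩ movable (D j) ∣ ≤ 1))
    × ((∀ (i j : Fin n) → i < j → ∣ movable (D i) ∩ movable (D j) ∣ ≤ 1) ⇔
    (∀ (t N : ℕ) (Ns : Fin n → ℕ) →
    HasLatticeCount (InDilatedSchubitope D t) N →
    (∀ j → HasLatticeCount (InDilatedMatroidPolytope (D j) t) (Ns j)) →
    N ≡ prodℕ Ns))
theorem1p1 n _ D = latticeFree⇔smallOverlaps D , smallOverlaps⇔countsMultiply D
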